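{- Let $\Gamma$ be a thick locally finitely chained generalized $n$-gon with $n\in\{4,6\}$, and let $\gamma:\Gamma\to\Delta$ be an epimorphism, with $\Delta$ a thin $n$-gon of order $(s,1)$. Then $s=1$, and, after a suitable naming of the points of $\Delta$, $\gamma$ is of type (a) or of type (b) (the types for $n=4$, respectively $n=6$, being those defined in the context).
   Context: Polygons. A point-line geometry is a weak generalized $n$-gon ($n\ge 3$) if any two elements (points or lines) lie in a common ordinary sub $n$-gon and there are no ordinary sub $k$-gons for $2\le k<n$; it is thick (a generalized $n$-gon) if every point is on at least three lines and every line has at least three points, and thin if it is not thick. Order $(u,v)$: each line has $u+1$ points and each point is on $v+1$ lines (possibly infinite). A morphism maps points to points, lines to lines, and preserves incidence; an epimorphism is a morphism surjective on points and on lines. $x\sim y$ means collinear; $\overline{x}\overline{y}$ is the line joining distinct collinear points. The point-line dual is obtained by interchanging points and lines. Locally finitely chained. A sub $n$-gon is a (thin or thick) weak generalized $n$-gon whose points and lines are points and lines of $\Gamma$, with induced incidence. For a point set $S$ of $\Gamma$, $\langle S\rangle$ is the intersection of all (thin and thick) sub $n$-gons containing $S$. $\Gamma$ is locally finitely chained if there is a chain of finite point subsets $S_0\subseteq S_1\subseteq\cdots\subseteq S_i\subseteq\cdots$ such that each $\langle S_j\rangle$ is a finite (possibly thin) sub $n$-gon and $\bigcup_{i\ge0}\langle S_i\rangle=\Gamma$. Type (a), $n=4$. $\Delta$ has points $\overline{a}\sim\overline{b}\sim\overline{c}\sim\overline{d}\sim\overline{a}$; write $\widetilde{X}=\gamma^{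 -1}(\overline{x})$. There is a line $L$ of $\Gamma$ such that $(\widetilde{A},\widetilde{B})$ is a partition of the points incident with $L$ into two nonempty sets; $\widetilde{C}$ (resp. $\widetilde{D}$) consists of the points not on $L$ collinear with a point of $\widetilde{B}$ (resp. $\widetilde{A}$); $\gamma^{ -1}(\overline{a}\overline{b})=\{L\}$; $\gamma^{ -1}(\overline{b}\overline{c})$ (resp. $\gamma^{ -1}(\overline{a}\overline{d})$) is the set of lines distinct from $L$ incident with a point of $\widetilde{B}$ (resp. $\widetilde{A}$); $\gamma^{ -1}(\overline{c}\overline{d})$ consists of the lines incident with at least one point of $\widetilde{C}$ and at least one point of $\widetilde{D}$. Type (a), $n=6$. $\Delta$ has points $\overline{a}\sim\overline{b}\sim\overline{c}\sim\overline{d}\sim\overline{e}\sim\overline{f}\sim\overline{a}$; write $\widetilde{X}=\gamma^{ -1}(\overline{x})$. There is a line $L$ of $\Gamma$ such that $(\widetilde{C},\widetilde{B})$ is a partition of the points incident with $L$ into two nonempty sets; $\widetilde{D}$ (resp. $\widetilde{A}$) consists of the points not on $L$ collinear with a point of $\widetilde{C}$ (resp. $\widetilde{B}$); $\widetilde{E}$ consists of the points not in $\widetilde{C}\cup\widetilde{D}$ collinear with a point of $\widetilde{D}$; $\widetilde{F}$ consists of the points not in $\widetilde{A}\cup\widetilde{B}$ collinear with a point of $\widetilde{A}$; $\gamma^{ -1}(\overline{b}\overline{c})=\{L\}$; $\gamma^{ -1}(\overline{c}\overline{d})$ (resp. $\gamma^{ -1}(\overline{a}\overline{b})$) is the set of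 lines distinct from $L$ incident with a point of $\widetilde{C}$ (resp. $\widetilde{B}$); $\gamma^{ -1}(\overline{d}\overline{e})$ is the set of lines not in $\gamma^{ -1}(\overline{c}\overline{d})$ incident with a point of $\widetilde{D}$; $\gamma^{ -1}(\overline{f}\overline{a})$ is the set of lines not in $\gamma^{ -1}(\overline{a}\overline{b})$ incident with a point of $\widetilde{A}$; $\gamma^{ -1}(\overline{f}\overline{e})$ is the set of lines not in $\gamma^{ -1}(\overline{f}\overline{a})$ incident with a point of $\widetilde{F}$ (equivalently, the lines not in $\gamma^{ -1}(\overline{d}\overline{e})$ incident with a point of $\widetilde{E}$). Type (b). $\gamma$, regarded as an epimorphism from the point-line dual of $\Gamma$ onto the point-line dual of $\Delta$, is of type (a). -}

module Defs where

open import Level using (Level; 0ℓ; _⊔_; suc)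
open import Data.Fin.Base using (Fin; toℕ)
open import Data.List.Base using ([]; _∷_)
open import Data.List.Membership.Propositional using () renaming (_∈_ to _∈ᴸ_)
open import Data.List.Relation.Unary.Unique.Propositional using (Unique)
open import Data.Maybe.Base using (Maybe)
open import Data.Nat.Base as ℕ using (ℕ)
open import Data.Nat.DivMod using (_mod_)
open import Data.Product using (∃; ∃-syntax; _×_)
open import Data.Sum.Base using (_⊎_; inj₁; inj₂)
open import Function.Base using (flip)
open import Function.Bundles using (_⇔_)
open import Function.Definitions using (Injective)
open import Relation.Binary.Core using (REL)
open import Relation.Binary.PropositionalEquality.Core using (_≡_)
open import Relation.Nullary.Negation.Core using (¬_)
open import Relation.Unary
  using (Pred; _∈_; _⊆_; _≐_; _∪_; _∩_; _⊥_; ∁; U; ｛_｝; Satisfiable)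

private
  variable
    α κ π υ ν ℓ ℓ′ : Level

-- Cardinals are represented by types.  Elements of a subset are counted, not
-- proofs of membership, so predicates need not be proof-irrelevant.
HasCardinality : {A : Set α} → Pred A π → Set κ → Set (α ⊔ π ⊔ κ)
HasCardinality P K =
  ∃[ f ] Injective {A = K} _≡_ _≡_ f × (∀ x → x ∈ P ⇔ (∃[ i ] f i ≡ x))

Finite : {A : Set α} → Pred A π → Set (α ⊔ π)
Finite P = ∃[ m ] HasCardinality P (Fin m)

AtLeast : {A : Set α} → ℕ → Pred A π → Set (α ⊔ π)
AtLeast m P = ∃[ f ] Injective {A = Fin m} _≡_ _≡_ f × (∀ i → f i ∈ P)

-- i ↦ i + 1 modulo m
next : ∀ {m} → Fin m → Fin m
next {ℕ.suc m} i = ℕ.suc (toℕ i) mod ℕ.suc m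

record Geometry (ℓ : Level) : Set (suc ℓ) where
  infix 4 _I_ _∼_
  field
    Point : Set ℓ
    Line  : Set ℓ
    _I_   : REL Point Line ℓ

  _∼_ : Point → Point → Set ℓ
  x ∼ y = ∃[ M ] x I M × y I M

  Element : Set ℓ
  Element = Point ⊎ Line

  -- For distinct collinear x and y in a polygon, M is the line xy.
  Joins : Line → Point → Point → Set ℓ
  Joins M x y = x I M × y I M

dual : Geometry ℓ → Geometry ℓ
dual Γ = record { Point = Line ; Line = Point ; _I_ = flip _I_ }
  where open Geometry Γ

module _ (Γ : Geometry ℓ) where
  open Geometry Γ

  -- point 0, line 0, point 1, line 1, ..., point (m - 1), line (m - 1), point 0.
  -- No further incidences are excluded: a chord splits the circuit into two
  -- shorter ones, so in a geometry without ordinary j-gons for 2 ≤ j < m the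
  -- circuits of this kind are exactly the induced ones.
  record OrdinaryGon (m : ℕ) : Set ℓ where
    field
      point           : Fin m → Point
      line            : Fin m → Line
      point-injective : Injective _≡_ _≡_ point
      line-injective  : Injective _≡_ _≡_ line
      point-I-line    : ∀ i → point i I line i
      next-I-line     : ∀ i → point (next i) I line i

  _LiesIn_ : ∀ {m} → Element → OrdinaryGon m → Set ℓ
  inj₁ x LiesIn G = ∃[ i ] OrdinaryGon.point G i ≡ x
  inj₂ M LiesIn G = ∃[ i ] OrdinaryGon.line G i ≡ M

  -- A set of points and a set of lines, with the incidence induced from Γ.
  record Subgeometry (ℓ′ : Level) : Set (ℓ ⊔ suc ℓ′) where
    field
      points : Pred Point ℓ′
      lines  : Pred Line ℓ′

  full : Subgeometry 0ℓ
  full = record { points = U ; lines = U }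

  module _ (Σ : Subgeometry ℓ′) where
    open Subgeometry Σ

    HasElement : Pred Element ℓ′
    HasElement (inj₁ x) = x ∈ points
    HasElement (inj₂ M) = M ∈ lines

    HasGon : ∀ {m} → OrdinaryGon m → Set ℓ′
    HasGon G = (∀ i → point i ∈ points) × (∀ i → line i ∈ lines)
      where open OrdinaryGon G

    record IsWeakSubpolygon (n : ℕ) : Set (ℓ ⊔ ℓ′) where
      field
        3≤n         : 3 ℕ.≤ n
        common-gon  : ∀ x y → HasElement x → HasElement y →
                      ∃[ G ] HasGon {n} G × x LiesIn G × y LiesIn G
        no-smaller  : ∀ m → 2 ℕ.≤ m → m ℕ.< n → (G : OrdinaryGon m) → ¬ HasGon G

    FiniteSubgeometry : Set (ℓ ⊔ ℓ′)
    FiniteSubgeometry = Finite points × Finite lines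

  IsWeakPolygon : ℕ → Set ℓ
  IsWeakPolygon n = IsWeakSubpolygon full n

  Thick : Set ℓ
  Thick = (∀ x → AtLeast 3 (λ M → x I M)) × (∀ M → AtLeast 3 (λ x → x I M))

  IsThickPolygon : ℕ → Set ℓ
  IsThickPolygon n = IsWeakPolygon n × Thick

  IsThinPolygon : ℕ → Set ℓ
  IsThinPolygon n = IsWeakPolygon n × ¬ Thick

  -- The cardinal successor of K is Maybe K.
  HasOrder : Set υ → Set ν → Set (ℓ ⊔ υ ⊔ ν)
  HasOrder s t = (∀ M → HasCardinality (λ x → x I M) (Maybe s))
               × (∀ x → HasCardinality (λ M → x I M) (Maybe t))

  ⟨_⟩ : Pred Point ℓ → ℕ → Subgeometry (suc ℓ)
  ⟨ S ⟩ n = record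
    { points = λ x → ∀ (Σ : Subgeometry ℓ) → IsWeakSubpolygon Σ n →
                     S ⊆ Subgeometry.points Σ → x ∈ Subgeometry.points Σ
    ; lines  = λ M → ∀ (Σ : Subgeometry ℓ) → IsWeakSubpolygon Σ n →
                     S ⊆ Subgeometry.points Σ → M ∈ Subgeometry.lines Σ
    }

  record LocallyFinitelyChained (n : ℕ) : Set (suc ℓ) where
    field
      S         : ℕ → Pred Point ℓ
      S-finite  : ∀ i → Finite (S i)
      ascending : ∀ i → S i ⊆ S (ℕ.suc i)
      polygon   : ∀ i → IsWeakSubpolygon (⟨ S i ⟩ n) n
      finite    : ∀ i → FiniteSubgeometry (⟨ S i ⟩ n)
      exhausts  : ∀ x → ∃[ i ] HasElement (⟨ S i ⟩ n) x

record Epimorphism (Γ Δ : Geometry ℓ) : Set ℓ where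
  private
    module Γ = Geometry Γ
    module Δ = Geometry Δ
  field
    onPoints         : Γ.Point → Δ.Point
    onLines          : Γ.Line → Δ.Line
    preserves-I      : ∀ {x M} → x Γ.I M → onPoints x Δ.I onLines M
    points-surjective : ∀ y → ∃[ x ] onPoints x ≡ y
    lines-surjective  : ∀ N → ∃[ M ] onLines M ≡ N

dualEpi : {Γ Δ : Geometry ℓ} → Epimorphism Γ Δ → Epimorphism (dual Γ) (dual Δ)
dualEpi γ = record
  { onPoints          = onLines
  ; onLines           = onPoints
  ; preserves-I       = preserves-I
  ; points-surjective = lines-surjective
  ; lines-surjective  = points-surjective
  }
  where open Epimorphism γ

module _ {Γ Δ : Geometry ℓ} (γ : Epimorphism Γ Δ) where
  open Geometry Γ
  open Epimorphism γ
  private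
    module Δ = Geometry Δ

  pointFibre : Δ.Point → Pred Point ℓ
  pointFibre y x = onPoints x ≡ y

  lineFibre : Δ.Line → Pred Line ℓ
  lineFibre N M = onLines M ≡ N

  PointsOn : Line → Pred Point ℓ
  PointsOn M x = x I M

  CollinearWith : Pred Point ℓ → Pred Point ℓ
  CollinearWith P x = ∃[ y ] y ∈ P × x ∼ y

  IncidentWith : Pred Point ℓ → Pred Line ℓ
  IncidentWith P M = ∃[ y ] y ∈ P × y I M

  record IsPartition (P Q R : Pred Point ℓ) : Set ℓ where
    field
      covers    : P ∪ Q ≐ R
      disjoint  : P ⊥ Q
      nonempty₁ : Satisfiable P
      nonempty₂ : Satisfiable Q

  record TypeA₄ : Set ℓ where
    field
      a b c d     : Δ.Point
      distinct    : Unique (a ∷ b ∷ c ∷ d ∷ [])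
      all-points  : ∀ x → x ∈ᴸ (a ∷ b ∷ c ∷ d ∷ [])
      ab bc cd ad : Δ.Line
      ab-joins    : Δ.Joins ab a b
      bc-joins    : Δ.Joins bc b c
      cd-joins    : Δ.Joins cd c d
      ad-joins    : Δ.Joins ad a d

    A : Pred Point ℓ
    A = pointFibre a
    B : Pred Point ℓ
    B = pointFibre b
    C : Pred Point ℓ
    C = pointFibre c
    D : Pred Point ℓ
    D = pointFibre d

    field
      L           : Line
      A,B-on-L    : IsPartition A B (PointsOn L)
      C-points    : C ≐ ∁ (PointsOn L) ∩ CollinearWith B
      D-points    : D ≐ ∁ (PointsOn L) ∩ CollinearWith A
      ab-lines    : lineFibre ab ≐ ｛ L ｝
      bc-lines    : lineFibre bc ≐ ∁ ｛ L ｝ ∩ IncidentWith B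
      ad-lines    : lineFibre ad ≐ ∁ ｛ L ｝ ∩ IncidentWith A
      cd-lines    : lineFibre cd ≐ IncidentWith C ∩ IncidentWith D

  record TypeA₆ : Set ℓ where
    field
      a b c d e f       : Δ.Point
      distinct          : Unique (a ∷ b ∷ c ∷ d ∷ e ∷ f ∷ [])
      all-points        : ∀ x → x ∈ᴸ (a ∷ b ∷ c ∷ d ∷ e ∷ f ∷ [])
      ab bc cd de fe fa : Δ.Line
      ab-joins          : Δ.Joins ab a b
      bc-joins          : Δ.Joins bc b c
      cd-joins          : Δ.Joins cd c d
      de-joins          : Δ.Joins de d e
      fe-joins          : Δ.Joins fe f e
      fa-joins          : Δ.Joins fa f a

    A : Pred Point ℓ
    A = pointFibre a
    B : Pred Point ℓ
    B = pointFibre b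
    C : Pred Point ℓ
    C = pointFibre c
    D : Pred Point ℓ
    D = pointFibre d
    E : Pred Point ℓ
    E = pointFibre e
    F : Pred Point ℓ
    F = pointFibre f

    field
      L           : Line
      C,B-on-L    : IsPartition C B (PointsOn L)
      D-points    : D ≐ ∁ (PointsOn L) ∩ CollinearWith C
      A-points    : A ≐ ∁ (PointsOn L) ∩ CollinearWith B
      E-points    : E ≐ ∁ (C ∪ D) ∩ CollinearWith D
      F-points    : F ≐ ∁ (A ∪ B) ∩ CollinearWith A
      bc-lines    : lineFibre bc ≐ ｛ L ｝
      cd-lines    : lineFibre cd ≐ ∁ ｛ L ｝ ∩ IncidentWith C
      ab-lines    : lineFibre ab ≐ ∁ ｛ L ｝ ∩ IncidentWith B
      de-lines    : lineFibre de ≐ ∁ (lineFibre cd) ∩ IncidentWith D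
      fa-lines    : lineFibre fa ≐ ∁ (lineFibre ab) ∩ IncidentWith A
      fe-lines    : lineFibre fe ≐ ∁ (lineFibre fa) ∩ IncidentWith F
      fe-lines′   : lineFibre fe ≐ ∁ (lineFibre de) ∩ IncidentWith E

  data TypeA : ℕ → Set ℓ where
    quadrangle : TypeA₄ → TypeA 4
    hexagon    : TypeA₆ → TypeA 6

TypeB : {Γ Δ : Geometry ℓ} → Epimorphism Γ Δ → ℕ → Set ℓ
TypeB γ n = TypeA (dualEpi γ) n

{-# OPTIONS --safe #-}
module Submission where

-- An epimorphism onto an ordinary n-gon colours the incidence graph of Γ by the
-- cyclic group of order 2n.  In a finite polygon the numbers of neighbours above and
-- below an element depend on its colour only, and the numbers above i and below the
-- antipode i + n agree.  Non-backtracking walks of length less than n are determined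
-- by their ends; counting those that rise n - 3 steps in total gives, with yₖ and xₖ
-- the numbers of neighbours above and below colour k, minus one,
--   y₀ x₁ + y₁ x₂ + ... + yₙ₋₂ xₙ₋₁ ≤ y₀ xₙ₋₁     for every choice of the colour 0.
-- As xₖ + yₖ depends on the parity of k only, this says that a random binary sequence
-- with independent entries has on average no more ascents than required by its ends.
-- Hence almost surely there is no further ascent, n - 1 consecutive yₖ vanish, and some
-- colour is taken by a single element.  Exhausting Γ by finite polygons, the same holds
-- for Γ.  For an arbitrary Δ, colour Γ through the folding of Δ around a point p, the
-- signed distance to p.  If s > 1, the single element lies over p or over a line on p,
-- for every p, and this is contradictory.  If s = 1, the fibre of γ through the single
-- element is a singleton, which determines γ: type (a) if it is a line, type (b) if it
-- is a point.

open import Defs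
open import Level using (Level; _⊔_; Lift) renaming (suc to lsuc)
open import Axiom.ExcludedMiddle using (ExcludedMiddle)
open import Data.Bool.Base using (Bool; true; false; not)
open import Data.Bool.Properties using (not-¬)
open import Data.Empty using (⊥; ⊥-elim)
open import Data.Fin.Base using (Fin; toℕ) renaming (zero to fzero; suc to fsuc)
open import Data.Fin.Patterns using (0F; 1F; 2F; 3F; 4F; 5F)
open import Data.Fin.Properties as Fin using (toℕ<n; toℕ-injective; toℕ-fromℕ<)
open import Data.List.Base using (List; []; _∷_; _++_; [_]; length; filter; concatMap; tabulate; allFin)
  renaming (map to mapᴸ)
open import Data.List.Properties using (length-++; length-tabulate; filter-all; filter-accept; filter-reject)
open import Data.List.Membership.Propositional using (_∈_; find; lose)
open import Data.List.Membership.Propositional.Properties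
  using (∈-∃++; ∈-concatMap⁺; ∈-concatMap⁻; ∈-filter⁺; ∈-filter⁻; ∈-++⁺ˡ; ∈-++⁺ʳ; ∈-++⁻; ∈-map⁺; ∈-map⁻;
         ∈-allFin; ∈-tabulate⁺; ∈-tabulate⁻)
open import Data.List.Relation.Unary.All as All using ([]; _∷_)
open import Data.List.Relation.Unary.AllPairs using ([]; _∷_)
open import Data.List.Relation.Unary.Any using (here; there)
open import Data.List.Relation.Unary.Unique.Propositional using (Unique)
open import Data.List.Relation.Unary.Unique.Propositional.Properties
  using (filter⁺; ++⁺; map⁺; allFin⁺; tabulate⁺)
open import Data.Maybe.Base using (Maybe; just; nothing)
open import Data.Maybe.Properties using (just-injective)
open import Data.Nat.Base using (ℕ; zero; suc; pred; _+_; _*_; _∸_; _≤_; _<_; z≤n; s≤s; >-nonZero)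
  renaming (_⊔_ to _⊔ⁿ_)
open import Data.Nat.DivMod using (_%_; _mod_; m<n⇒m%n≡m; n%n≡0; m%n%n≡m%n; %-distribˡ-+; [m+n]%n≡m%n)
open import Data.Nat.Properties renaming (_≟_ to _≟ℕ_)
open import Data.Nat.Solver using (module +-*-Solver)
open import Data.Product using (∃-syntax; _×_; _,_; proj₁; proj₂)
open import Data.Sum.Base using (_⊎_; inj₁; inj₂; [_,_]′; map; map₁; map₂; swap)
open import Data.Sum.Properties using (inj₁-injective; inj₂-injective; ≡-dec)
open import Function.Base using (_∘_; _on_; case_of_; id)
open import Function.Bundles using (_↔_; mk↔ₛ′; Equivalence)
open import Function.Definitions using (Injective)
open import Relation.Binary.Definitions using (tri<; tri≈; tri>)
open import Relation.Binary.PropositionalEquality hiding ([_])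
open import Relation.Nullary using (Dec; yes; no; ¬_; ¬?)
open import Relation.Nullary.Decidable using (map′; decidable-stable)
open import Relation.Unary using (Pred; _≐_; _∩_; _∪_; ∁; ｛_｝)

-- Why the rise `n - 3`: distance `n` having the wrong parity, the elements `n - 1` colours above
-- some `w` are exactly the ends of the climbs of `n - 1` steps from `w`. Seen from an element `c`
-- two colours above `w` they lie `n - 3` higher, and a walk of fewer than `n` steps that rises so
-- far has either no step down or exactly one. All these walks have different ends, so they are at
-- most as numerous as the climbs from `w`; a descent at a given height contributes a product
-- `yₖ xₖ₊₁`. The count needs finiteness, and the finite stages may be thin. As valencies turn out
-- to depend on the colour only, it is enough that a stage contains, for each of the finitely many
-- colours, one element together with three neighbours. The folding is needed because the count uses
-- colours that form a single cycle. It is centred at a point since a point of Δ is on two lines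
-- only, so that the distance to it can be given a sign.

private
  variable
    α β e f ℓ ρ v w : Level
    A : Set α
    B : Set β

-- Walks in graphs and polygons

module Walks {V : Set v} (E : V → V → Set e) where

  data Walk : V → ℕ → V → Set (v ⊔ e) where
    nil : ∀ {x} → Walk x 0 x
    _∷_ : ∀ {x y z k} → E x y → Walk y k z → Walk x (suc k) z

  -- NB p c k z: a walk of k steps from c to z which does not backtrack, even
  -- when preceded by the step from p to c.
  data NB : V → V → ℕ → V → Set (v ⊔ e) where
    stop : ∀ {p c} → NB p c 0 c
    step : ∀ {p c d k z} → E c d → d ≢ p → NB c d k z → NB p c (suc k) z

  data Path (x : V) : ℕ → V → Set (v ⊔ e) where
    here : Path x 0 x
    go   : ∀ {y k z} → E x y → NB x y k z → Path x (suc k) z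

  toWalk : ∀ {p c k z} → NB p c k z → Walk c k z
  toWalk stop         = nil
  toWalk (step a _ w) = a ∷ toWalk w

  pathWalk : ∀ {x k z} → Path x k z → Walk x k z
  pathWalk here     = nil
  pathWalk (go a w) = a ∷ toWalk w

  forget : ∀ {p c k z} → NB p c k z → Path c k z
  forget stop         = here
  forget (step a _ w) = go a w

  _∷ʳ_ : ∀ {x k y z} → Walk x k y → E y z → Walk x (suc k) z
  nil     ∷ʳ b = b ∷ nil
  (a ∷ w) ∷ʳ b = a ∷ (w ∷ʳ b)

  reverseWalk : (∀ {x y} → E x y → E y x) → ∀ {x k y} → Walk x k y → Walk y k x
  reverseWalk s nil     = nil
  reverseWalk s (a ∷ w) = reverseWalk s w ∷ʳ s a

  -- If the new edge undoes the last step, one step is lost instead of gained. For the walk of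
  -- length `0` the step undone is the one from `p`, whence the middle case.
  snoc : ((x y : V) → Dec (x ≡ y)) → ∀ {p c k y z} → NB p c k y → E y z →
         NB p c (suc k) z ⊎ (k ≡ 0 × z ≡ p) ⊎ (∃[ j ] k ≡ suc j × NB p c j z)
  snoc _≟_ {p} {z = z} stop b with z ≟ p
  ... | yes z≡p = inj₂ (inj₁ (refl , z≡p))
  ... | no  z≢p = inj₁ (step b z≢p stop)
  snoc _≟_ (step a d≢p w) b with snoc _≟_ w b
  ... | inj₁ w′                       = inj₁ (step a d≢p w′)
  ... | inj₂ (inj₁ (refl , refl))     = inj₂ (inj₂ (0 , refl , stop))
  ... | inj₂ (inj₂ (j , refl , w′))   = inj₂ (inj₂ (suc j , refl , step a d≢p w′))

  unsnoc : ∀ {p c k z} → NB p c (suc k) z → ∃[ y ] NB p c k y × E y z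
  unsnoc (step a _ stop) = _ , stop , a
  unsnoc (step a d≢p w@(step _ _ _)) with unsnoc w
  ... | y , w′ , b = y , step a d≢p w′ , b

-- Stated for graphs, so that Γ, its finite stages and Δ are treated alike, and points and lines
-- too. In `girth` the last step may undo the first one: closed walks with a tail at `p` are
-- excluded as well, and the corner at `p` never has to be checked.
record Polygon {V : Set v} (E : V → V → Set e) (n : ℕ) : Set (v ⊔ e) where
  open Walks E
  field
    _≟_       : (x y : V) → Dec (x ≡ y)
    symmetric : ∀ {x y} → E x y → E y x
    colour    : V → Bool
    alternate : ∀ {x y} → E x y → colour y ≡ not (colour x)
    diameter  : ∀ x y → ∃[ k ] k ≤ n × Walk x k y
    girth     : ∀ {p c k} → E p c → NB p c k p → suc k < n + n → ⊥

module PolygonProperties {V : Set v} {E : V → V → Set e} {n : ℕ} (𝒫 : Polygon E n) where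
  open Walks E public
  open Polygon 𝒫 public

  private
    not^ : ℕ → Bool → Bool
    not^ zero    b = b
    not^ (suc k) b = not (not^ k b)

    not^-not : ∀ k b → not^ k (not b) ≡ not (not^ k b)
    not^-not zero    b = refl
    not^-not (suc k) b = cong not (not^-not k b)

    walk-colour : ∀ {x k y} → Walk x k y → colour y ≡ not^ k (colour x)
    walk-colour nil = refl
    walk-colour {k = suc k} (a ∷ w) =
      trans (walk-colour w) (trans (cong (not^ k) (alternate a)) (not^-not k _))

  parity : ∀ {x k y} → Walk x k y → Walk x (suc k) y → ⊥
  parity w w′ = not-¬ (walk-colour w) (walk-colour w′)

  irreflexive : ∀ {x} → E x x → ⊥
  irreflexive a = parity nil (a ∷ nil)

  -- The steps of the first walk are moved, reversed, to the front of the second until none is left.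
  -- The result is a closed walk based at `z`, the one vertex where `girth` tolerates backtracking.
  join : ∀ {c y k l z} → E c y → NB c y k z → NB y c l z → suc (k + l) < n + n → ⊥
  join a stop w = girth (symmetric a) w
  join {k = suc k} {l} a (step b d≢c w) w′ lt =
    join b w (step (symmetric a) (d≢c ∘ sym) w′)
      (subst (_< n + n) (cong suc (sym (+-suc k l))) lt)

  -- The main tool for telling ends of walks apart: two walks that leave `c` differently and meet
  -- again close up to a walk shorter than the girth.
  separate : ∀ {c y y′ k l z} → E c y → E c y′ → y ≢ y′ →
             NB c y k z → NB c y′ l z → suc (k + suc l) < n + n → ⊥
  separate a a′ y≢y′ w w′ = join a w (step a′ (y≢y′ ∘ sym) w′)

  NB-length-unique : ∀ {p c k l z} → NB p c k z → NB p c l z → k + l < n + n → k ≡ l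
  NB-length-unique stop stop _ = refl
  NB-length-unique stop (step a _ w) lt = ⊥-elim (girth a w lt)
  NB-length-unique {k = suc k} (step a _ w) stop lt =
    ⊥-elim (girth a w (subst (_< n + n) (+-identityʳ (suc k)) lt))
  NB-length-unique {k = suc k} {suc l} (step {d = d} a _ w) (step {d = d′} a′ _ w′) lt
    with d ≟ d′
  ... | yes refl = cong suc (NB-length-unique w w′
                     (≤-<-trans (+-mono-≤ (n≤1+n k) (n≤1+n l)) lt))
  ... | no  d≢d′ = ⊥-elim (separate a a′ d≢d′ w w′ lt)

  length-unique : ∀ {x k l z} → Path x k z → Path x l z → k + l < n + n → k ≡ l
  length-unique here     here      lt = refl
  length-unique here     (go a w)  lt = ⊥-elim (girth a w lt)
  length-unique {k = suc k} (go a w) here lt =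
    ⊥-elim (girth a w (subst (_< n + n) (+-identityʳ (suc k)) lt))
  length-unique {k = suc k} {suc l} (go {y} a w) (go {y′} a′ w′) lt with y ≟ y′
  ... | yes refl = cong suc (NB-length-unique w w′
                     (≤-<-trans (+-mono-≤ (n≤1+n k) (n≤1+n l)) lt))
  ... | no  y≢y′ = ⊥-elim (separate a a′ y≢y′ w w′ lt)

  reduce : ∀ {x k z} → Walk x k z → ∃[ j ] j ≤ k × Path x j z
  reduce nil = 0 , z≤n , here
  reduce {x} (a ∷ w) with reduce w
  ... | zero  , j≤k , here = 1 , s≤s z≤n , go a stop
  ... | suc j , j≤k , go {y} b w′ with y ≟ x
  ...   | yes refl = j , ≤-trans (n≤1+n j) (m≤n⇒m≤1+n j≤k) , forget w′
  ...   | no  y≢x  = suc (suc j) , s≤s j≤k , go a (step b y≢x w′)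

  connect : ∀ x y → ∃[ k ] k ≤ n × Path x k y
  connect x y with diameter x y
  ... | k , k≤n , w with reduce w
  ...   | j , j≤k , p = j , ≤-trans j≤k k≤n , p

  -- Otherwise `y` reaches `z` through `u` without backtracking in `k + 2` steps, but also by a
  -- reduced walk of at most `k` steps, against the uniqueness of lengths.
  first-step : ∀ {u u′ y k l z} → E u u′ → NB u u′ k z → E u y → Walk y l z →
               l ≤ k → suc l + suc k < n + n → y ≡ u′
  first-step {u} {u′} {y} {k} {l} {z} a nb b w l≤k lt with y ≟ u′
  ... | yes y≡u′ = y≡u′
  ... | no  y≢u′ = ⊥-elim (contra (reduce w))
    where
    open ≤-Reasoning
    detour : Path y (suc (suc k)) z
    detour = go (symmetric b) (step a (y≢u′ ∘ sym) nb)
    contra : (∃[ j ] j ≤ l × Path y j z) → ⊥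
    contra (j , j≤l , p) = 1+n≰n {suc k} (begin
      suc (suc k) ≡⟨ sym (length-unique p detour (≤-<-trans (≤-trans
                       (≤-reflexive (+-suc j (suc k))) (s≤s (+-monoˡ-≤ (suc k) j≤l))) lt)) ⟩
      j           ≤⟨ j≤l ⟩
      l           ≤⟨ l≤k ⟩
      k           ≤⟨ n≤1+n k ⟩
      suc k       ∎)

  NB-snoc : ∀ {p c k z q} → NB p c k z → E z q →
    NB p c (suc k) q ⊎ (k ≡ 0 × q ≡ p) ⊎ (∃[ j ] k ≡ suc j × NB p c j q)
  NB-snoc = snoc _≟_

  -- The walk from `c` to `p` and on to `t` is the accumulator, holding the part reversed so far.
  reverseNB : ∀ {p c k z l t} → E p c → NB p c k z → NB c p l t →
              ∃[ q ] E z q × NB z q (k + l) t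
  reverseNB a stop acc = _ , symmetric a , acc
  reverseNB {k = suc k} {z = z} {l} {t} a (step b d≢p w) acc
    with reverseNB b w (step (symmetric a) (d≢p ∘ sym) acc)
  ... | q , b′ , w′ = q , b′ , subst (λ m → NB z q m t) (+-suc k l) w′

  reversePath : ∀ {x k z} → Path x k z → Path z k x
  reversePath here = here
  reversePath {x} {z = z} (go {k = k} a w) with reverseNB a w stop
  ... | q , b , w′ = subst (λ m → Path z (suc m) x) (+-identityʳ k) (go b w′)

  extend : (∀ (x p : V) → ∃[ y ] E x y × y ≢ p) → ∀ k p c → ∃[ z ] NB p c k z
  extend ext zero    p c = c , stop
  extend ext (suc k) p c with ext c p
  ... | d , a , d≢p with extend ext k c d
  ...   | z , w = z , step a d≢p w

-- The cyclic group and ascents of random sequences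

iter : (A → A) → ℕ → A → A
iter f zero    x = x
iter f (suc k) x = iter f k (f x)

iter-comm : (f : A → A) → ∀ k x → iter f k (f x) ≡ f (iter f k x)
iter-comm f zero    x = refl
iter-comm f (suc k) x = iter-comm f k (f x)

iter-+ : (f : A → A) → ∀ j k x → iter f (j + k) x ≡ iter f k (iter f j x)
iter-+ f zero    k x = refl
iter-+ f (suc j) k x = iter-+ f j k (f x)

iter-inverse : (f g : A → A) → (∀ x → g (f x) ≡ x) → ∀ k x → iter g k (iter f k x) ≡ x
iter-inverse f g gf zero    x = refl
iter-inverse f g gf (suc k) x = trans
  (cong (λ z → iter g k (g z)) (iter-comm f k x))
  (trans (cong (iter g k) (gf _)) (iter-inverse f g gf k x))

-- A free action of the cyclic group of order 2n, with a generator and its inverse.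
record Cycle {κ} (K : Set κ) (n : ℕ) : Set κ where
  field
    _≟_       : (i j : K) → Dec (i ≡ j)
    above      : K → K
    below      : K → K
    below-above : ∀ i → below (above i) ≡ i
    above-below : ∀ i → above (below i) ≡ i
    period    : ∀ i → iter above (n + n) i ≡ i
    free      : ∀ k i → 0 < k → k < n + n → iter above k i ≢ i

  infixl 9 _↑_
  _↑_ : K → ℕ → K
  i ↑ k = iter above k i

  above-injective : ∀ {i j} → above i ≡ above j → i ≡ j
  above-injective {i} {j} eq = trans (sym (below-above i)) (trans (cong below eq) (below-above j))

  ↑-injective : ∀ k {i j} → i ↑ k ≡ j ↑ k → i ≡ j
  ↑-injective zero    eq = eq
  ↑-injective (suc k) eq = above-injective (↑-injective k eq)

  ↑-distinct : ∀ {i j k} → i ↑ j ≡ i ↑ k → j < k → k < j + (n + n) → ⊥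
  ↑-distinct {i} {j} {k} eq j<k k<j+2n = free (k ∸ j) i (m<n⇒0<n∸m j<k)
    (+-cancelˡ-< j _ _ (subst (_< j + (n + n)) (sym (m+[n∸m]≡n (<⇒≤ j<k))) k<j+2n))
    (↑-injective j (begin
      i ↑ (k ∸ j) ↑ j  ≡⟨ sym (iter-+ above (k ∸ j) j i) ⟩
      i ↑ (k ∸ j + j)  ≡⟨ cong (i ↑_) (m∸n+n≡m (<⇒≤ j<k)) ⟩
      i ↑ k            ≡⟨ sym eq ⟩
      i ↑ j            ∎))
    where open ≡-Reasoning

  antipode-involutive : ∀ i → i ↑ n ↑ n ≡ i
  antipode-involutive i = trans (sym (iter-+ above n n i)) (period i)

  antipode-below : ∀ i → iter below n i ≡ i ↑ n
  antipode-below i = trans (cong (iter below n) (sym (antipode-involutive i)))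
                          (iter-inverse above below below-above n (i ↑ n))

  reversed : Cycle K n
  reversed = record
    { _≟_       = _≟_
    ; above      = below
    ; below      = above
    ; below-above = above-below
    ; above-below = below-above
    ; period    = λ i → trans (cong (iter below (n + n)) (sym (period i)))
                              (iter-inverse above below below-above (n + n) i)
    ; free      = λ k i 0<k k<2n eq → free k i 0<k k<2n
                    (trans (cong (iter above k) (sym eq)) (iter-inverse below above above-below k i))
    }

module _ {κ} {K : Set κ} {n : ℕ} (C : Cycle K n) (x y : K → ℕ) where
  open Cycle C using (above; _↑_; antipode-involutive)

  -- There are `m + 1` terms: the sequence has the positions `0` to `m + 1`.
  ascents : K → ℕ → ℕ
  ascents i zero    = y i * x (above i)
  ascents i (suc m) = y i * x (above i) + ascents (above i) m

  private
    ascents-last : ∀ i m →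
      ascents i (suc m) ≡ ascents i m + y (i ↑ suc m) * x (i ↑ suc (suc m))
    ascents-last i zero    = refl
    ascents-last i (suc m) = trans (cong (y i * x (above i) +_) (ascents-last (above i) m))
                                   (sym (+-assoc (y i * x (above i)) _ _))

    weight : K → ℕ
    weight i = x i + y i

  module _ (weight-period : ∀ i → x (above (above i)) + y (above (above i)) ≡ x i + y i)
           (weight-positive : ∀ i → 0 < x i + y i)
    where

    private
      -- The probabilities `x / weight` and `y / weight` are brought to a common denominator. As
      -- weights have period two, `weight i * weight (above i)` serves every position.
      X Y : K → ℕ
      X i = x i * weight (above i)
      Y i = y i * weight (above i)

      T : K → ℕ
      T i = weight i * weight (above i)

      T-above : ∀ i → T (above i) ≡ T i
      T-above i = trans (cong (weight (above i) *_) (weight-period i)) (*-comm (weight (above i)) _)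

      T-↑ : ∀ m i → T (i ↑ m) ≡ T i
      T-↑ zero    i = refl
      T-↑ (suc m) i = trans (T-↑ m (above i)) (T-above i)

      X+Y≡T : ∀ i → X i + Y i ≡ T i
      X+Y≡T i = sym (*-distribʳ-+ (weight (above i)) (x i) (y i))

      YX : ∀ i → Y i * X (above i) ≡ T i * (y i * x (above i))
      YX i = trans (cong (λ w → Y i * (x (above i) * w)) (weight-period i))
        (solve 4 (λ p q r s → (p :* q) :* (r :* s) := (s :* q) :* (p :* r)) refl
           (y i) (weight (above i)) (x (above i)) (weight i))
        where open +-*-Solver

      -- In a random binary sequence with independent entries, where entry k is 1 with
      -- probability X (i ↑ k) / T i, the expected number of ascents is at least the
      -- probability of starting with 0 and ending with 1.
      triangle : ∀ p₀ q₀ p₁ q₁ p₂ q₂ t → p₀ + q₀ ≡ t → p₁ + q₁ ≡ t → p₂ + q₂ ≡ t →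
        t * (q₀ * p₁ + q₁ * p₂) ≡ t * (q₀ * p₂) + (q₀ * p₁ * q₂ + p₀ * q₁ * p₂)
      triangle p₀ q₀ p₁ q₁ p₂ q₂ t e₀ e₁ e₂ = begin
        t * (q₀ * p₁ + q₁ * p₂)
          ≡⟨ *-distribˡ-+ t (q₀ * p₁) (q₁ * p₂) ⟩
        t * (q₀ * p₁) + t * (q₁ * p₂)
          ≡⟨ cong₂ (λ r s → r * (q₀ * p₁) + s * (q₁ * p₂)) (sym e₂) (sym e₀) ⟩
        (p₂ + q₂) * (q₀ * p₁) + (p₀ + q₀) * (q₁ * p₂)
          ≡⟨ solve 6 (λ p₀ q₀ p₁ q₁ p₂ q₂ →
               (p₂ :+ q₂) :* (q₀ :* p₁) :+ (p₀ :+ q₀) :* (q₁ :* p₂) :=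
               (p₁ :+ q₁) :* (q₀ :* p₂) :+ (q₀ :* p₁ :* q₂ :+ p₀ :* q₁ :* p₂)) refl
               p₀ q₀ p₁ q₁ p₂ q₂ ⟩
        (p₁ + q₁) * (q₀ * p₂) + (q₀ * p₁ * q₂ + p₀ * q₁ * p₂)
          ≡⟨ cong (λ r → r * (q₀ * p₂) + (q₀ * p₁ * q₂ + p₀ * q₁ * p₂)) e₁ ⟩
        t * (q₀ * p₂) + (q₀ * p₁ * q₂ + p₀ * q₁ * p₂) ∎
        where
        open ≡-Reasoning
        open +-*-Solver

      YX-↑ : ∀ i m → Y (i ↑ m) * X (i ↑ suc m) ≡ T i * (y (i ↑ m) * x (i ↑ suc m))
      YX-↑ i m = subst₂ (λ j t → Y (i ↑ m) * X j ≡ t * (y (i ↑ m) * x j))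
        (sym (iter-comm above m i)) (T-↑ m i) (YX (i ↑ m))

      T-ascents : ∀ i m → T i * ascents i (suc m) ≡
                          T i * ascents i m + Y (i ↑ suc m) * X (i ↑ suc (suc m))
      T-ascents i m = begin
        T i * ascents i (suc m)
          ≡⟨ cong (T i *_) (ascents-last i m) ⟩
        T i * (ascents i m + y (i ↑ suc m) * x (i ↑ suc (suc m)))
          ≡⟨ *-distribˡ-+ (T i) (ascents i m) _ ⟩
        T i * ascents i m + T i * (y (i ↑ suc m) * x (i ↑ suc (suc m)))
          ≡⟨ cong (T i * ascents i m +_) (sym (YX-↑ i (suc m))) ⟩
        T i * ascents i m + Y (i ↑ suc m) * X (i ↑ suc (suc m)) ∎
        where open ≡-Reasoning

      -- The patterns 010 and 101 at the positions `0`, `m + 1` and `m + 2`: just these have an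
      -- ascent through the middle position but none from the first to the last.
      excess : K → ℕ → ℕ
      excess i m = Y i * X (i ↑ suc m) * Y (i ↑ suc (suc m))
                 + X i * Y (i ↑ suc m) * X (i ↑ suc (suc m))

      triangle-↑ : ∀ i m →
        T i * (Y i * X (i ↑ suc m) + Y (i ↑ suc m) * X (i ↑ suc (suc m))) ≡
        T i * (Y i * X (i ↑ suc (suc m))) + excess i m
      triangle-↑ i m = triangle (X i) (Y i) (X (i ↑ suc m)) (Y (i ↑ suc m)) (X (i ↑ suc (suc m)))
        (Y (i ↑ suc (suc m))) (T i)
        (X+Y≡T i) (trans (X+Y≡T (i ↑ suc m)) (T-↑ (suc m) i))
        (trans (X+Y≡T (i ↑ suc (suc m))) (T-↑ (suc (suc m)) i))

      T>0 : ∀ i → 0 < T i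
      T>0 i = *-mono-≤ (weight-positive i) (weight-positive (above i))

      triangle-≤ : ∀ i m → Y i * X (i ↑ suc (suc m)) ≤
                           Y i * X (i ↑ suc m) + Y (i ↑ suc m) * X (i ↑ suc (suc m))
      triangle-≤ i m = *-cancelˡ-≤ (T i) {{>-nonZero (T>0 i)}}
        (≤-trans (m≤m+n _ (excess i m)) (≤-reflexive (sym (triangle-↑ i m))))

      ascents-≥ : ∀ i m → Y i * X (i ↑ suc m) ≤ T i * ascents i m
      ascents-≥ i zero    = ≤-reflexive (YX i)
      ascents-≥ i (suc m) = begin
        Y i * X (i ↑ suc (suc m))
          ≤⟨ triangle-≤ i m ⟩
        Y i * X (i ↑ suc m) + Y (i ↑ suc m) * X (i ↑ suc (suc m))
          ≤⟨ +-monoˡ-≤ _ (ascents-≥ i m) ⟩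
        T i * ascents i m + Y (i ↑ suc m) * X (i ↑ suc (suc m))
          ≡⟨ sym (T-ascents i m) ⟩
        T i * ascents i (suc m) ∎
        where open ≤-Reasoning

      -- The converse of `ascents-≥`, hence the case of equality.
      FewAscents : K → ℕ → Set
      FewAscents i m = T i * ascents i m ≤ Y i * X (i ↑ suc m)

      -- Equality passes to shorter sequences: removing the last position takes the same term from
      -- both sides of the chain `ascents-≥`, `triangle-≤`.
      few-pred : ∀ i m → FewAscents i (suc m) → FewAscents i m
      few-pred i m few = +-cancelʳ-≤ (Y (i ↑ suc m) * X (i ↑ suc (suc m))) _ _ (begin
        T i * ascents i m + Y (i ↑ suc m) * X (i ↑ suc (suc m))
          ≡⟨ sym (T-ascents i m) ⟩
        T i * ascents i (suc m)
          ≤⟨ few ⟩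
        Y i * X (i ↑ suc (suc m))
          ≤⟨ triangle-≤ i m ⟩
        Y i * X (i ↑ suc m) + Y (i ↑ suc m) * X (i ↑ suc (suc m)) ∎)
        where open ≤-Reasoning

      no-excess : ∀ i m → FewAscents i (suc m) → excess i m ≡ 0
      no-excess i m few = n≤0⇒n≡0 (+-cancelˡ-≤ (T i * (Y i * X (i ↑ suc (suc m)))) _ _ (begin
        T i * (Y i * X (i ↑ suc (suc m))) + excess i m
          ≡⟨ sym (triangle-↑ i m) ⟩
        T i * (Y i * X (i ↑ suc m) + Y (i ↑ suc m) * X (i ↑ suc (suc m)))
          ≤⟨ *-monoʳ-≤ (T i) (+-monoˡ-≤ _ (ascents-≥ i m)) ⟩
        T i * (T i * ascents i m + Y (i ↑ suc m) * X (i ↑ suc (suc m)))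
          ≡⟨ cong (T i *_) (sym (T-ascents i m)) ⟩
        T i * (T i * ascents i (suc m))
          ≤⟨ *-monoʳ-≤ (T i) few ⟩
        T i * (Y i * X (i ↑ suc (suc m)))
          ≡⟨ sym (+-identityʳ _) ⟩
        T i * (Y i * X (i ↑ suc (suc m))) + 0 ∎))
        where open ≤-Reasoning

      few-≤ : ∀ i {m} k → FewAscents i (k + m) → FewAscents i m
      few-≤ i zero    few = few
      few-≤ i (suc k) few = few-≤ i k (few-pred i (k + _) few)

      weight≢0 : ∀ i → weight i ≢ 0
      weight≢0 i w≡0 = 1+n≰n (subst (1 ≤_) w≡0 (weight-positive i))

      unscale : ∀ z i → z * weight i ≡ 0 → z ≡ 0
      unscale z i eq = case m*n≡0⇒m≡0∨n≡0 z eq of λ where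
        (inj₁ z≡0) → z≡0
        (inj₂ w≡0) → ⊥-elim (weight≢0 i w≡0)

    module _ (x-antipode : ∀ i → x (i ↑ n) ≡ y i) (y-antipode : ∀ i → y (i ↑ n) ≡ x i)
             {q} (n≡3+q : n ≡ 3 + q)
             (few-ascents : ∀ i → ascents i (suc q) ≤ y i * x (i ↑ suc (suc q)))
      where

      private
        r : ℕ
        r = suc q

        weight-antipode : ∀ i → weight (i ↑ n) ≡ weight i
        weight-antipode i = trans (cong₂ _+_ (x-antipode i) (y-antipode i)) (+-comm (y i) (x i))

        few : ∀ i → FewAscents i r
        few i = ≤-trans (*-monoʳ-≤ (T i) (few-ascents i)) (≤-reflexive (begin
          T i * (y i * x (i ↑ suc r))
            ≡⟨ solve 4 (λ p q s t → (p :* q) :* (s :* t) := (s :* q) :* (t :* p)) refl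
                 (weight i) (weight (above i)) (y i) (x (i ↑ suc r)) ⟩
          Y i * (x (i ↑ suc r) * weight i)
            -- The denominator at the last position involves the weight of the colour `n` above `i`.
            -- It is the weight of `i`, because the antipode exchanges `x` and `y`.
            ≡⟨ cong (λ w → Y i * (x (i ↑ suc r) * w)) (sym (begin
                 weight (above (i ↑ suc r))  ≡⟨ cong weight (sym (iter-comm above (suc r) i)) ⟩
                 weight (i ↑ suc (suc r))   ≡⟨ cong (λ k → weight (i ↑ k)) (sym n≡3+q) ⟩
                 weight (i ↑ n)             ≡⟨ weight-antipode i ⟩
                 weight i                   ∎)) ⟩
          Y i * X (i ↑ suc r) ∎))
          where
          open ≡-Reasoning
          open +-*-Solver

      -- The pattern 101 has probability zero, and its first entry is 1 with positive probability.
      no-ascent : ∀ i → x i ≢ 0 → ∀ m → m < r →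
                  y (i ↑ suc m) ≡ 0 ⊎ x (i ↑ suc (suc m)) ≡ 0
      no-ascent i x≢0 m m<r
        with m*n≡0⇒m≡0∨n≡0 (X i * Y (i ↑ suc m)) (m+n≡0⇒n≡0
               (Y i * X (i ↑ suc m) * Y (i ↑ suc (suc m)))
               (no-excess i m (few-≤ i (r ∸ suc m) (subst (FewAscents i) (sym (m∸n+n≡m m<r)) (few i)))))
      ... | inj₂ X≡0 = inj₂ (unscale _ _ X≡0)
      ... | inj₁ XY≡0 with m*n≡0⇒m≡0∨n≡0 (X i) XY≡0
      ...   | inj₁ X≡0 = ⊥-elim (x≢0 (unscale _ _ X≡0))
      ...   | inj₂ Y≡0 = inj₁ (unscale _ _ Y≡0)

      private
        Window : Set κ
        Window = ∃[ i ] (∀ k → k < suc r → y (i ↑ k) ≡ 0)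

        x≡0⇒y≢0 : ∀ i → x i ≡ 0 → y i ≢ 0
        x≡0⇒y≢0 i x≡0 y≡0 = weight≢0 i (cong₂ _+_ x≡0 y≡0)

        x-window : ∀ i → (∀ k → k < suc r → x (i ↑ k) ≡ 0) → Window
        x-window i zeros = i ↑ n , λ k k<1+r → begin
          y (i ↑ n ↑ k)    ≡⟨ cong y (trans (sym (iter-+ above n k i))
                               (trans (cong (i ↑_) (+-comm n k)) (iter-+ above k n i))) ⟩
          y (i ↑ k ↑ n)    ≡⟨ y-antipode (i ↑ k) ⟩
          x (i ↑ k)        ≡⟨ zeros k k<1+r ⟩
          0                ∎
          where open ≡-Reasoning

        -- Once an entry can be 0 after a possible 1, the next one cannot be 1; so it is surely 0,
        -- and the argument repeats.
        zeros-after : ∀ i → x i ≢ 0 → y (above i) ≢ 0 →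
                      ∀ m → m < r → x (i ↑ suc (suc m)) ≡ 0
        zeros-after i x≢0 y≢0 m m<r with no-ascent i x≢0 m m<r
        ... | inj₂ x≡0 = x≡0
        zeros-after i x≢0 y≢0 zero    m<r | inj₁ y≡0 = ⊥-elim (y≢0 y≡0)
        zeros-after i x≢0 y≢0 (suc m) m<r | inj₁ y≡0 =
          ⊥-elim (x≡0⇒y≢0 _ (zeros-after i x≢0 y≢0 m (<-trans (n<1+n m) m<r)) y≡0)

        -- `zeros-after` gives `r` zeros of `x`, one too few. The missing one is in front of them if
        -- `x (above i)` vanishes; otherwise `no-ascent` may be started one position later and
        -- supplies a zero behind them.
        drop-window : ∀ i → x i ≢ 0 → y (above i) ≢ 0 → Window
        drop-window i x≢0 y≢0 with x (above i) ≟ℕ 0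
        ... | yes x₁≡0 = x-window (above i) λ where
          zero    _           → x₁≡0
          (suc k) (s≤s k<r)   → zeros-after i x≢0 y≢0 k k<r
        ... | no  x₁≢0 = x-window (above (above i)) (last-zero (zeros-after i x≢0 y≢0) x₁≢0)
          where
          last-zero : (∀ m → m < r → x (i ↑ suc (suc m)) ≡ 0) → x (above i) ≢ 0 →
                      ∀ k → k < suc r → x (above (above i) ↑ k) ≡ 0
          last-zero zeros x₁≢0 k (s≤s k≤r) with m≤n⇒m<n∨m≡n k≤r
          ... | inj₁ k<r = zeros k k<r
          last-zero zeros x₁≢0 (suc k) _ | inj₂ refl
            with no-ascent (above i) x₁≢0 k ≤-refl
          ... | inj₂ x≡0 = x≡0
          ... | inj₁ y≡0 = ⊥-elim (x≡0⇒y≢0 _ (zeros k ≤-refl) y≡0)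

        -- While the next `y` vanishes, the next `x` does not, weights being positive, so the search
        -- upwards can go on. The first `y` that does not vanish gives a window by `drop-window`.
        zeros-or-window : ∀ i → x i ≢ 0 → ∀ k →
                          (∀ j → j < k → y (i ↑ suc j) ≡ 0) ⊎ Window
        zeros-or-window i x≢0 zero = inj₁ λ _ ()
        zeros-or-window i x≢0 (suc k) with y (above i) ≟ℕ 0
        ... | no  y₁≢0 = inj₂ (drop-window i x≢0 y₁≢0)
        ... | yes y₁≡0 = map₁ (λ zeros → λ where
                zero    _         → y₁≡0
                (suc j) (s≤s j<k) → zeros j j<k)
              (zeros-or-window (above i) (λ x₁≡0 → x≡0⇒y≢0 _ x₁≡0 y₁≡0) k)

        window-from : ∀ i → x i ≢ 0 → Window
        window-from i x≢0 with zeros-or-window i x≢0 (suc r)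
        ... | inj₁ zeros = above i , zeros
        ... | inj₂ w     = w

      window : K → ∃[ i ] (∀ k → k < suc (suc q) → y (i ↑ k) ≡ 0)
      window i with x i ≟ℕ 0
      ... | no  x≢0 = window-from i x≢0
      ... | yes x≡0 = window-from (i ↑ n) (x≡0⇒y≢0 i x≡0 ∘ trans (sym (x-antipode i)))

-- Counting in lists

insert⁻ : ∀ {y z : A} as {bs} → z ∈ as ++ y ∷ bs → z ≢ y → z ∈ as ++ bs
insert⁻ []       (here eq)  z≢y = ⊥-elim (z≢y eq)
insert⁻ []       (there m)  z≢y = m
insert⁻ (_ ∷ as) (here eq)  z≢y = here eq
insert⁻ (_ ∷ as) (there m)  z≢y = there (insert⁻ as m z≢y)

length-insert : ∀ (as : List A) {y bs} → length (as ++ y ∷ bs) ≡ suc (length (as ++ bs))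
length-insert []       = refl
length-insert (_ ∷ as) = cong suc (length-insert as)

-- The partner of the head is struck out of `ys`; by injectivity no later element needs it.
matching-≤ : {R : A → B → Set ρ} → (∀ {x x′ y} → R x y → R x′ y → x ≡ x′) →
             ∀ {xs ys} → Unique xs → (∀ {x} → x ∈ xs → ∃[ y ] y ∈ ys × R x y) →
             length xs ≤ length ys
matching-≤ inj []           match = z≤n
matching-≤ {R = R} inj {x ∷ xs} {ys} (x∉ ∷ uniq) match
  with match (here refl)
... | y , y∈ys , Rxy with ∈-∃++ y∈ys
...   | as , bs , refl = subst (suc (length xs) ≤_) (sym (length-insert as))
        (s≤s (matching-≤ inj uniq λ {x′} x′∈xs → case match (there x′∈xs) of λ where
          (y′ , y′∈ys , Rx′y′) → y′ , insert⁻ as y′∈ys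
            (λ { refl → All.lookup x∉ x′∈xs (inj Rxy Rx′y′) }) , Rx′y′))

subset-≤ : ∀ {xs ys : List A} → Unique xs → (∀ {x} → x ∈ xs → x ∈ ys) → length xs ≤ length ys
subset-≤ uniq sub = matching-≤ {R = _≡_} (λ e e′ → trans e (sym e′)) uniq λ m → _ , sub m , refl

∈-concatMap⇒ : ∀ (f : A → List B) {z} xs → z ∈ concatMap f xs → ∃[ x ] x ∈ xs × z ∈ f x
∈-concatMap⇒ f xs m = find (∈-concatMap⁻ f m)

⇒∈-concatMap : ∀ (f : A → List B) {z x} {xs} → x ∈ xs → z ∈ f x → z ∈ concatMap f xs
⇒∈-concatMap f x∈xs z∈fx = ∈-concatMap⁺ f (lose x∈xs z∈fx)

length-concatMap : ∀ (f : A → List B) {m} xs → (∀ {x} → x ∈ xs → length (f x) ≡ m) →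
                   length (concatMap f xs) ≡ length xs * m
length-concatMap f []       eq = refl
length-concatMap f (x ∷ xs) eq = trans (length-++ (f x))
  (cong₂ _+_ (eq (here refl)) (length-concatMap f xs (eq ∘ there)))

Unique-concatMap : ∀ (f : A → List B) {xs} → Unique xs → (∀ {x} → x ∈ xs → Unique (f x)) →
  (∀ {x x′ z} → x ∈ xs → x′ ∈ xs → x ≢ x′ → z ∈ f x → z ∈ f x′ → ⊥) → Unique (concatMap f xs)
Unique-concatMap f []          u d = []
Unique-concatMap f {x ∷ xs} (x∉ ∷ uniq) u d = ++⁺ (u (here refl))
  (Unique-concatMap f uniq (u ∘ there) (λ m m′ → d (there m) (there m′)))
  λ where (z∈fx , z∈) → case ∈-concatMap⇒ f xs z∈ of λ where
            (x′ , x′∈xs , z∈fx′) → d (here refl) (there x′∈xs) (All.lookup x∉ x′∈xs) z∈fx z∈fx′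

module Removal {A : Set α} (_≟_ : (x y : A) → Dec (x ≡ y)) where

  infixl 6 _∖_
  _∖_ : List A → A → List A
  xs ∖ p = filter (λ x → ¬? (x ≟ p)) xs

  ∈-∖⁻ : ∀ {x p xs} → x ∈ xs ∖ p → x ∈ xs × x ≢ p
  ∈-∖⁻ = ∈-filter⁻ _

  Unique-∖ : ∀ {xs} p → Unique xs → Unique (xs ∖ p)
  Unique-∖ p = filter⁺ _

  length-∖ : ∀ {xs p} → Unique xs → p ∈ xs → suc (length (xs ∖ p)) ≡ length xs
  length-∖ {x ∷ xs} {p} (x∉ ∷ uniq) (here refl)
    rewrite filter-reject (λ y → ¬? (y ≟ p)) {x} {xs} (λ ne → ne refl)
    = cong (suc ∘ length) (filter-all (λ y → ¬? (y ≟ p)) (All.map (_∘ sym) x∉))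
  length-∖ {x ∷ xs} {p} (x∉ ∷ uniq) (there p∈xs)
    rewrite filter-accept (λ y → ¬? (y ≟ p)) {x} {xs} (All.lookup x∉ p∈xs)
    = cong suc (length-∖ uniq p∈xs)

length-split : ∀ {p q} {P : A → Set p} {Q : A → Set q} (P? : ∀ x → Dec (P x)) (Q? : ∀ x → Dec (Q x))
  {xs : List A} → (∀ {x} → x ∈ xs → P x ⊎ Q x) → (∀ {x} → P x → Q x → ⊥) →
  length (filter P? xs) + length (filter Q? xs) ≡ length xs
length-split P? Q? {[]}     cover disj = refl
length-split P? Q? {x ∷ xs} cover disj with P? x | Q? x | cover (here refl)
... | yes p | yes q | _      = ⊥-elim (disj p q)
... | yes p | no ¬q | _      = cong suc (length-split P? Q? (cover ∘ there) disj)
... | no ¬p | yes q | _      = trans (+-suc _ _) (cong suc (length-split P? Q? (cover ∘ there) disj))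
... | no ¬p | no ¬q | inj₁ p = ⊥-elim (¬p p)
... | no ¬p | no ¬q | inj₂ q = ⊥-elim (¬q q)

-- Counting walks in a labelled finite polygon

module Labelled {v e κ} {V : Set v} {E : V → V → Set e} {n : ℕ} (𝒫 : Polygon E n)
  {K : Set κ} (C : Cycle K n) (f : V → K)
  (edge : ∀ {x y} → E x y → f y ≡ Cycle.above C (f x) ⊎ f x ≡ Cycle.above C (f y)) where

  open PolygonProperties 𝒫
  open Cycle C using (above; below; _↑_; ↑-distinct; below-above; above-below)

  balance : ∀ {x k y} → Walk x k y → ∃[ u ] ∃[ d ] u + d ≡ k × f y ↑ d ≡ f x ↑ u
  balance nil = 0 , 0 , refl , refl
  balance {x} (_∷_ {y = y} a w) with balance w
  ... | u , d , refl , eq with edge a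
  ...   | inj₁ up   = suc u , d , refl , trans eq (cong (_↑ u) up)
  ...   | inj₂ down = u , suc d , +-suc u d ,
            trans (iter-comm above d _) (trans (cong above eq)
              (trans (sym (iter-comm above u (f y))) (cong (_↑ u) (sym down))))

  private
    balance-↑ : ∀ {x k y m} → Walk x k y → f y ≡ f x ↑ m →
                ∃[ u ] ∃[ d ] u + d ≡ k × f x ↑ (m + d) ≡ f x ↑ u
    balance-↑ {x} {m = m} w fy with balance w
    ... | u , d , u+d≡k , eq = u , d , u+d≡k ,
      trans (iter-+ above m d (f x)) (trans (cong (_↑ d) (sym fy)) eq)

  -- With `u` steps up and `d` down, the colours force `m + d` and `u` to agree modulo `2n`. If
  -- `k < m`, their difference lies strictly between `0` and `2n`.
  far : ∀ {x k y m} → Walk x k y → f y ≡ f x ↑ m → m ≤ n → m ≤ k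
  far {m = m} w fy m≤n with balance-↑ {m = m} w fy
  ... | u , d , refl , eq = ≮⇒≥ λ k<m → ↑-distinct (sym eq)
        (<-≤-trans (≤-<-trans (m≤m+n u d) k<m) (m≤m+n m d))
        (<-≤-trans (+-mono-≤-< m≤n (<-≤-trans (≤-<-trans (m≤n+m d u) k<m) m≤n)) (m≤n+m (n + n) u))

  -- A parity argument: here `m + d - u = 2d - 1`, which is odd and smaller than `2n` in absolute
  -- value.
  not-one-longer : ∀ {x y} m → Walk x (suc m) y → f y ≡ f x ↑ m → m < n → ⊥
  not-one-longer m w fy m<n with balance-↑ {m = m} w fy
  ... | u , zero , eq₁ , eq =
    ↑-distinct eq (subst₂ _<_ (sym (+-identityʳ m)) (trans (sym eq₁) (+-identityʳ u)) ≤-refl)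
      (subst (_< m + 0 + (n + n)) (trans (sym eq₁) (+-identityʳ u))
        (subst (λ j → suc m < j + (n + n)) (sym (+-identityʳ m))
          (≤-trans (≤-reflexive (cong suc (+-comm 1 m)))
            (≤-trans (≤-reflexive (sym (+-suc m 1))) (+-monoʳ-≤ m (+-mono-≤ 1≤n 1≤n))))))
    where
    1≤n : 1 ≤ n
    1≤n = ≤-trans (s≤s z≤n) m<n
  ... | u , suc d , eq₁ , eq = ↑-distinct (sym eq)
      (<-≤-trans (s≤s u≤m) (≤-trans (s≤s (m≤m+n m d)) (≤-reflexive (sym (+-suc m d)))))
      (<-≤-trans (+-mono-<-≤ m<n (≤-trans d<1+m m<n)) (m≤n+m (n + n) u))
    where
    u+d≡m : u + d ≡ m
    u+d≡m = suc-injective (trans (sym (+-suc u d)) eq₁)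
    u≤m : u ≤ m
    u≤m = subst (u ≤_) u+d≡m (m≤m+n u d)
    d<1+m : suc d ≤ suc m
    d<1+m = s≤s (subst (d ≤_) u+d≡m (m≤n+m d u))

module FiniteLabelled {v e κ} {V : Set v} {E : V → V → Set e} {q : ℕ} (𝒫 : Polygon E (3 + q))
  {K : Set κ} (C : Cycle K (3 + q)) (f : V → K)
  (edge : ∀ {x y} → E x y → f y ≡ Cycle.above C (f x) ⊎ f x ≡ Cycle.above C (f y))
  (E? : ∀ x y → Dec (E x y)) (vs : List V) (vs-unique : Unique vs) (∈vs : ∀ x → x ∈ vs) where

  private
    n : ℕ
    n = 3 + q

  open PolygonProperties 𝒫
  open Labelled 𝒫 C f edge public
  open Cycle C using (above; below; _↑_; ↑-distinct; below-above; above-below) renaming (_≟_ to _≟ᴷ_)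
  open Removal _≟_

  nbrs : V → List V
  nbrs x = filter (E? x) vs

  nbrs-unique : ∀ x → Unique (nbrs x)
  nbrs-unique x = filter⁺ (E? x) vs-unique

  ∈-nbrs : ∀ {x y} → E x y → y ∈ nbrs x
  ∈-nbrs a = ∈-filter⁺ (E? _) (∈vs _) a

  nbrs-edge : ∀ {x y} → y ∈ nbrs x → E x y
  nbrs-edge = proj₂ ∘ ∈-filter⁻ (E? _) {xs = vs}

  up down : V → List V
  up   x = filter (λ y → f y ≟ᴷ above (f x)) (nbrs x)
  down x = filter (λ y → f y ≟ᴷ below (f x)) (nbrs x)

  up-unique : ∀ x → Unique (up x)
  up-unique x = filter⁺ _ (nbrs-unique x)

  down-unique : ∀ x → Unique (down x)
  down-unique x = filter⁺ _ (nbrs-unique x)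

  ∈-up : ∀ {x y} → E x y → f y ≡ above (f x) → y ∈ up x
  ∈-up a eq = ∈-filter⁺ _ (∈-nbrs a) eq

  ∈-down : ∀ {x y} → E x y → f y ≡ below (f x) → y ∈ down x
  ∈-down a eq = ∈-filter⁺ _ (∈-nbrs a) eq

  up-edge : ∀ {x y} → y ∈ up x → E x y
  up-edge = nbrs-edge ∘ proj₁ ∘ ∈-filter⁻ _

  down-edge : ∀ {x y} → y ∈ down x → E x y
  down-edge = nbrs-edge ∘ proj₁ ∘ ∈-filter⁻ _

  up-label : ∀ {x y} → y ∈ up x → f y ≡ above (f x)
  up-label {x} = proj₂ ∘ ∈-filter⁻ _ {xs = nbrs x}

  down-label : ∀ {x y} → y ∈ down x → f y ≡ below (f x)
  down-label {x} = proj₂ ∘ ∈-filter⁻ _ {xs = nbrs x}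

  private
    up-down-disjoint : ∀ {i : K} → above i ≡ below i → ⊥
    up-down-disjoint {i} eq = ↑-distinct {i} {0} {2}
      (sym (trans (cong above eq) (above-below i))) (s≤s z≤n)
      (s≤s (s≤s (s≤s z≤n)))

  up+down : ∀ x → length (up x) + length (down x) ≡ length (nbrs x)
  up+down x = length-split (λ y → f y ≟ᴷ above (f x)) (λ y → f y ≟ᴷ below (f x))
    (λ y∈ → map₂ (λ eq → trans (sym (below-above _)) (cong below (sym eq))) (edge (nbrs-edge y∈)))
    (λ e₁ e₂ → up-down-disjoint (trans (sym e₁) e₂))

  up-down : ∀ {x y} → y ∈ up x → x ∈ down y
  up-down y∈ = ∈-down (symmetric (up-edge y∈))
    (trans (sym (below-above _)) (cong below (sym (up-label y∈))))

  down-up : ∀ {x y} → y ∈ down x → x ∈ up y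
  down-up y∈ = ∈-up (symmetric (down-edge y∈))
    (trans (sym (above-below _)) (cong above (sym (down-label y∈))))

  up-up : ∀ {x y} → y ∈ up x → x ∈ up y → ⊥
  up-up {x} y∈ x∈ = ↑-distinct {f x} {0} {2}
      (trans (up-label x∈) (cong above (up-label y∈))) (s≤s z≤n)
      (s≤s (s≤s (s≤s z≤n)))

  climbs : ℕ → V → List V
  climbs zero    c = [ c ]
  climbs (suc m) c = concatMap (climbs m) (up c)

  climbs-NB : ∀ m {p c z} → (p ∈ up c → ⊥) → z ∈ climbs m c → NB p c m z
  climbs-NB zero    p∉ (here refl) = stop
  climbs-NB (suc m) {c = c} p∉ z∈ with ∈-concatMap⇒ (climbs m) (up c) z∈
  ... | d , d∈ , z∈′ = step (up-edge d∈) (λ { refl → p∉ d∈ })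
                         (climbs-NB m (up-up d∈) z∈′)

  climbs-label : ∀ m {c z} → z ∈ climbs m c → f z ≡ f c ↑ m
  climbs-label zero    (here refl) = refl
  climbs-label (suc m) {c} z∈ with ∈-concatMap⇒ (climbs m) (up c) z∈
  ... | d , d∈ , z∈′ = trans (climbs-label m z∈′) (cong (_↑ m) (up-label d∈))

  -- A first step down would leave a larger rise to fewer steps, against `far`.
  climbs-complete : ∀ m {c z k} → Walk c k z → k ≤ m → m < n → f z ≡ f c ↑ m → z ∈ climbs m c
  climbs-complete zero    nil     k≤m m<n fz = here refl
  climbs-complete (suc m) w       k≤m m<n fz with far {m = suc m} w fz (<⇒≤ m<n)
  climbs-complete (suc m) {c} (_∷_ {y = d} a w) (s≤s k≤m) m<n fz | _ with edge a
  ... | inj₁ fd = ⇒∈-concatMap (climbs m) (∈-up a fd)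
                    (climbs-complete m w k≤m (<-trans (n<1+n m) m<n)
                      (trans fz (cong (_↑ m) (sym fd))))
  ... | inj₂ fc = ⊥-elim (1+n≰n (≤-trans
        (far {m = suc (suc m)} w (trans fz (cong (_↑ suc m) fc)) m<n) (≤-trans k≤m (n≤1+n m))))

  short-walk : ∀ {x z m} → suc m ≡ n → f z ≡ f x ↑ m → ∃[ k ] k ≤ m × Path x k z
  short-walk {x} {z} {m} refl fz with connect x z
  ... | k , k≤n , p with m≤n⇒m<n∨m≡n k≤n
  ...   | inj₁ (s≤s k≤m) = k , k≤m , p
  ...   | inj₂ refl      = ⊥-elim (not-one-longer m (pathWalk p) fz ≤-refl)

  -- Hence the climbs of `n - 1` steps fill a whole colour class. The diameter allows a path of `n`
  -- steps at first, but its parity is wrong.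
  ∈-climbs : ∀ {x z m} → suc m ≡ n → f z ≡ f x ↑ m → z ∈ climbs m x
  ∈-climbs {m = m} eq fz with short-walk eq fz
  ... | k , k≤m , p = climbs-complete m (pathWalk p) k≤m (≤-reflexive eq) fz

  short : ∀ {k l} → k ≤ suc q → l ≤ suc q → suc (k + suc l) < n + n
  short k≤ l≤ = s≤s (s≤s (+-mono-≤ k≤ (m≤n⇒m≤1+n (s≤s l≤))))

  not-n≤1+q : n ≤ suc q → ⊥
  not-n≤1+q le = 1+n≰n (≤-trans (n≤1+n _) le)

  -- From each `w` above `x` a path of exactly `n - 1` steps leads to `z`, and `w` is matched with
  -- its last vertex before `z`. By `separate` that vertex determines `w`.
  up-≤-down : ∀ {x z} → f z ≡ f x ↑ n → length (up x) ≤ length (down z)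
  up-≤-down {x} {z} fz = matching-≤ {R = λ w w′ → E x w × NB x w (suc q) w′}
    (λ { {w} {w₁} (a , nb) (a₁ , nb₁) → case w ≟ w₁ of λ where
          (yes eq) → eq
          (no  ne) → ⊥-elim (separate a a₁ ne nb nb₁ (short ≤-refl ≤-refl)) })
    (up-unique x) match
    where
    continue : ∀ {w k} → E x w → f w ≡ above (f x) → k ≤ suc (suc q) → Path w k z →
               ∃[ w′ ] w′ ∈ down z × (E x w × NB x w (suc q) w′)
    continue {w} {k} a fw k≤ p with ≤-antisym k≤ (far {m = suc (suc q)} (pathWalk p)
                                    (trans fz (cong (_↑ suc (suc q)) (sym fw))) (n≤1+n _))
    continue {w} a fw _ (go {y = d} b nb) | refl with d ≟ x
    -- Back at `x`, a rise of `n` would be left to `n - 2` steps.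
    ... | yes refl = ⊥-elim (not-n≤1+q (far {m = n} (toWalk nb) fz ≤-refl))
    ... | no  d≢x with unsnoc (step b d≢x nb)
    ...   | w′ , nb′ , c = w′ , ∈-down (symmetric c) (falls (edge c)) , a , nb′
      where
      falls : f z ≡ above (f w′) ⊎ f w′ ≡ above (f z) → f w′ ≡ below (f z)
      falls (inj₁ fz′) = trans (sym (below-above _)) (cong below (sym fz′))
      falls (inj₂ fw′) = ⊥-elim (not-n≤1+q (far {m = n} (toWalk nb′) (begin
        f w′                          ≡⟨ fw′ ⟩
        above (f z)                    ≡⟨ cong above fz ⟩
        above (f x ↑ n)                ≡⟨ sym (iter-comm above n (f x)) ⟩
        above (f x) ↑ n                ≡⟨ cong (_↑ n) (sym fw) ⟩
        f w ↑ n                       ∎) ≤-refl))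
        where open ≡-Reasoning
    match : ∀ {w} → w ∈ up x → ∃[ w′ ] w′ ∈ down z × (E x w × NB x w (suc q) w′)
    match w∈ with short-walk refl (trans fz (cong (_↑ suc (suc q)) (sym (up-label w∈))))
    ... | k , k≤ , p = continue (up-edge w∈) (up-label w∈) k≤ p

  -- The matching of `up-≤-down`, now for all neighbours. That the path from `w` has `n - 1` steps
  -- follows from parity and from the distance of `x` and `z` instead of the colours.
  opposite-≤ : ∀ {x z} → Path x n z → length (nbrs x) ≤ length (nbrs z)
  opposite-≤ {x} {z} far-apart = matching-≤ {R = λ w w′ → E x w × NB x w (suc q) w′}
    (λ { {w} {w₁} (a , nb) (a₁ , nb₁) → case w ≟ w₁ of λ where
          (yes eq) → eq
          (no  ne) → ⊥-elim (separate a a₁ ne nb nb₁ (short ≤-refl ≤-refl)) })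
    (nbrs-unique x) match
    where
    shortest : ∀ {k} → Path x k z → k < n → ⊥
    shortest p k<n = <-irrefl (length-unique p far-apart (+-monoˡ-< n k<n)) k<n
    continue : ∀ {w k} → E x w → k ≤ n → Path w k z →
               ∃[ w′ ] w′ ∈ nbrs z × (E x w × NB x w (suc q) w′)
    continue a k≤n here = ⊥-elim (shortest (go a stop) (s≤s (s≤s z≤n)))
    continue a k≤n p@(go {y = d} {k = k} b nb) with d ≟ x
    ... | yes refl = ⊥-elim (shortest (forget nb) k≤n)
    ... | no  d≢x with m≤n⇒m<n∨m≡n k≤n
    ...   | inj₂ refl = ⊥-elim (parity (pathWalk far-apart) (a ∷ pathWalk p))
    ...   | inj₁ (s≤s 1+k≤2+q) with m≤n⇒m<n∨m≡n 1+k≤2+q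
    ...     | inj₁ 1+k<2+q = ⊥-elim (shortest (go a (step b d≢x nb)) (s≤s 1+k<2+q))
    ...     | inj₂ refl with unsnoc (step b d≢x nb)
    ...       | w′ , nb′ , c = w′ , ∈-nbrs (symmetric c) , a , nb′
    match : ∀ {w} → w ∈ nbrs x → ∃[ w′ ] w′ ∈ nbrs z × (E x w × NB x w (suc q) w′)
    match {w} w∈ with connect w z
    ... | k , k≤n , p = continue (nbrs-edge w∈) k≤n p

  opposite-≡ : ∀ {x z} → Path x n z → length (nbrs x) ≡ length (nbrs z)
  opposite-≡ p = ≤-antisym (opposite-≤ p) (opposite-≤ (reversePath p))

  module Counting (X Y : K → ℕ) (length-up : ∀ c → length (up c) ≡ suc (Y (f c)))
                  (length-down : ∀ c → length (down c) ≡ suc (X (f c))) where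

    climb-count : K → ℕ → ℕ
    climb-count i zero    = 1
    climb-count i (suc m) = suc (Y i) * climb-count (above i) m

    length-climbs : ∀ m c → length (climbs m c) ≡ climb-count (f c) m
    length-climbs zero    c = refl
    length-climbs (suc m) c = trans
      (length-concatMap (climbs m) (up c)
        (λ d∈ → trans (length-climbs m _) (cong (λ i → climb-count i m) (up-label d∈))))
      (cong (_* climb-count (above (f c)) m) (length-up c))

    length-down-∖ : ∀ {p c} → p ∈ down c → length (down c ∖ p) ≡ X (f c)
    length-down-∖ {c = c} p∈ =
      suc-injective (trans (length-∖ (down-unique c) p∈) (length-down c))

    length-up-∖ : ∀ {p c} → p ∈ up c → length (up c ∖ p) ≡ Y (f c)
    length-up-∖ {c = c} p∈ = suc-injective (trans (length-∖ (up-unique c) p∈) (length-up c))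

    -- The ends of the walks which go down from c to d, up to a vertex other than c,
    -- and then m steps up.
    rebound : ℕ → V → V → List V
    rebound m c d = concatMap (climbs m) (up d ∖ c)

    -- branches m c ds: the ends of the non-backtracking walks from c with one step
    -- down and m + 1 steps up, the first vertex of which is up or in ds.
    -- dips m p c: the ends of those from c, preceded by p, with one step down and
    -- m steps up.
    branches : ℕ → V → List V → List V
    dips     : ℕ → V → V → List V
    branches m c ds   = concatMap (rebound m c) ds ++ concatMap (dips m c) (up c)
    dips zero    p c  = down c ∖ p
    dips (suc m) p c  = branches m c (down c ∖ p)

    rebound-NB : ∀ m {c d z} → z ∈ rebound m c d → NB c d (suc m) z
    rebound-NB m {c} {d} z∈ with ∈-concatMap⇒ (climbs m) (up d ∖ c) z∈
    ... | e , e∈∖ , z∈′ with ∈-∖⁻ {xs = up d} e∈∖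
    ...   | e∈ , e≢c = step (up-edge e∈) e≢c (climbs-NB m (up-up e∈) z∈′)

    branches-step : ∀ m {c ds z} → z ∈ branches m c ds →
                    (∃[ d ] d ∈ ds × z ∈ rebound m c d) ⊎ (∃[ d ] d ∈ up c × z ∈ dips m c d)
    branches-step m {c} {ds} z∈ with ∈-++⁻ (concatMap (rebound m c) ds) z∈
    ... | inj₁ z∈₁ = inj₁ (∈-concatMap⇒ (rebound m c) ds z∈₁)
    ... | inj₂ z∈₂ = inj₂ (∈-concatMap⇒ (dips m c) (up c) z∈₂)

    dips-NB : ∀ m {p c z} → p ∈ down c → z ∈ dips m p c → NB p c (suc m) z
    dips-NB zero {c = c} p∈ z∈ with ∈-∖⁻ {xs = down c} z∈
    ... | z∈′ , z≢p = step (down-edge z∈′) z≢p stop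
    dips-NB (suc m) {p} {c} p∈ z∈ with branches-step m {c} {down c ∖ p} z∈
    ... | inj₂ (d , d∈ , z∈′) = step (up-edge d∈) (λ { refl → up-up (down-up p∈) d∈ })
                                  (dips-NB m (up-down d∈) z∈′)
    ... | inj₁ (d , d∈∖ , z∈′) with ∈-∖⁻ {xs = down c} d∈∖
    ...   | d∈ , d≢p = step (down-edge d∈) d≢p (rebound-NB m z∈′)

    rebound-label : ∀ m {c d z} → d ∈ down c → z ∈ rebound m c d → f z ≡ f c ↑ m
    rebound-label m {c} {d} d∈ z∈ with ∈-concatMap⇒ (climbs m) (up d ∖ c) z∈
    ... | e , e∈∖ , z∈′ = trans (climbs-label m z∈′) (cong (_↑ m) (begin
      f e             ≡⟨ up-label (proj₁ (∈-∖⁻ {xs = up d} e∈∖)) ⟩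
      above (f d)      ≡⟨ sym (up-label (down-up d∈)) ⟩
      f c             ∎))
      where open ≡-Reasoning

    dips-label : ∀ m {p c z} → z ∈ dips m p c → above (f z) ≡ f c ↑ m
    branches-label : ∀ m {c ds z} → (∀ {d} → d ∈ ds → d ∈ down c) →
                     z ∈ branches m c ds → f z ≡ f c ↑ m
    dips-label zero {c = c} z∈ =
      trans (cong above (down-label (proj₁ (∈-∖⁻ {xs = down c} z∈)))) (above-below (f c))
    dips-label (suc m) {p} {c} z∈ = trans
      (cong above (branches-label m {c} {down c ∖ p} (proj₁ ∘ ∈-∖⁻ {xs = down c}) z∈))
      (sym (iter-comm above m (f c)))
    branches-label m {c} {ds} sub z∈ with branches-step m {c} {ds} z∈
    ... | inj₁ (d , d∈ , z∈′) = rebound-label m (sub d∈) z∈′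
    ... | inj₂ (d , d∈ , z∈′) = Cycle.above-injective C
      (trans (dips-label m {c} {d} z∈′) (trans (cong (_↑ m) (up-label d∈)) (iter-comm above m (f c))))

    -- Walks with different first vertices have different ends, as together they have at most
    -- `2n - 2` steps.
    family-unique : ∀ {c xs k} (g : V → List V) → Unique xs → k ≤ suc q →
      (∀ {x} → x ∈ xs → E c x) → (∀ {x} → x ∈ xs → Unique (g x)) →
      (∀ {x z} → x ∈ xs → z ∈ g x → NB c x k z) → Unique (concatMap g xs)
    family-unique g xs-unique k≤ adj g-unique nb = Unique-concatMap g xs-unique g-unique
      λ x∈ x′∈ x≢x′ z∈ z∈′ → separate (adj x∈) (adj x′∈) x≢x′ (nb x∈ z∈) (nb x′∈ z∈′)
        (short k≤ k≤)

    climbs-unique : ∀ m c → m ≤ suc (suc q) → Unique (climbs m c)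
    climbs-unique zero    c m≤ = [] ∷ []
    climbs-unique (suc m) c (s≤s m≤) = family-unique (climbs m) (up-unique c) m≤ up-edge
      (λ {d} _ → climbs-unique m d (m≤n⇒m≤1+n m≤)) (λ d∈ → climbs-NB m (up-up d∈))

    rebound-unique : ∀ m {c d} → m ≤ suc q → Unique (rebound m c d)
    rebound-unique m {c} {d} m≤ = family-unique (climbs m) (Unique-∖ c (up-unique d)) m≤
      (up-edge ∘ proj₁ ∘ ∈-∖⁻ {xs = up d}) (λ {e} _ → climbs-unique m e (m≤n⇒m≤1+n m≤))
      (λ e∈ → climbs-NB m (up-up (proj₁ (∈-∖⁻ {xs = up d} e∈))))

    dips-unique : ∀ m {p c} → m ≤ suc q → Unique (dips m p c)
    branches-unique : ∀ m {c ds} → m ≤ q → Unique ds → (∀ {d} → d ∈ ds → d ∈ down c) →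
                      Unique (branches m c ds)
    dips-unique zero    {p} {c} m≤ = Unique-∖ p (down-unique c)
    dips-unique (suc m) {p} {c} (s≤s m≤) =
      branches-unique m m≤ (Unique-∖ p (down-unique c)) (proj₁ ∘ ∈-∖⁻ {xs = down c})
    branches-unique m {c} {ds} m≤ ds-unique sub = ++⁺
      (family-unique (rebound m c) ds-unique (s≤s m≤) (down-edge ∘ sub)
        (λ _ → rebound-unique m (m≤n⇒m≤1+n m≤)) (λ _ → rebound-NB m))
      (family-unique (dips m c) (up-unique c) (s≤s m≤) up-edge
        (λ _ → dips-unique m (m≤n⇒m≤1+n m≤)) (λ d∈ → dips-NB m (up-down d∈)))
      λ { (z∈ , z∈′) → disjoint z∈ z∈′ }
      where
      disjoint : ∀ {z} → z ∈ concatMap (rebound m c) ds → z ∈ concatMap (dips m c) (up c) → ⊥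
      disjoint z∈ z∈′ with ∈-concatMap⇒ (rebound m c) ds z∈ | ∈-concatMap⇒ (dips m c) (up c) z∈′
      ... | d , d∈ , z∈d | d′ , d′∈ , z∈d′ = separate (down-edge (sub d∈)) (up-edge d′∈)
        (λ { refl → up-down-disjoint (trans (sym (up-label d′∈)) (down-label (sub d∈))) })
        (rebound-NB m z∈d) (dips-NB m (up-down d′∈) z∈d′)
        (short (s≤s m≤) (s≤s m≤))

    dip-count : K → ℕ → ℕ
    dip-count i zero    = X i
    dip-count i (suc m) = X i * (Y (below i) * climb-count i m) + suc (Y i) * dip-count (above i) m

    length-rebound : ∀ m {c d} → d ∈ down c →
                     length (rebound m c d) ≡ Y (below (f c)) * climb-count (f c) m
    length-rebound m {c} {d} d∈ = trans
      (length-concatMap (climbs m) (up d ∖ c) (λ e∈ → trans (length-climbs m _)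
        (cong (λ i → climb-count i m)
          (trans (up-label (proj₁ (∈-∖⁻ {xs = up d} e∈))) (sym (up-label (down-up d∈)))))))
      (cong (_* climb-count (f c) m) (trans (length-up-∖ (down-up d∈)) (cong Y (down-label d∈))))

    length-dips : ∀ m {p c} → p ∈ down c → length (dips m p c) ≡ dip-count (f c) m
    length-branches : ∀ m {c ds} → (∀ {d} → d ∈ ds → d ∈ down c) →
      length (branches m c ds) ≡ length ds * (Y (below (f c)) * climb-count (f c) m)
                                 + suc (Y (f c)) * dip-count (above (f c)) m
    length-dips zero    p∈ = length-down-∖ p∈
    length-dips (suc m) {p} {c} p∈ = trans
      (length-branches m {c} {down c ∖ p} (proj₁ ∘ ∈-∖⁻ {xs = down c}))
      (cong (λ l → l * (Y (below (f c)) * climb-count (f c) m)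
                   + suc (Y (f c)) * dip-count (above (f c)) m) (length-down-∖ p∈))
    length-branches m {c} {ds} sub = trans (length-++ (concatMap (rebound m c) ds)) (cong₂ _+_
      (length-concatMap (rebound m c) ds (length-rebound m ∘ sub))
      (trans (length-concatMap (dips m c) (up c) (λ d∈ →
               trans (length-dips m (up-down d∈)) (cong (λ i → dip-count i m) (up-label d∈))))
             (cong (_* dip-count (above (f c)) m) (length-up c))))

    single-climb : ∀ m i → (∀ k → k < m → Y (i ↑ k) ≡ 0) → climb-count i m ≡ 1
    single-climb zero    i zeros = refl
    single-climb (suc m) i zeros = trans
      (cong (λ y → suc y * climb-count (above i) m) (zeros 0 (s≤s z≤n)))
      (trans (+-identityʳ _) (single-climb m (above i) λ k k<m → zeros (suc k) (s≤s k<m)))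

    climb-count>0 : ∀ i m → 0 < climb-count i m
    climb-count>0 i zero    = ≤-refl
    climb-count>0 i (suc m) = ≤-trans (climb-count>0 (above i) m) (m≤m+n _ _)

    private
      asc : K → ℕ → ℕ
      asc = ascents C X Y

    -- A descent from height `k + 1` followed by a step up has `X` choices down and `Y` choices up,
    -- the ascent term `yₖ xₖ₊₁`; the other steps up contribute the factors of a straight climb. A
    -- descent at the very end gives `(1 + yₘ) xₘ₊₁`, that is, the last ascent term and the extra
    -- summand.
    dip-count-ascents : ∀ i m →
      suc (Y i) * dip-count (above i) m ≡ climb-count i m * (asc i m + X (i ↑ suc m))
    dip-count-ascents i zero = trans (+-comm (X (above i)) _) (sym (+-identityʳ _))
    dip-count-ascents i (suc m) = begin
      suc (Y i) * (X (above i) * (Y (below (above i)) * cc) + suc (Y (above i)) * dip-count (above (above i)) m)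
        ≡⟨ cong₂ (λ j d → suc (Y i) * (X (above i) * (Y j * cc) + d))
             (below-above i) (dip-count-ascents (above i) m) ⟩
      suc (Y i) * (X (above i) * (Y i * cc) + cc * (asc (above i) m + X (above i ↑ suc m)))
        ≡⟨ solve 5 (λ y x c a l →
             (con 1 :+ y) :* (x :* (y :* c) :+ c :* (a :+ l)) :=
             ((con 1 :+ y) :* c) :* ((y :* x :+ a) :+ l)) refl
             (Y i) (X (above i)) cc (asc (above i) m) (X (above i ↑ suc m)) ⟩
      suc (Y i) * cc * (Y i * X (above i) + asc (above i) m + X (above i ↑ suc m)) ∎
      where
      cc : ℕ
      cc = climb-count (above i) m
      open ≡-Reasoning
      open +-*-Solver

    -- Both lists consist of elements `q` colours above `c`, hence `n - 1` above `w`, and `∈-climbs`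
    -- covers that class. They are disjoint because their walks from `c` have `q` and `q + 2` steps.
    climbs+branches-≤ : ∀ {w c} → f c ≡ above (above (f w)) →
      length (climbs q c) + length (branches q c (down c)) ≤ length (climbs (suc (suc q)) w)
    climbs+branches-≤ {w} {c} fc = subst (_≤ length (climbs (suc (suc q)) w)) (length-++ (climbs q c))
      (subset-≤ (++⁺ (climbs-unique q c (≤-trans (n≤1+n _) (n≤1+n _)))
                     (branches-unique q ≤-refl (down-unique c) (λ d∈ → d∈))
                     λ { (z∈ , z∈′) → disjoint z∈ z∈′ })
        λ z∈ → ∈-climbs refl (trans (label (∈-++⁻ (climbs q c) z∈)) (cong (_↑ q) fc)))
      where
      label : ∀ {z} → z ∈ climbs q c ⊎ z ∈ branches q c (down c) → f z ≡ f c ↑ q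
      label (inj₁ z∈) = climbs-label q z∈
      label (inj₂ z∈) = branches-label q {c} {down c} (λ d∈ → d∈) z∈
      branch-path : ∀ {z} → z ∈ branches q c (down c) → Path c (suc (suc q)) z
      branch-path z∈ with branches-step q {c} {down c} z∈
      ... | inj₁ (d , d∈ , z∈′) = go (down-edge d∈) (rebound-NB q z∈′)
      ... | inj₂ (d , d∈ , z∈′) = go (up-edge d∈) (dips-NB q (up-down d∈) z∈′)
      disjoint : ∀ {z} → z ∈ climbs q c → z ∈ branches q c (down c) → ⊥
      disjoint z∈ z∈′ = 1+n≰n (≤-trans (n≤1+n (suc q)) (≤-reflexive (sym
        (length-unique (forget (climbs-NB q (irreflexive ∘ up-edge) z∈)) (branch-path z∈′)
          (+-mono-≤ {suc q} {n} {suc (suc q)} {n} (≤-trans (n≤1+n _) (n≤1+n _)) (n≤1+n _))))))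

    -- All terms of the count are multiples of `cc`. Dividing by it and removing the common
    -- `1 + Y i + last` leaves the claim; `last` enters as `Y (below i)`, since the antipode of
    -- `below i` is `n - 1` above `i`.
    few-ascents : (∀ i → X (i ↑ n) ≡ Y i) → ∀ i {w c} → f w ≡ below i → f c ≡ above i →
                  asc i (suc q) ≤ Y i * X (i ↑ suc (suc q))
    few-ascents X-antipode i {w} {c} fw fc =
      +-cancelˡ-≤ (1 + Y i + last) _ _ (*-cancelˡ-≤ cc {{>-nonZero (climb-count>0 (above i) q)}} (begin
        cc * ((1 + Y i + last) + (Y i * X (above i) + asc (above i) q))
          ≡⟨ solve 5 (λ y x c a l →
               c :* ((con 1 :+ y :+ l) :+ (y :* x :+ a)) :=
               c :+ ((con 1 :+ x) :* (y :* c) :+ c :* (a :+ l))) refl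
               (Y i) (X (above i)) cc (asc (above i) q) last ⟩
        cc + (suc (X (above i)) * (Y i * cc) + cc * (asc (above i) q + last))
          ≡⟨ sym (cong₂ (λ j d → cc + (suc (X (above i)) * (Y j * cc) + d))
               (below-above i) (dip-count-ascents (above i) q)) ⟩
        cc + (suc (X (above i)) * (Y (below (above i)) * cc)
              + suc (Y (above i)) * dip-count (above (above i)) q)
          ≡⟨ cong (λ j → climb-count j q + (suc (X j) * (Y (below j) * climb-count j q)
                         + suc (Y j) * dip-count (above j) q)) (sym fc) ⟩
        climb-count (f c) q + (suc (X (f c)) * (Y (below (f c)) * climb-count (f c) q)
                               + suc (Y (f c)) * dip-count (above (f c)) q)
          ≡⟨ sym (cong₂ _+_ (length-climbs q c) (trans (length-branches q {c} {down c} (λ d∈ → d∈))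
               (cong (λ l → l * (Y (below (f c)) * climb-count (f c) q)
                            + suc (Y (f c)) * dip-count (above (f c)) q) (length-down c)))) ⟩
        length (climbs q c) + length (branches q c (down c))
          ≤⟨ climbs+branches-≤ (trans fc (cong above (trans (sym (above-below i)) (cong above (sym fw))))) ⟩
        length (climbs (suc (suc q)) w)
          ≡⟨ trans (length-climbs (suc (suc q)) w) (cong (λ j → climb-count j (suc (suc q))) fw) ⟩
        suc (Y (below i)) * climb-count (above (below i)) (suc q)
          ≡⟨ cong₂ (λ y j → suc y * climb-count j (suc q)) Y-below (above-below i) ⟩
        suc last * (suc (Y i) * cc)
          ≡⟨ solve 3 (λ y c l → (con 1 :+ l) :* ((con 1 :+ y) :* c) :=
                                c :* ((con 1 :+ y :+ l) :+ y :* l)) refl (Y i) cc last ⟩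
        cc * ((1 + Y i + last) + Y i * last) ∎))
      where
      cc last : ℕ
      cc   = climb-count (above i) q
      last = X (i ↑ suc (suc q))
      Y-below : Y (below i) ≡ last
      Y-below = trans (sym (X-antipode (below i))) (cong (λ j → X (j ↑ suc (suc q))) (above-below i))
      open ≤-Reasoning
      open +-*-Solver

-- Finite polygons have a colour taken only once

module _ {v e κ} {V : Set v} {E : V → V → Set e} {q : ℕ} (𝒫 : Polygon E (3 + q))
  {K : Set κ} (C : Cycle K (3 + q)) (f : V → K)
  (edge : ∀ {x y} → E x y → f y ≡ Cycle.above C (f x) ⊎ f x ≡ Cycle.above C (f y))
  (E? : ∀ x y → Dec (E x y)) (vs : List V) (vs-unique : Unique vs) (∈vs : ∀ x → x ∈ vs)
  (pair : ∀ i → ∃[ x ] ∃[ y ] f x ≡ i × f y ≡ i × x ≢ y)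
  (three : ∀ i → ∃[ x ] ∃[ ys ] f x ≡ i × length ys ≡ 3 × Unique ys × (∀ {y} → y ∈ ys → E x y))
  (i₀ : K)
  where

  private
    n : ℕ
    n = 3 + q

    open PolygonProperties 𝒫
    open Cycle C using (above; below; _↑_; ↑-distinct; below-above; above-below; antipode-involutive;
                        antipode-below; reversed)
    open FiniteLabelled 𝒫 C f edge E? vs vs-unique ∈vs

    edge⁻ : ∀ {x y} → E x y → f y ≡ below (f x) ⊎ f x ≡ below (f y)
    edge⁻ a = swap (map flip flip (edge a))
      where
      flip : ∀ {i j} → i ≡ above j → j ≡ below i
      flip eq = trans (sym (below-above _)) (cong below (sym eq))

    module Reversed = FiniteLabelled 𝒫 reversed f edge⁻ E? vs vs-unique ∈vs
    open Removal _≟_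

    rep : K → V
    rep i = proj₁ (pair i)

    rep-label : ∀ i → f (rep i) ≡ i
    rep-label i = proj₁ (proj₂ (proj₂ (pair i)))

    down-≤-up : ∀ {x z} → f z ≡ f x ↑ n → length (down x) ≤ length (up z)
    down-≤-up fz = Reversed.up-≤-down (trans fz (sym (antipode-below _)))

    antipodal : ∀ {i j} → i ≡ j ↑ n → j ≡ i ↑ n
    antipodal {j = j} eq = trans (sym (antipode-involutive j)) (cong (_↑ n) (sym eq))

    -- Both numbers are compared with the number below one element of the antipodal colour.
    up-constant : ∀ {x x′} → f x ≡ f x′ → length (up x) ≤ length (up x′)
    up-constant {x} {x′} eq = ≤-trans (up-≤-down {x} {z} (rep-label _))
      (down-≤-up {z} {x′} (trans (sym eq) (antipodal (rep-label (f x ↑ n)))))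
      where
      z : V
      z = rep (f x ↑ n)

    down-constant : ∀ {x x′} → f x ≡ f x′ → length (down x) ≤ length (down x′)
    down-constant {x} {x′} eq = ≤-trans (down-≤-up {x} {z} (rep-label _))
      (up-≤-down {z} {x′} (trans (sym eq) (antipodal (rep-label (f x ↑ n)))))
      where
      z : V
      z = rep (f x ↑ n)

    a b : K → ℕ
    a i = length (up (rep i))
    b i = length (down (rep i))

    b-antipode : ∀ i → b (i ↑ n) ≡ a i
    b-antipode i = ≤-antisym
      (down-≤-up {rep (i ↑ n)} {rep i} (trans (rep-label i) (antipodal (rep-label (i ↑ n)))))
      (up-≤-down {rep i} {rep (i ↑ n)} (trans (rep-label _) (cong (_↑ n) (sym (rep-label i)))))

    a-antipode : ∀ i → a (i ↑ n) ≡ b i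
    a-antipode i = trans (sym (b-antipode (i ↑ n))) (cong b (antipode-involutive i))

    nonempty : ∀ {A : Set v} {z : A} {xs} → z ∈ xs → 0 < length xs
    nonempty (here _)  = s≤s z≤n
    nonempty (there _) = s≤s z≤n

    -- Some element has the colour `n - 1` higher, and it is reached by climbing.
    a>0 : ∀ i → 0 < a i
    a>0 i with ∈-concatMap⇒ (climbs (suc q)) (up (rep i))
                 (∈-climbs {rep i} {rep (f (rep i) ↑ suc (suc q))} refl (rep-label _))
    ... | d , d∈ , _ = nonempty d∈

    b>0 : ∀ i → 0 < b i
    b>0 i = subst (0 <_) (a-antipode i) (a>0 (i ↑ n))

    Y X : K → ℕ
    Y i = pred (a i)
    X i = pred (b i)

    1+pred : ∀ {m} → 0 < m → suc (pred m) ≡ m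
    1+pred (s≤s _) = refl

    length-up : ∀ c → length (up c) ≡ suc (Y (f c))
    length-up c = trans (≤-antisym (up-constant (sym (rep-label (f c)))) (up-constant (rep-label (f c))))
                        (sym (1+pred (a>0 (f c))))

    length-down : ∀ c → length (down c) ≡ suc (X (f c))
    length-down c =
      trans (≤-antisym (down-constant (sym (rep-label (f c)))) (down-constant (rep-label (f c))))
            (sym (1+pred (b>0 (f c))))

    valency : ∀ c → length (nbrs c) ≡ 2 + (X (f c) + Y (f c))
    valency c = trans (sym (up+down c)) (trans (cong₂ _+_ (length-up c) (length-down c))
      (cong suc (trans (+-suc _ _) (cong suc (+-comm (Y (f c)) _)))))

    -- Thickness is assumed at one element of each colour only; it spreads because the valency
    -- depends on the colour.
    valency≥3 : ∀ c → 3 ≤ length (nbrs c)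
    valency≥3 c with three (f c)
    ... | x , ys , fx , ys≡3 , ys-unique , adj = begin
      3                          ≡⟨ sym ys≡3 ⟩
      length ys                  ≤⟨ subset-≤ ys-unique (∈-nbrs ∘ adj) ⟩
      length (nbrs x)            ≡⟨ valency x ⟩
      2 + (X (f x) + Y (f x))    ≡⟨ cong (λ i → 2 + (X i + Y i)) fx ⟩
      2 + (X (f c) + Y (f c))    ≡⟨ sym (valency c) ⟩
      length (nbrs c)            ∎
      where open ≤-Reasoning

    member : ∀ (xs : List V) → 0 < length xs → ∃[ z ] z ∈ xs
    member (x ∷ xs) _ = x , here refl

    third : ∀ {c x y} → E c x → E c y → x ≢ y → ∃[ z ] E c z × z ≢ x × z ≢ y
    third {c} {x} {y} ax ay x≢y =
      pick (member (nbrs c ∖ x ∖ y) (≤-pred (≤-pred (subst (3 ≤_) (sym two-less) (valency≥3 c)))))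
      where
      y∈ : y ∈ nbrs c ∖ x
      y∈ = ∈-filter⁺ _ (∈-nbrs ay) (x≢y ∘ sym)
      two-less : suc (suc (length (nbrs c ∖ x ∖ y))) ≡ length (nbrs c)
      two-less = trans (cong suc (length-∖ (Unique-∖ x (nbrs-unique c)) y∈))
                       (length-∖ (nbrs-unique c) (∈-nbrs ax))
      pick : ∃[ z ] z ∈ nbrs c ∖ x ∖ y → ∃[ z ] E c z × z ≢ x × z ≢ y
      pick (z , z∈) with ∈-∖⁻ {xs = nbrs c ∖ x} z∈
      ... | z∈′ , z≢y with ∈-∖⁻ {xs = nbrs c} z∈′
      ...   | z∈″ , z≢x = z , nbrs-edge z∈″ , z≢x , z≢y

    up-member : ∀ c → ∃[ d ] d ∈ up c
    up-member c = member (up c) (subst (0 <_) (sym (length-up c)) (s≤s z≤n))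

    down-member : ∀ c → ∃[ d ] d ∈ down c
    down-member c = member (down c) (subst (0 <_) (sym (length-down c)) (s≤s z≤n))

    no-dead-end : ∀ x p → ∃[ y ] E x y × y ≢ p
    no-dead-end x p = choose (up-member x) (down-member x)
      where
      choose : ∃[ y ] y ∈ up x → ∃[ y ] y ∈ down x → ∃[ y ] E x y × y ≢ p
      choose (y , y∈) (y′ , y′∈) = case y ≟ p of λ where
        (no  y≢p) → y , up-edge y∈ , y≢p
        (yes y≡p) → y′ , down-edge y′∈ ,
          λ y′≡p → up-up y∈ (subst (λ d → x ∈ up d) (trans y′≡p (sym y≡p)) (down-up y′∈))

    -- A third neighbour of `m` starts a walk that reaches, after `n` steps from `x` as well as from
    -- `y`, an element opposite both; opposite elements have equal valencies.
    valency-period : ∀ {x m y} → m ∈ up x → y ∈ up m → length (nbrs x) ≡ length (nbrs y)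
    valency-period {x} {m} {y} m∈ y∈ =
      via (third (symmetric (up-edge m∈)) (up-edge y∈) (λ x≡y → up-up m∈ (subst (_∈ up m) (sym x≡y) y∈)))
      where
      opposites : ∀ {y′ z} → E m y′ → y′ ≢ x → y′ ≢ y → NB m y′ (suc q) z →
                  Path x n z × Path y n z
      opposites b y′≢x y′≢y w = go (up-edge m∈) (step b y′≢x w) ,
                                go (symmetric (up-edge y∈)) (step b y′≢y w)
      via : ∃[ y′ ] E m y′ × y′ ≢ x × y′ ≢ y → length (nbrs x) ≡ length (nbrs y)
      via (y′ , b , y′≢x , y′≢y) =
        let z , w = extend no-dead-end (suc q) m y′
            x⇒z , y⇒z = opposites b y′≢x y′≢y w
        in trans (opposite-≡ x⇒z) (sym (opposite-≡ y⇒z))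

    weight-period : ∀ i → X (above (above i)) + Y (above (above i)) ≡ X i + Y i
    weight-period i = via (up-member (rep i))
      where
      two-up : ∀ {m y} → m ∈ up (rep i) → y ∈ up m → f y ≡ above (above i)
      two-up m∈ y∈ = trans (up-label y∈) (cong above (trans (up-label m∈) (cong above (rep-label i))))
      same-weight : ∀ {m y} → m ∈ up (rep i) → y ∈ up m → X (f y) + Y (f y) ≡ X (f (rep i)) + Y (f (rep i))
      same-weight {m} {y} m∈ y∈ = suc-injective (suc-injective
        (trans (sym (valency y)) (trans (sym (valency-period m∈ y∈)) (valency (rep i)))))
      via : ∃[ m ] m ∈ up (rep i) → X (above (above i)) + Y (above (above i)) ≡ X i + Y i
      via (m , m∈) =
        let y , y∈ = up-member m
        in subst₂ (λ j k → X j + Y j ≡ X k + Y k) (two-up m∈ y∈) (rep-label i) (same-weight m∈ y∈)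

    weight-positive : ∀ i → 0 < X i + Y i
    weight-positive i = subst (λ j → 0 < X j + Y j) (rep-label i)
      (≤-pred (≤-pred (subst (3 ≤_) (valency (rep i)) (valency≥3 (rep i)))))

    open Counting X Y length-up length-down

    same : ∀ {xs : List V} {x y} → length xs ≡ 1 → x ∈ xs → y ∈ xs → x ≡ y
    same {_ ∷ []} _ (here refl) (here refl) = refl

    -- The climbs of `n - 1` steps exhaust the class, and with no choice at any step there is only
    -- one.
    single-class : ∀ i → (∀ k → k < suc (suc q) → Y (i ↑ k) ≡ 0) →
                   ∀ {x y} → f x ≡ i ↑ suc (suc q) → f y ≡ i ↑ suc (suc q) → x ≡ y
    single-class i zeros fx fy = same
      (trans (length-climbs (suc (suc q)) (rep i))
        (trans (cong (λ j → climb-count j (suc (suc q))) (rep-label i))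
          (single-climb (suc (suc q)) i zeros)))
      (reached fx) (reached fy)
      where
      reached : ∀ {x} → f x ≡ i ↑ suc (suc q) → x ∈ climbs (suc (suc q)) (rep i)
      reached fx = ∈-climbs refl (trans fx (cong (_↑ suc (suc q)) (sym (rep-label i))))

    X-antipode : ∀ i → X (i ↑ n) ≡ Y i
    X-antipode i = cong pred (b-antipode i)

    Y-antipode : ∀ i → Y (i ↑ n) ≡ X i
    Y-antipode i = cong pred (a-antipode i)

    few : ∀ i → ascents C X Y i (suc q) ≤ Y i * X (i ↑ suc (suc q))
    few i = few-ascents X-antipode i (rep-label (below i)) (rep-label (above i))

    contradiction : ∃[ i ] (∀ k → k < suc (suc q) → Y (i ↑ k) ≡ 0) → ⊥
    contradiction (i , zeros) =
      let x , y , fx , fy , x≢y = pair (i ↑ suc (suc q)) in x≢y (single-class i zeros fx fy)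

  no-finite-labelling : ⊥
  no-finite-labelling = contradiction
    (window C X Y weight-period weight-positive X-antipode Y-antipode refl few i₀)

-- Incidence graphs of geometries

module _ {V : Set v} (E : V → V → Set e) where
  open Walks E

  private
    vertex : ∀ {p c k z} → NB p c k z → ℕ → V
    vertex {p}     w            zero    = p
    vertex {c = c} stop         (suc i) = c
    vertex         (step a _ w) (suc i) = vertex w i

    vertex-edge : ∀ {p c k z} → E p c → (w : NB p c k z) → ∀ i → i ≤ k →
                  E (vertex w i) (vertex w (suc i))
    vertex-edge a stop         zero    i≤k       = a
    vertex-edge a (step _ _ _) zero    i≤k       = a
    vertex-edge a (step b _ w) (suc i) (s≤s i≤k) = vertex-edge b w i i≤k

    vertex-last : ∀ {p c k z} (w : NB p c k z) → vertex w (suc k) ≡ z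
    vertex-last stop         = refl
    vertex-last (step _ _ w) = vertex-last w

    initial : ∀ {p c k z} (w : NB p c k z) → ∀ j → j ≤ k → NB p c j (vertex w (suc j))
    initial stop           zero    j≤k       = stop
    initial (step a d≢p w) zero    j≤k       = stop
    initial (step a d≢p w) (suc j) (s≤s j≤k) = step a d≢p (initial w j j≤k)

    segment : ∀ {p c k z} → E p c → (w : NB p c k z) → ∀ i j → i < j → j ≤ suc k →
              vertex w i ≡ vertex w j →
              ∃[ p′ ] ∃[ c′ ] ∃[ k′ ] k′ < j × E p′ c′ × NB p′ c′ k′ p′
    segment {p} {c} a w zero (suc j) _ (s≤s j≤k) eq =
      p , c , j , ≤-refl , a , subst (NB p c j) (sym eq) (initial w j j≤k)
    segment a stop (suc i) (suc j) (s≤s i<j) (s≤s z≤n) eq = ⊥-elim (n≮0 i<j)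
    segment a (step b _ w) (suc i) (suc j) (s≤s i<j) (s≤s j≤) eq with segment b w i j i<j j≤ eq
    ... | p′ , c′ , k′ , k′<j , rest = p′ , c′ , k′ , m<n⇒m<1+n k′<j , rest

  -- A shortest closed walk without backtracking is a circuit.
  girth-from-circuits : (∀ {x} → E x x → ⊥) → ∀ {l} →
    (∀ N (g : ℕ → V) → 3 ≤ N → N < l → (∀ i → i < N → E (g i) (g (suc i))) → g N ≡ g 0 →
      (∀ i j → i < j → j < N → g i ≢ g j) → ⊥) →
    ∀ {p c k} → E p c → NB p c k p → suc k < l → ⊥
  girth-from-circuits irr {l} no-circuit {k = k} = go′ (suc k) ≤-refl
    where
    go′ : ∀ bound {p c k} → k < bound → E p c → NB p c k p → suc k < l → ⊥
    go′ (suc bound) {k = zero}        k< a stop _ = irr a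
    go′ (suc bound) {k = suc zero}    k< a (step _ p≢p stop) _ = p≢p refl
    go′ (suc bound) {k = suc (suc k)} (s≤s k≤) a w lt =
      no-circuit (3 + k) (vertex w) (s≤s (s≤s (s≤s z≤n))) lt
        (λ { i (s≤s i≤) → vertex-edge a w i i≤ }) (vertex-last w) distinct
      where
      distinct : ∀ i j → i < j → j < 3 + k → vertex w i ≢ vertex w j
      distinct i j i<j j< eq with segment a w i j i<j (<⇒≤ j<) eq
      ... | p′ , c′ , k′ , k′<j , a′ , w′ = go′ bound
        (<-≤-trans (<-≤-trans k′<j (≤-pred j<)) k≤) a′ w′
        (<-trans (s≤s (<-≤-trans k′<j (≤-pred j<))) lt)

module Incidence (Γ : Geometry ℓ) where
  open Geometry Γ

  data Adjacent : Element → Element → Set ℓ where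
    pl : ∀ {x M} → x I M → Adjacent (inj₁ x) (inj₂ M)
    lp : ∀ {x M} → x I M → Adjacent (inj₂ M) (inj₁ x)

  adjacent-sym : ∀ {x y} → Adjacent x y → Adjacent y x
  adjacent-sym (pl i) = lp i
  adjacent-sym (lp i) = pl i

  isPoint : Element → Bool
  isPoint (inj₁ _) = true
  isPoint (inj₂ _) = false

  adjacent-alternate : ∀ {x y} → Adjacent x y → isPoint y ≡ not (isPoint x)
  adjacent-alternate (pl _) = refl
  adjacent-alternate (lp _) = refl

toℕ-next : ∀ {m} (i : Fin m) →
           toℕ (next i) ≡ suc (toℕ i) ⊎ (suc (toℕ i) ≡ m × toℕ (next i) ≡ 0)
toℕ-next {suc m} i with m≤n⇒m<n∨m≡n (toℕ<n i)
... | inj₁ i<m = inj₁ (trans (toℕ-fromℕ< _) (m<n⇒m%n≡m i<m))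
... | inj₂ eq  = inj₂ (eq , trans (toℕ-fromℕ< _) (trans (cong (λ j → j % suc m) eq) (n%n≡0 (suc m))))

next-injective : ∀ {m} → Injective _≡_ _≡_ (next {m})
next-injective {m} {i} {j} eq with toℕ-next i | toℕ-next j
... | inj₁ e       | inj₁ e′        = toℕ-injective (suc-injective (trans (sym e) (trans (cong toℕ eq) e′)))
... | inj₂ (e , _) | inj₂ (e′ , _)  = toℕ-injective (suc-injective (trans e (sym e′)))
... | inj₁ e       | inj₂ (_ , e′)  = ⊥-elim (1+n≢0 (trans (sym e) (trans (cong toℕ eq) e′)))
... | inj₂ (_ , e) | inj₁ e′        = ⊥-elim (1+n≢0 (trans (sym e′) (trans (cong toℕ (sym eq)) e)))

mod-toℕ : ∀ {m} (i : Fin (suc m)) → toℕ i mod suc m ≡ i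
mod-toℕ i = toℕ-injective (trans (toℕ-fromℕ< _) (m<n⇒m%n≡m (toℕ<n i)))

next-mod : ∀ {m} i → next (i mod suc m) ≡ suc i mod suc m
next-mod {m} i = toℕ-injective (begin
  toℕ (next (i mod suc m))          ≡⟨ toℕ-fromℕ< _ ⟩
  suc (toℕ (i mod suc m)) % suc m   ≡⟨ cong (λ j → suc j % suc m) (toℕ-fromℕ< _) ⟩
  suc (i % suc m) % suc m           ≡⟨ %-distribˡ-+ 1 (i % suc m) (suc m) ⟩
  (1 % suc m + i % suc m % suc m) % suc m ≡⟨ cong (λ j → (1 % suc m + j) % suc m) (m%n%n≡m%n i (suc m)) ⟩
  (1 % suc m + i % suc m) % suc m   ≡⟨ sym (%-distribˡ-+ 1 i (suc m)) ⟩
  suc i % suc m                     ≡⟨ sym (toℕ-fromℕ< _) ⟩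
  toℕ (suc i mod suc m)             ∎)
  where open ≡-Reasoning

dualGon : {Γ : Geometry ℓ} → ∀ {m} → OrdinaryGon (dual Γ) m → OrdinaryGon Γ m
dualGon G = record
  { point           = line
  ; line            = point ∘ next
  ; point-injective = line-injective
  ; line-injective  = next-injective ∘ point-injective
  ; point-I-line    = next-I-line
  ; next-I-line     = point-I-line ∘ next
  }
  where open OrdinaryGon G

NoSmallGons : Geometry ℓ → ℕ → Set ℓ
NoSmallGons Γ n = ∀ m → 2 ≤ m → m < n → OrdinaryGon Γ m → ⊥

half : ∀ N → ∃[ m ] (N ≡ m + m ⊎ N ≡ suc (m + m))
half zero = 0 , inj₁ refl
half (suc N) with half N
... | m , inj₁ eq = m , inj₂ (cong suc eq)
... | m , inj₂ eq = suc m , inj₁ (cong suc (trans eq (sym (+-suc m m))))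

module CircuitGon (Γ : Geometry ℓ) where
  open Geometry Γ
  open Incidence Γ

  module _ (N : ℕ) (g : ℕ → Element) (edges : ∀ i → i < N → Adjacent (g i) (g (suc i)))
           (closed : g N ≡ g 0) (distinct : ∀ i j → i < j → j < N → g i ≢ g j)
           {x₀ : Point} (start : g 0 ≡ inj₁ x₀) where

    private
      points : ∀ i → i + i ≤ N → ∃[ x ] g (i + i) ≡ inj₁ x
      lines  : ∀ i → i + i < N → ∃[ M ] g (suc (i + i)) ≡ inj₂ M
      points zero    le = x₀ , start
      points (suc i) le with lines i (≤-trans (n≤1+n _) (subst (_≤ N) (cong suc (+-suc i i)) le))
      ... | M , eq with g (suc (i + i)) | g (suc (suc (i + i)))
                      | edges (suc (i + i)) (subst (_≤ N) (cong suc (+-suc i i)) le)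
                      | cong g (sym (cong suc (+-suc i i)))
      points (suc i) le | M , refl | .(inj₂ M) | .(inj₁ _) | lp _ | eq′ = _ , sym eq′
      lines i lt with points i (<⇒≤ lt)
      ... | x , eq with g (i + i) | g (suc (i + i)) | edges (i + i) lt
      lines i lt | x , refl | .(inj₁ x) | .(inj₂ _) | pl _ = _ , refl

      injective : ∀ {i j} → i < N → j < N → g i ≡ g j → i ≡ j
      injective {i} {j} i<N j<N eq with <-cmp i j
      ... | tri< i<j _ _ = ⊥-elim (distinct i j i<j j<N eq)
      ... | tri≈ _ i≡j _ = i≡j
      ... | tri> _ _ j<i = ⊥-elim (distinct j i j<i i<N (sym eq))

    private
      i+i<N : ∀ {m} → N ≡ m + m → (i : Fin m) → toℕ i + toℕ i < N
      i+i<N eq i = subst (toℕ i + toℕ i <_) (sym eq) (+-mono-< (toℕ<n i) (toℕ<n i))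

      1+i+i<N : ∀ {m} → N ≡ m + m → (i : Fin m) → suc (toℕ i + toℕ i) < N
      1+i+i<N {m} eq i = subst (suc (toℕ i + toℕ i) <_) (sym eq)
        (subst (_≤ m + m) (cong suc (+-suc (toℕ i) (toℕ i))) (+-mono-≤ (toℕ<n i) (toℕ<n i)))

      double-injective : ∀ i j → i + i ≡ j + j → i ≡ j
      double-injective zero    zero    eq = refl
      double-injective (suc i) (suc j) eq = cong suc (double-injective i j
        (suc-injective (trans (sym (+-suc i i)) (trans (suc-injective eq) (+-suc j j)))))

      module Even {m} (N≡m+m : N ≡ m + m) where
        pt : (i : Fin m) → ∃[ x ] g (toℕ i + toℕ i) ≡ inj₁ x
        pt i = points (toℕ i) (<⇒≤ (i+i<N N≡m+m i))

        ln : (i : Fin m) → ∃[ M ] g (suc (toℕ i + toℕ i)) ≡ inj₂ M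
        ln i = lines (toℕ i) (i+i<N N≡m+m i)

        incident : ∀ {x M} → Adjacent (inj₁ x) (inj₂ M) → x I M
        incident (pl i) = i

        next-point : ∀ i → g (suc (suc (toℕ i + toℕ i))) ≡ inj₁ (proj₁ (pt (next i)))
        next-point i with toℕ-next i
        ... | inj₁ eq = begin
          g (suc (suc (toℕ i + toℕ i)))       ≡⟨ cong g (sym (cong suc (+-suc (toℕ i) (toℕ i)))) ⟩
          g (suc (toℕ i) + suc (toℕ i))       ≡⟨ cong (λ j → g (j + j)) (sym eq) ⟩
          g (toℕ (next i) + toℕ (next i))     ≡⟨ proj₂ (pt (next i)) ⟩
          inj₁ (proj₁ (pt (next i)))          ∎
          where open ≡-Reasoning
        ... | inj₂ (eq , next≡0) = begin
          g (suc (suc (toℕ i + toℕ i)))       ≡⟨ cong g (sym (cong suc (+-suc (toℕ i) (toℕ i)))) ⟩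
          g (suc (toℕ i) + suc (toℕ i))       ≡⟨ cong (λ j → g (j + j)) eq ⟩
          g (m + m)                           ≡⟨ cong g (sym N≡m+m) ⟩
          g N                                 ≡⟨ closed ⟩
          g (0 + 0)                           ≡⟨ cong (λ j → g (j + j)) (sym next≡0) ⟩
          g (toℕ (next i) + toℕ (next i))     ≡⟨ proj₂ (pt (next i)) ⟩
          inj₁ (proj₁ (pt (next i)))          ∎
          where open ≡-Reasoning

        gon : OrdinaryGon Γ m
        gon = record
          { point           = proj₁ ∘ pt
          ; line            = proj₁ ∘ ln
          ; point-injective = λ {i} {j} eq → toℕ-injective (double-injective _ _
              (injective (i+i<N N≡m+m i) (i+i<N N≡m+m j)
                (trans (proj₂ (pt i)) (trans (cong inj₁ eq) (sym (proj₂ (pt j)))))))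
          ; line-injective  = λ {i} {j} eq → toℕ-injective (double-injective _ _ (suc-injective
              (injective (1+i+i<N N≡m+m i) (1+i+i<N N≡m+m j)
                (trans (proj₂ (ln i)) (trans (cong inj₂ eq) (sym (proj₂ (ln j))))))))
          ; point-I-line    = λ i → incident (subst₂ Adjacent (proj₂ (pt i)) (proj₂ (ln i))
              (edges _ (i+i<N N≡m+m i)))
          ; next-I-line     = λ i → incident (subst₂ Adjacent (next-point i) (proj₂ (ln i))
              (adjacent-sym (edges _ (1+i+i<N N≡m+m i))))
          }

      odd : ∀ {m} → N ≡ suc (m + m) → ⊥
      odd {m} eq with lines m (≤-reflexive (sym eq))
      ... | M , eq′ = case trans (sym start) (trans (sym closed) (trans (cong g eq) eq′)) of λ ()

    circuit-gon : ∃[ m ] N ≡ m + m × OrdinaryGon Γ m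
    circuit-gon with half N
    ... | m , inj₁ eq = m , eq , Even.gon eq
    ... | m , inj₂ eq = ⊥-elim (odd {m} eq)

module _ (Γ : Geometry ℓ) {n : ℕ} (no-gons : NoSmallGons Γ n) where
  open Geometry Γ
  open Incidence Γ
  open Walks Adjacent

  private
    swap-adjacent : ∀ {x y} → Adjacent x y → Incidence.Adjacent (dual Γ) (swap x) (swap y)
    swap-adjacent (pl i) = Incidence.lp i
    swap-adjacent (lp i) = Incidence.pl i

    swap-injective : ∀ {x y : Element} → swap x ≡ swap y → x ≡ y
    swap-injective {inj₁ _} {inj₁ _} refl = refl
    swap-injective {inj₂ _} {inj₂ _} refl = refl

    no-gon : ∀ {N} → 3 ≤ N → N < n + n → ∃[ m ] N ≡ m + m × OrdinaryGon Γ m → ⊥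
    no-gon 3≤N N<2n (zero , refl , G) = n≮0 3≤N
    no-gon 3≤N N<2n (suc zero , refl , G) = n≮0 (≤-pred (≤-pred 3≤N))
    no-gon 3≤N N<2n (m@(suc (suc _)) , refl , G) =
      no-gons m (s≤s (s≤s z≤n)) (≰⇒> (λ n≤m → <⇒≱ N<2n (+-mono-≤ n≤m n≤m))) G

  geometry-girth : ∀ {p c k} → Adjacent p c → NB p c k p → suc k < n + n → ⊥
  geometry-girth = girth-from-circuits Adjacent
    (λ a → case adjacent-alternate a of λ eq → not-fixed eq) circuit
    where
    not-fixed : ∀ {b} → b ≡ not b → ⊥
    not-fixed {false} ()
    not-fixed {true}  ()
    circuit : ∀ N (g : ℕ → Element) → 3 ≤ N → N < n + n →
      (∀ i → i < N → Adjacent (g i) (g (suc i))) → g N ≡ g 0 →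
      (∀ i j → i < j → j < N → g i ≢ g j) → ⊥
    circuit N g 3≤N N<2n edges closed distinct with g 0 in start
    ... | inj₁ x₀ = no-gon 3≤N N<2n (CircuitGon.circuit-gon Γ N g edges
            (trans closed (sym start)) distinct start)
    -- A circuit starting at a line is one of the dual starting at a point.
    ... | inj₂ M₀ = no-gon 3≤N N<2n
          (case CircuitGon.circuit-gon (dual Γ) N (swap ∘ g) (λ i i<N → swap-adjacent (edges i i<N))
                 (cong swap (trans closed (sym start)))
                 (λ i j i<j j<N eq → distinct i j i<j j<N (swap-injective eq)) (cong swap start) of λ where
            (m , eq , G) → m , eq , dualGon G)

module _ {V : Set v} {E : V → V → Set e} (E-sym : ∀ {x y} → E x y → E y x) where
  open Walks E

  -- Of the two arcs between positions on a closed walk of `2n` steps, one has at most `n` steps.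
  arc : ∀ {n} (g : ℕ → V) → (∀ i → E (g i) (g (suc i))) → (∀ i → g (n + n + i) ≡ g i) →
        ∀ i j → i < n + n → j < n + n → ∃[ k ] k ≤ n × Walk (g i) k (g j)
  arc {n} g edges periodic i j i<2n j<2n = [ ordered j<2n , flipped ∘ ordered i<2n ]′ (≤-total i j)
    where
    open ≤-Reasoning
    forward : ∀ k i → Walk (g i) k (g (k + i))
    forward zero    i = nil
    forward (suc k) i = edges i ∷ subst (Walk (g (suc i)) k) (cong g (+-suc k i)) (forward k (suc i))
    ordered : ∀ {i j} → j < n + n → i ≤ j → ∃[ k ] k ≤ n × Walk (g i) k (g j)
    ordered {i} {j} j<2n i≤j with ≤-total (j ∸ i) n
    ... | inj₁ short = j ∸ i , short , subst (Walk (g i) (j ∸ i)) (cong g (m∸n+n≡m i≤j)) (forward (j ∸ i) i)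
    ... | inj₂ long  = n + n + i ∸ j ,
      (begin
        n + n + i ∸ j         ≤⟨ ∸-monoʳ-≤ (n + n + i) n+i≤j ⟩
        n + n + i ∸ (n + i)   ≡⟨ cong (_∸ (n + i)) (+-assoc n n i) ⟩
        n + (n + i) ∸ (n + i) ≡⟨ m+n∸n≡m n (n + i) ⟩
        n                     ∎) ,
      reverseWalk E-sym (subst (Walk (g j) (n + n + i ∸ j))
        (trans (cong g (m∸n+n≡m (≤-trans (<⇒≤ j<2n) (m≤m+n _ i)))) (periodic i))
        (forward (n + n + i ∸ j) j))
      where
      n+i≤j : n + i ≤ j
      n+i≤j = begin
        n + i     ≤⟨ +-monoˡ-≤ i long ⟩
        j ∸ i + i ≡⟨ m∸n+n≡m i≤j ⟩
        j         ∎
    flipped : ∃[ k ] k ≤ n × Walk (g j) k (g i) → ∃[ k ] k ≤ n × Walk (g i) k (g j)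
    flipped (k , k≤n , w) = k , k≤n , reverseWalk E-sym w

-- `V` enumerates the elements of Γ or of a subpolygon. The girth is inherited from Γ, since an
-- injective `φ` keeps walks free of backtracking; for the diameter the ordinary gons must lie in
-- the subpolygon itself.
module Embedded (Γ : Geometry ℓ) {q : ℕ} (no-gons : NoSmallGons Γ (3 + q))
  {V : Set v} (φ : V → Geometry.Element Γ) (φ-injective : ∀ {x y} → φ x ≡ φ y → x ≡ y)
  (_≟_ : (x y : V) → Dec (x ≡ y))
  (common : ∀ x y → ∃[ G ] (∀ i → ∃[ u ] φ u ≡ inj₁ (OrdinaryGon.point {Γ = Γ} {m = 3 + q} G i))
                         × (∀ i → ∃[ u ] φ u ≡ inj₂ (OrdinaryGon.line G i))
                         × _LiesIn_ Γ (φ x) G × _LiesIn_ Γ (φ y) G)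
  where

  open Incidence Γ

  private
    n : ℕ
    n = 3 + q

    E : V → V → Set _
    E = Adjacent on φ

    module Γ-walks = Walks Adjacent

    φ-NB : ∀ {p c k z} → Walks.NB E p c k z → Γ-walks.NB (φ p) (φ c) k (φ z)
    φ-NB Walks.stop           = Γ-walks.stop
    φ-NB (Walks.step a d≢p w) = Γ-walks.step a (d≢p ∘ φ-injective) (φ-NB w)

    module Circuit (G : OrdinaryGon Γ n)
      (pt : ∀ i → ∃[ u ] φ u ≡ inj₁ (OrdinaryGon.point G i))
      (ln : ∀ i → ∃[ u ] φ u ≡ inj₂ (OrdinaryGon.line G i)) where
      open OrdinaryGon G

      -- The vertex `j` steps along the circuit from point `i`, so that even `j` give points.
      from : ℕ → ℕ → V
      from i zero          = proj₁ (pt (i mod n))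
      from i (suc zero)    = proj₁ (ln (i mod n))
      from i (suc (suc j)) = from (suc i) j

      from-edge : ∀ i j → E (from i j) (from i (suc j))
      from-edge i zero = subst₂ Adjacent (sym (proj₂ (pt (i mod n)))) (sym (proj₂ (ln (i mod n))))
        (pl (point-I-line (i mod n)))
      from-edge i (suc zero) = subst₂ Adjacent (sym (proj₂ (ln (i mod n))))
        (sym (trans (proj₂ (pt (suc i mod n))) (cong (inj₁ ∘ point) (sym (next-mod i)))))
        (lp (next-I-line (i mod n)))
      from-edge i (suc (suc j)) = from-edge (suc i) j

      from-+ : ∀ k i j → from i (k + k + j) ≡ from (k + i) j
      from-+ zero    i j = refl
      from-+ (suc k) i j = trans (cong (λ l → from i (suc l + j)) (+-suc k k))
        (trans (from-+ k (suc i) j) (cong (λ l → from l j) (+-suc k i)))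

      mod-periodic : ∀ i → (n + i) mod n ≡ i mod n
      mod-periodic i = toℕ-injective (trans (toℕ-fromℕ< _)
        (trans (cong (_% n) (+-comm n i)) (trans ([m+n]%n≡m%n i n) (sym (toℕ-fromℕ< _)))))

      from-periodic : ∀ i j → from (n + i) j ≡ from i j
      from-periodic i zero          = cong (proj₁ ∘ pt) (mod-periodic i)
      from-periodic i (suc zero)    = cong (proj₁ ∘ ln) (mod-periodic i)
      from-periodic i (suc (suc j)) = trans (cong (λ l → from l j) (sym (+-suc n i)))
                                            (from-periodic (suc i) j)

      position : ∀ u → _LiesIn_ Γ (φ u) G → ∃[ j ] j < n + n × from 0 j ≡ u
      position u lies with φ u in eq
      position u (i , refl) | inj₁ x = toℕ i + toℕ i ,
        <-trans (+-monoˡ-< (toℕ i) (toℕ<n i)) (+-monoʳ-< n (toℕ<n i)) , φ-injective (begin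
          φ (from 0 (toℕ i + toℕ i))         ≡⟨ cong (λ j → φ (from 0 j)) (sym (+-identityʳ (toℕ i + toℕ i))) ⟩
          φ (from 0 (toℕ i + toℕ i + 0))     ≡⟨ cong φ (from-+ (toℕ i) 0 0) ⟩
          φ (from (toℕ i + 0) 0)             ≡⟨ proj₂ (pt _) ⟩
          inj₁ (point ((toℕ i + 0) mod n))   ≡⟨ cong (λ j → inj₁ (point (j mod n))) (+-identityʳ (toℕ i)) ⟩
          inj₁ (point (toℕ i mod n))         ≡⟨ cong (inj₁ ∘ point) (mod-toℕ i) ⟩
          inj₁ (point i)                     ≡⟨ sym eq ⟩
          φ u                                ∎)
        where open ≡-Reasoning
      position u (i , refl) | inj₂ M = toℕ i + toℕ i + 1 ,
        subst (_< n + n) (+-comm 1 (toℕ i + toℕ i))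
          (subst (_≤ n + n) (cong suc (+-suc (toℕ i) (toℕ i))) (+-mono-≤ (toℕ<n i) (toℕ<n i))) ,
        φ-injective (begin
          φ (from 0 (toℕ i + toℕ i + 1))     ≡⟨ cong φ (from-+ (toℕ i) 0 1) ⟩
          φ (from (toℕ i + 0) 1)             ≡⟨ proj₂ (ln _) ⟩
          inj₂ (line ((toℕ i + 0) mod n))    ≡⟨ cong (λ j → inj₂ (line (j mod n))) (+-identityʳ (toℕ i)) ⟩
          inj₂ (line (toℕ i mod n))          ≡⟨ cong (inj₂ ∘ line) (mod-toℕ i) ⟩
          inj₂ (line i)                      ≡⟨ sym eq ⟩
          φ u                                ∎)
        where open ≡-Reasoning

      between : ∀ u w → _LiesIn_ Γ (φ u) G → _LiesIn_ Γ (φ w) G → ∃[ k ] k ≤ n × Walks.Walk E u k w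
      between u w u∈G w∈G with position u u∈G | position w w∈G
      ... | i , i< , refl | j , j< , refl = arc {E = E} adjacent-sym (from 0) (from-edge 0)
              (λ k → trans (from-+ n 0 k) (from-periodic 0 k)) i j i< j<

  polygon : Polygon E n
  polygon = record
    { _≟_       = _≟_
    ; symmetric = adjacent-sym
    ; colour    = isPoint ∘ φ
    ; alternate = adjacent-alternate
    ; diameter  = λ x y → case common x y of λ where
        (G , pt , ln , x∈G , y∈G) → Circuit.between G pt ln x y x∈G y∈G
    ; girth     = λ a w → geometry-girth Γ no-gons a (φ-NB w)
    }

-- Exhaustion by finite polygons

lower-em : ExcludedMiddle (lsuc ℓ) → ExcludedMiddle ℓ
lower-em {ℓ} em {P} = map′ Level.lower Level.lift (em {Lift (lsuc ℓ) P})

bounded : ∀ {N} (h : Fin N → ℕ) → ∃[ J ] (∀ i → h i ≤ J)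
bounded {zero}  h = 0 , λ ()
bounded {suc N} h with bounded (h ∘ fsuc)
... | J , h≤J = h fzero ⊔ⁿ J , λ where
  fzero    → m≤m⊔n (h fzero) J
  (fsuc i) → ≤-trans (h≤J i) (m≤n⊔m (h fzero) J)

three-nbrs : {Γ : Geometry ℓ} → Thick Γ → ∀ x →
             ∃[ h ] Injective {A = Fin 3} {B = Geometry.Element Γ} _≡_ _≡_ h ×
                    (∀ i → Incidence.Adjacent Γ x (h i))
three-nbrs thick (inj₁ x) =
  let h , h-injective , inc = proj₁ thick x
  in inj₂ ∘ h , h-injective ∘ inj₂-injective , Incidence.pl ∘ inc
three-nbrs thick (inj₂ M) =
  let h , h-injective , inc = proj₂ thick M
  in inj₁ ∘ h , h-injective ∘ inj₁-injective , Incidence.lp ∘ inc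

no-small-gons : ∀ {Γ : Geometry ℓ} {n} → IsWeakPolygon Γ n → NoSmallGons Γ n
no-small-gons weak m 2≤m m<n G =
  IsWeakSubpolygon.no-smaller weak m 2≤m m<n G ((λ _ → _) , (λ _ → _))

module _ (em : ExcludedMiddle ℓ) {Γ : Geometry ℓ} {q : ℕ} (weak : IsWeakPolygon Γ (3 + q)) where
  open Geometry Γ
  open Incidence Γ

  incidence-polygon : Polygon Adjacent (3 + q)
  incidence-polygon = Embedded.polygon Γ (no-small-gons weak) id id (λ _ _ → em)
    λ x y → let G , _ , x∈G , y∈G = IsWeakSubpolygon.common-gon weak x y (in-full x) (in-full y)
            in G , (λ _ → _ , refl) , (λ _ → _ , refl) , x∈G , y∈G
    where
    in-full : ∀ x → HasElement Γ (full Γ) x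
    in-full (inj₁ _) = _
    in-full (inj₂ _) = _

module _ (Em : ExcludedMiddle (lsuc ℓ)) {Γ : Geometry ℓ} {q : ℕ} (weak : IsWeakPolygon Γ (3 + q))
  (thick : Thick Γ) (chained : LocallyFinitelyChained Γ (3 + q)) where
  open Geometry Γ
  open Incidence Γ

  private
    n : ℕ
    n = 3 + q

    open LocallyFinitelyChained chained

    em : ExcludedMiddle ℓ
    em = lower-em Em

    stage-step : ∀ i {x} → HasElement Γ (⟨_⟩ Γ (S i) n) x → HasElement Γ (⟨_⟩ Γ (S (suc i)) n) x
    stage-step i {inj₁ x} x∈ Σ sub S⊆ = x∈ Σ sub (S⊆ ∘ ascending i)
    stage-step i {inj₂ M} M∈ Σ sub S⊆ = M∈ Σ sub (S⊆ ∘ ascending i)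

    stage-mono : ∀ k i {x} → HasElement Γ (⟨_⟩ Γ (S i) n) x → HasElement Γ (⟨_⟩ Γ (S (k + i)) n) x
    stage-mono zero    i x∈ = x∈
    stage-mono (suc k) i {x} x∈ = stage-step (k + i) {x} (stage-mono k i {x} x∈)

    stage-≤ : ∀ {i j x} → i ≤ j → HasElement Γ (⟨_⟩ Γ (S i) n) x → HasElement Γ (⟨_⟩ Γ (S j) n) x
    stage-≤ {i} {j} {x} i≤j x∈ =
      subst (λ k → HasElement Γ (⟨_⟩ Γ (S k) n) x) (m∸n+n≡m i≤j) (stage-mono (j ∸ i) i {x} x∈)

    module Stage (j : ℕ) where
      fp = proj₁ (proj₂ (proj₁ (finite j)))
      fl = proj₁ (proj₂ (proj₂ (finite j)))
      fp-injective = proj₁ (proj₂ (proj₂ (proj₁ (finite j))))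
      fl-injective = proj₁ (proj₂ (proj₂ (proj₂ (finite j))))
      fp⇔ = proj₂ (proj₂ (proj₂ (proj₁ (finite j))))
      fl⇔ = proj₂ (proj₂ (proj₂ (proj₂ (finite j))))

      -- Using the enumerations in place of the subsets gives decidable equality and a list of all
      -- vertices, and avoids the larger universe of the membership predicates.
      V : Set
      V = Fin (proj₁ (proj₁ (finite j))) ⊎ Fin (proj₁ (proj₂ (finite j)))

      φ : V → Element
      φ = map fp fl

      φ-injective : ∀ {x y} → φ x ≡ φ y → x ≡ y
      φ-injective {inj₁ _} {inj₁ _} eq = cong inj₁ (fp-injective (inj₁-injective eq))
      φ-injective {inj₂ _} {inj₂ _} eq = cong inj₂ (fl-injective (inj₂-injective eq))

      φ-surjective : ∀ x → HasElement Γ (⟨_⟩ Γ (S j) n) x → ∃[ u ] φ u ≡ x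
      φ-surjective (inj₁ x) x∈ with Equivalence.to (fp⇔ x) x∈
      ... | i , eq = inj₁ i , cong inj₁ eq
      φ-surjective (inj₂ M) M∈ with Equivalence.to (fl⇔ M) M∈
      ... | i , eq = inj₂ i , cong inj₂ eq

      φ-member : ∀ u → HasElement Γ (⟨_⟩ Γ (S j) n) (φ u)
      φ-member (inj₁ i) = Equivalence.from (fp⇔ (fp i)) (i , refl)
      φ-member (inj₂ i) = Equivalence.from (fl⇔ (fl i)) (i , refl)

      _≟ⱽ_ : (x y : V) → Dec (x ≡ y)
      _≟ⱽ_ = ≡-dec Fin._≟_ Fin._≟_

      vs : List V
      vs = mapᴸ inj₁ (allFin _) ++ mapᴸ inj₂ (allFin _)

      vs-unique : Unique vs
      vs-unique = ++⁺ (map⁺ inj₁-injective (allFin⁺ _)) (map⁺ inj₂-injective (allFin⁺ _))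
        λ { (x∈ , y∈) → case ∈-map⁻ inj₁ x∈ of λ { (_ , _ , refl) → case ∈-map⁻ inj₂ y∈ of λ () } }

      ∈vs : ∀ u → u ∈ vs
      ∈vs (inj₁ i) = ∈-++⁺ˡ (∈-map⁺ inj₁ (∈-allFin i))
      ∈vs (inj₂ i) = ∈-++⁺ʳ (mapᴸ inj₁ (allFin _)) (∈-map⁺ inj₂ (∈-allFin i))

      stage-polygon : Polygon (Adjacent on φ) n
      stage-polygon = Embedded.polygon Γ (no-small-gons weak) φ φ-injective _≟ⱽ_ λ x y →
        let G , (pt∈ , ln∈) , x∈G , y∈G =
              IsWeakSubpolygon.common-gon (polygon j) (φ x) (φ y) (φ-member x) (φ-member y)
        in G , (λ i → φ-surjective _ (pt∈ i)) , (λ i → φ-surjective _ (ln∈ i)) , x∈G , y∈G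

  -- If every colour were taken twice, finitely many elements would witness this, together with
  -- three neighbours for one element of each colour. Some stage contains them all and contradicts
  -- `no-finite-labelling`.
  single-class : ∀ {N} (C : Cycle (Fin N) n) (f : Element → Fin N) →
    (∀ {x y} → Adjacent x y → f y ≡ Cycle.above C (f x) ⊎ f x ≡ Cycle.above C (f y)) →
    (∀ i → ∃[ x ] f x ≡ i) → Fin N → ∃[ z ] (∀ x → f x ≡ f z → x ≡ z)
  single-class {N} C f edge onto i₀ = decidable-stable em λ no-single →
    let J , stage≤J = bounded (stage no-single) in contradiction no-single J stage≤J
    where
    NoSingle : Set ℓ
    NoSingle = ¬ (∃[ z ] (∀ x → f x ≡ f z → x ≡ z))

    x₁ : Fin N → Element
    x₁ i = proj₁ (onto i)

    another : NoSingle → ∀ i → ∃[ y ] f y ≡ i × x₁ i ≢ y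
    another no-single i = decidable-stable em λ no-other → no-single (x₁ i , λ y fy →
      decidable-stable em λ y≢x → no-other (y , trans fy (proj₂ (onto i)) , y≢x ∘ sym))

    stage : NoSingle → Fin N → ℕ
    stage no-single i = proj₁ (exhausts (x₁ i)) ⊔ⁿ (proj₁ (exhausts (proj₁ (another no-single i)))
      ⊔ⁿ proj₁ (bounded λ k → proj₁ (exhausts (proj₁ (three-nbrs thick (x₁ i)) k))))

    contradiction : ∀ no-single J → (∀ i → stage no-single i ≤ J) → ⊥
    contradiction no-single J stage≤J = no-finite-labelling stage-polygon C (f ∘ φ) edge
      (λ _ _ → em) vs vs-unique ∈vs pair three i₀
      where
      open Stage J
      member : ∀ x → proj₁ (exhausts x) ≤ J → ∃[ u ] φ u ≡ x
      member x le = φ-surjective x (stage-≤ {x = x} le (proj₂ (exhausts x)))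
      first≤ : ∀ i → proj₁ (exhausts (x₁ i)) ≤ J
      first≤ i = ≤-trans (m≤m⊔n _ _) (stage≤J i)
      second≤ : ∀ i → proj₁ (exhausts (proj₁ (another no-single i))) ≤ J
      second≤ i = ≤-trans (m≤m⊔n _ _) (≤-trans (m≤n⊔m (proj₁ (exhausts (x₁ i))) _) (stage≤J i))
      nbrs≤ : ∀ i k → proj₁ (exhausts (proj₁ (three-nbrs thick (x₁ i)) k)) ≤ J
      nbrs≤ i k = ≤-trans (proj₂ (bounded λ k → proj₁ (exhausts (proj₁ (three-nbrs thick (x₁ i)) k))) k)
        (≤-trans (m≤n⊔m (proj₁ (exhausts (proj₁ (another no-single i)))) _)
          (≤-trans (m≤n⊔m (proj₁ (exhausts (x₁ i))) _) (stage≤J i)))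
      pair : ∀ i → ∃[ x ] ∃[ y ] f (φ x) ≡ i × f (φ y) ≡ i × x ≢ y
      pair i with member (x₁ i) (first≤ i) | member _ (second≤ i)
      ... | x , φx | y , φy = x , y , trans (cong f φx) (proj₂ (onto i)) ,
        trans (cong f φy) (proj₁ (proj₂ (another no-single i))) ,
        λ x≡y → proj₂ (proj₂ (another no-single i)) (trans (sym φx) (trans (cong φ x≡y) φy))
      three : ∀ i → ∃[ x ] ∃[ ys ] f (φ x) ≡ i × length ys ≡ 3 × Unique ys ×
              (∀ {y} → y ∈ ys → Adjacent (φ x) (φ y))
      three i with member (x₁ i) (first≤ i)
      ... | x , φx = x , tabulate ys , trans (cong f φx) (proj₂ (onto i)) , length-tabulate ys ,
        tabulate⁺ {f = ys} (λ {k} {k′} eq → proj₁ (proj₂ (three-nbrs thick (x₁ i)))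
          (trans (sym (φ-ys k)) (trans (cong φ eq) (φ-ys k′)))) ,
        λ y∈ → case ∈-tabulate⁻ {f = ys} y∈ of λ where
          (k , refl) → subst₂ Adjacent (sym φx) (sym (φ-ys k)) (proj₂ (proj₂ (three-nbrs thick (x₁ i))) k)
        where
        ys : Fin 3 → V
        ys k = proj₁ (member _ (nbrs≤ i k))
        φ-ys : ∀ k → φ (ys k) ≡ proj₁ (three-nbrs thick (x₁ i)) k
        φ-ys k = proj₂ (member _ (nbrs≤ i k))

-- Lifting and folding

module _ (r : ℕ) where
  private
    N : ℕ
    N = suc r + suc r

    iter-mod : ∀ k i → iter next k (i mod N) ≡ (k + i) mod N
    iter-mod zero    i = refl
    iter-mod (suc k) i = trans (cong (iter next k) (next-mod i))
      (trans (iter-mod k (suc i)) (cong (_mod N) (+-suc k i)))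

    toℕ-iter : ∀ k (i : Fin N) → toℕ (iter next k i) ≡ (k + toℕ i) % N
    toℕ-iter k i = trans (cong (toℕ ∘ iter next k) (sym (mod-toℕ i)))
      (trans (cong toℕ (iter-mod k (toℕ i))) (Fin.toℕ-fromℕ< _))

    toℕ-% : (i : Fin N) → toℕ i % N ≡ toℕ i
    toℕ-% i = m<n⇒m%n≡m (Fin.toℕ<n i)

    period : ∀ (i : Fin N) → iter next N i ≡ i
    period i = Fin.toℕ-injective (trans (toℕ-iter N i)
      (trans (cong (_% N) (+-comm N (toℕ i))) (trans ([m+n]%n≡m%n (toℕ i) N) (toℕ-% i))))

  cycle : Cycle (Fin N) (suc r)
  cycle = record
    { _≟_       = Fin._≟_
    ; above     = next
    ; below      = iter next (r + suc r)
    ; below-above = period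
    ; above-below = λ i → trans (sym (iter-comm next (r + suc r) i)) (period i)
    ; period    = period
    ; free      = free
    }
    where
    free : ∀ k (i : Fin N) → 0 < k → k < N → iter next k i ≢ i
    free k i 0<k k<N eq with <-≤-connex (k + toℕ i) N
    ... | inj₁ k+i<N = <⇒≢ (m<n+m (toℕ i) 0<k)
            (sym (trans (sym (m<n⇒m%n≡m k+i<N)) (trans (sym (toℕ-iter k i)) (cong toℕ eq))))
    ... | inj₂ N≤k+i = <⇒≢ k<N (+-cancelʳ-≡ (toℕ i) k N (begin
        k + toℕ i            ≡⟨ sym (m∸n+n≡m N≤k+i) ⟩
        k + toℕ i ∸ N + N    ≡⟨ cong (_+ N) wrapped ⟩
        toℕ i + N            ≡⟨ +-comm (toℕ i) N ⟩
        N + toℕ i            ∎))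
      where
      open ≡-Reasoning
      small : k + toℕ i ∸ N < N
      small = +-cancelʳ-< N _ _ (subst (_< N + N) (sym (m∸n+n≡m N≤k+i)) (+-mono-< k<N (Fin.toℕ<n i)))
      wrapped : k + toℕ i ∸ N ≡ toℕ i
      wrapped = begin
        k + toℕ i ∸ N            ≡⟨ sym (m<n⇒m%n≡m small) ⟩
        (k + toℕ i ∸ N) % N      ≡⟨ sym ([m+n]%n≡m%n (k + toℕ i ∸ N) N) ⟩
        (k + toℕ i ∸ N + N) % N  ≡⟨ cong (_% N) (m∸n+n≡m N≤k+i) ⟩
        (k + toℕ i) % N          ≡⟨ sym (toℕ-iter k i) ⟩
        toℕ (iter next k i)     ≡⟨ cong toℕ eq ⟩
        toℕ i                    ∎

  cycle-reach : ∀ (i : Fin N) → ∃[ k ] k < N × i ≡ iter next k (0 mod N)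
  cycle-reach i = toℕ i , Fin.toℕ<n i , (begin
    i                          ≡⟨ sym (mod-toℕ i) ⟩
    toℕ i mod N                ≡⟨ cong (_mod N) (sym (+-identityʳ (toℕ i))) ⟩
    (toℕ i + 0) mod N          ≡⟨ sym (iter-mod (toℕ i) 0) ⟩
    iter next (toℕ i) (0 mod N) ∎)
    where open ≡-Reasoning

module Covering {V : Set v} {W : Set w} {E : V → V → Set e} {F : W → W → Set f} {r : ℕ}
  (𝒫 : Polygon E (2 + r)) (𝒬 : Polygon F (2 + r))
  (no-dead-end : ∀ (x p : W) → ∃[ y ] F x y × y ≢ p)
  (g : V → W) (g-adjacent : ∀ {x y} → E x y → F (g x) (g y))
  (g-surjective : ∀ u → ∃[ x ] g x ≡ u) where

  private
    module 𝒫 = PolygonProperties 𝒫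
    module 𝒬 = PolygonProperties 𝒬

    n : ℕ
    n = 2 + r

    g-walk : ∀ {x k y} → 𝒫.Walk x k y → 𝒬.Walk (g x) k (g y)
    g-walk Walks.nil     = 𝒬.nil
    g-walk (a Walks.∷ w) = g-adjacent a 𝒬.∷ g-walk w

    first : ∀ {x h k u} → F (g x) u → 𝒬.NB (g x) u r (g h) → 𝒫.Path x k h → k ≤ n →
            ∃[ y ] E x y × g y ≡ u
    first a w Walks.here k≤n = ⊥-elim (𝒬.girth a w (s≤s (s≤s (m≤m+n r n))))
    first a w p@(Walks.go {y} b w′) k≤n with m≤n⇒m<n∨m≡n k≤n
    ... | inj₂ refl = ⊥-elim (𝒬.parity (a 𝒬.∷ 𝒬.toWalk w) (g-walk (𝒫.pathWalk p)))
    ... | inj₁ (s≤s (s≤s k≤r)) = y , b , 𝒬.first-step a w (g-adjacent b) (g-walk (𝒫.toWalk w′)) k≤r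
            (s≤s (s≤s (+-mono-≤ k≤r (n≤1+n (suc r)))))

  -- Continue the edge from `g x` to `u` to a walk of `n - 1` steps and take an element `h` over its
  -- end. By parity a path from `x` to `h` has at most `n - 1` steps, and then `first-step` forces
  -- its image to begin with `u`.
  lift : ∀ {x u} → F (g x) u → ∃[ y ] E x y × g y ≡ u
  lift {x} {u} a =
    let z , w        = 𝒬.extend no-dead-end r (g x) u
        h , gh≡z     = g-surjective z
        k , k≤n , p  = 𝒫.connect x h
    in first a (subst (𝒬.NB (g x) u r) (sym gh≡z) w) p k≤n

  lift-NB : ∀ {x y k u} → E x y → 𝒬.NB (g x) (g y) k u → ∃[ z ] 𝒫.NB x y k z × g z ≡ u
  lift-NB a Walks.stop = _ , 𝒫.stop , refl
  lift-NB {x} {y} a (Walks.step b d≢gx w) with lift {y} b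
  ... | z , c , refl with lift-NB c w
  ...   | t , w′ , eq = t , 𝒫.step c (d≢gx ∘ cong g) w′ , eq

-- Signed distance to a vertex p₀ with exactly two neighbours.
module Fold {W : Set w} {F : W → W → Set f} {n : ℕ} (𝒬 : Polygon F n)
  (no-dead-end : ∀ (x p : W) → ∃[ y ] F x y × y ≢ p)
  {κ} {K : Set κ} (C : Cycle K n) (i₀ : K)
  (reach : ∀ i → ∃[ k ] k < n + n × i ≡ Cycle._↑_ C i₀ k)
  {p₀ m₀ m₁ : W} (a₀ : F p₀ m₀) (a₁ : F p₀ m₁) (m₀≢m₁ : m₀ ≢ m₁)
  (only : ∀ {m} → F p₀ m → m ≡ m₀ ⊎ m ≡ m₁) (1≤n : 1 ≤ n) where

  open PolygonProperties 𝒬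
  open Cycle C using (above; below; _↑_; below-above; above-below; antipode-below; period)

  -- A relation, since an element opposite `p₀` is reached from both sides; its labels `n` and `-n`
  -- coincide in a cycle of length `2n`.
  data Label : W → K → Set (w ⊔ f ⊔ κ) where
    centre : Label p₀ i₀
    plus   : ∀ {k y} → NB p₀ m₀ k y → suc k ≤ n → Label y (i₀ ↑ suc k)
    minus  : ∀ {k y} → NB p₀ m₁ k y → suc k ≤ n → Label y (iter below (suc k) i₀)

  private
    <2n : ∀ {k} → k ≤ n → k < n + n
    <2n k≤n = +-mono-≤ 1≤n k≤n

    sides : ∀ {k l y} → NB p₀ m₀ k y → suc k ≤ n → NB p₀ m₁ l y → suc l ≤ n →
            i₀ ↑ suc k ≡ iter below (suc l) i₀
    sides {k} {l} w k< w′ l< with m≤n⇒m<n∨m≡n k<  | m≤n⇒m<n∨m≡n l<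
    ... | inj₂ refl | inj₂ refl = sym (antipode-below i₀)
    ... | inj₁ k<n  | _         = ⊥-elim (separate a₀ a₁ m₀≢m₁ w w′ (+-mono-<-≤ k<n l<))
    ... | inj₂ _    | inj₁ l<n  = ⊥-elim (separate a₀ a₁ m₀≢m₁ w w′ (+-mono-≤-< k< l<n))

    same-length : ∀ {m k l y} → NB p₀ m k y → suc k ≤ n → NB p₀ m l y → suc l ≤ n → k ≡ l
    same-length w k< w′ l< = NB-length-unique w w′ (+-mono-<-≤ k< (<⇒≤ l<))

  label-unique : ∀ {y i j} → Label y i → Label y j → i ≡ j
  label-unique centre       centre         = refl
  label-unique centre       (plus w k<)    = ⊥-elim (girth a₀ w (<2n k<))
  label-unique centre       (minus w k<)   = ⊥-elim (girth a₁ w (<2n k<))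
  label-unique (plus w k<)  centre         = ⊥-elim (girth a₀ w (<2n k<))
  label-unique (minus w k<) centre         = ⊥-elim (girth a₁ w (<2n k<))
  label-unique (plus w k<)  (plus w′ l<)   = cong (λ k → i₀ ↑ suc k) (same-length w k< w′ l<)
  label-unique (minus w k<) (minus w′ l<)  = cong (λ k → iter below (suc k) i₀) (same-length w k< w′ l<)
  label-unique (plus w k<)  (minus w′ l<)  = sides w k< w′ l<
  label-unique (minus w k<) (plus w′ l<)   = sym (sides w′ l< w k<)

  path-label : ∀ {k y} → Path p₀ k y → k ≤ n → ∃[ i ] Label y i
  path-label here      k≤n = i₀ , centre
  path-label (go a w)  k≤n with only a
  ... | inj₁ refl = _ , plus w k≤n
  ... | inj₂ refl = _ , minus w k≤n

  fold-label : ∀ y → ∃[ i ] Label y i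
  fold-label y = let k , k≤n , p = connect p₀ y in path-label p k≤n

  fold : W → K
  fold y = proj₁ (fold-label y)

  fold-≡ : ∀ {y i} → Label y i → fold y ≡ i
  fold-≡ {y} l = label-unique (proj₂ (fold-label y)) l

  private
    Step : K → K → Set κ
    Step i j = j ≡ above i ⊎ i ≡ above j

    up-from : ∀ {k y z} → NB p₀ m₀ k y → suc k < n → F y z → Step (fold y) (fold z)
    up-from {k} w k<n b with NB-snoc w b
    ... | inj₁ w′ = inj₁ (trans (fold-≡ (plus w′ k<n))
            (trans (iter-comm above (suc k) i₀) (cong above (sym (fold-≡ (plus w (<⇒≤ k<n)))))))
    ... | inj₂ (inj₁ (refl , refl)) = inj₂ (trans (fold-≡ (plus w (<⇒≤ k<n))) (cong above (sym (fold-≡ centre))))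
    ... | inj₂ (inj₂ (j , refl , w′)) = inj₂ (trans (fold-≡ (plus w (<⇒≤ k<n)))
            (trans (iter-comm above (suc j) i₀)
              (cong above (sym (fold-≡ (plus w′ (<⇒≤ (<-trans (n<1+n _) k<n))))))))

    unbelow : ∀ {i j} → i ≡ below j → j ≡ above i
    unbelow eq = trans (sym (above-below _)) (cong above (sym eq))

    down-from : ∀ {k y z} → NB p₀ m₁ k y → suc k < n → F y z → Step (fold y) (fold z)
    down-from {k} w k<n b with NB-snoc w b
    ... | inj₁ w′ = inj₂ (unbelow (trans (fold-≡ (minus w′ k<n))
            (trans (iter-comm below (suc k) i₀) (cong below (sym (fold-≡ (minus w (<⇒≤ k<n))))))))
    ... | inj₂ (inj₁ (refl , refl)) =
            inj₁ (unbelow (trans (fold-≡ (minus w (<⇒≤ k<n))) (cong below (sym (fold-≡ centre)))))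
    ... | inj₂ (inj₂ (j , refl , w′)) = inj₁ (unbelow (trans (fold-≡ (minus w (<⇒≤ k<n)))
            (trans (iter-comm below (suc j) i₀)
              (cong below (sym (fold-≡ (minus w′ (<⇒≤ (<-trans (n<1+n _) k<n)))))))))

    near-step : ∀ {k y z} → Path p₀ k y → k < n → F y z → Step (fold y) (fold z)
    near-step here     k<n b with only b
    ... | inj₁ refl = inj₁ (trans (fold-≡ (plus stop 1≤n)) (cong above (sym (fold-≡ centre))))
    ... | inj₂ refl = inj₂ (unbelow (trans (fold-≡ (minus stop 1≤n)) (cong below (sym (fold-≡ centre)))))
    near-step (go a w) k<n b with only a
    ... | inj₁ refl = up-from w k<n b
    ... | inj₂ refl = down-from w k<n b

  -- By parity adjacent vertices are not both opposite `p₀`, and from a vertex nearer than that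
  -- every step changes the signed distance by one.
  fold-edge : ∀ {y z} → F y z → fold z ≡ above (fold y) ⊎ fold y ≡ above (fold z)
  fold-edge {y} {z} b with connect p₀ y | connect p₀ z
  ... | k , k≤n , p | l , l≤n , q with m≤n⇒m<n∨m≡n k≤n | m≤n⇒m<n∨m≡n l≤n
  ...   | inj₁ k<n  | _         = near-step p k<n b
  ...   | inj₂ _    | inj₁ l<n  = swap (near-step q l<n (symmetric b))
  ...   | inj₂ refl | inj₂ refl = ⊥-elim (parity (pathWalk q) (pathWalk p ∷ʳ b))

  fold-onto : ∀ i → ∃[ y ] fold y ≡ i
  fold-onto i with reach i
  ... | zero  , k<2n , refl = p₀ , fold-≡ centre
  ... | suc k , k<2n , refl with ≤-<-connex (suc k) n
  ...   | inj₁ k<n = let y , w = extend no-dead-end k p₀ m₀ in y , fold-≡ (plus w k<n)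
  ...   | inj₂ n<k = behind (m<n⇒0<n∸m k<2n) (m∸n≤n′) (m∸n+n≡m (<⇒≤ k<2n))
    where
    m∸n≤n′ : n + n ∸ suc k ≤ n
    m∸n≤n′ = ≤-trans (∸-monoʳ-≤ (n + n) (<⇒≤ n<k)) (≤-reflexive (m+n∸n≡m n n))
    behind : ∀ {d} → 0 < d → d ≤ n → d + suc k ≡ n + n → ∃[ y ] fold y ≡ i₀ ↑ suc k
    behind {suc d} _ d<n d+k≡2n =
      let y , w = extend no-dead-end d p₀ m₁ in y , trans (fold-≡ (minus w d<n)) (begin
        iter below (suc d) i₀                          ≡⟨ cong (iter below (suc d)) (sym (period i₀)) ⟩
        iter below (suc d) (i₀ ↑ (n + n))              ≡⟨ cong (λ j → iter below (suc d) (i₀ ↑ j))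
                                                           (trans (sym d+k≡2n) (+-comm (suc d) (suc k))) ⟩
        iter below (suc d) (i₀ ↑ (suc k + suc d))      ≡⟨ cong (iter below (suc d)) (iter-+ above (suc k) (suc d) i₀) ⟩
        iter below (suc d) (i₀ ↑ suc k ↑ suc d)        ≡⟨ iter-inverse above below below-above (suc d) (i₀ ↑ suc k) ⟩
        i₀ ↑ suc k                                    ∎)
      where open ≡-Reasoning

  -- If `u` were at distance at least two, the path to it could branch off after its first step;
  -- continued to the same length it ends at another vertex with the same label.
  own-label : (∀ {m} q → F p₀ m → ∃[ q′ ] F m q′ × q′ ≢ p₀ × q′ ≢ q) →
              ∀ u → (∀ y → fold y ≡ fold u → y ≡ u) → u ≡ p₀ ⊎ F p₀ u
  own-label branch u own with connect p₀ u
  ... | _ , _ , here      = inj₁ refl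
  ... | _ , _ , go a stop = inj₂ a
  ... | _ , k< , go {m} a (step {d = d} {k = k} b d≢p₀ w) = ⊥-elim (clash (branch d a))
    where
    same-label : ∀ {y l} → NB p₀ m l u → suc l ≤ n → NB p₀ m l y → fold y ≡ fold u
    same-label w l< w′ with only a
    ... | inj₁ refl = trans (fold-≡ (plus w′ l<)) (sym (fold-≡ (plus w l<)))
    ... | inj₂ refl = trans (fold-≡ (minus w′ l<)) (sym (fold-≡ (minus w l<)))
    clash : ∃[ q ] F m q × q ≢ p₀ × q ≢ d → ⊥
    clash (q , c , q≢p₀ , q≢d) =
      let y , w′ = extend no-dead-end k m q
      in separate c b q≢d w′ (subst (NB m d k) (sym (own y (same-label (step b d≢p₀ w) k< (step c q≢p₀ w′)))) w)
           (+-mono-<-≤ k< (<⇒≤ k<))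

-- Type (a)

rotate : {Γ : Geometry ℓ} → ∀ {m} → ℕ → OrdinaryGon Γ m → OrdinaryGon Γ m
rotate {Γ = Γ} k G = record
  { point           = point ∘ iter next k
  ; line            = line ∘ iter next k
  ; point-injective = shift-injective k ∘ point-injective
  ; line-injective  = shift-injective k ∘ line-injective
  ; point-I-line    = point-I-line ∘ iter next k
  ; next-I-line     = λ i → subst (λ j → point j I line (iter next k i)) (sym (iter-comm next k i))
                              (next-I-line (iter next k i))
  }
  where
  open OrdinaryGon G
  open Geometry Γ
  shift-injective : ∀ {m} k {i j : Fin m} → iter next k i ≡ iter next k j → i ≡ j
  shift-injective ℕ.zero    eq = eq
  shift-injective (ℕ.suc k) eq = next-injective (shift-injective k eq)

-- Duality exchanges the lifting assumptions and the bounds on neighbours. Applied to `dualEpi γ`,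
-- the module therefore handles a single point, which gives type (b).
module SingleLine {Γ Δ : Geometry ℓ} (γ : Epimorphism Γ Δ) where
  private
    module Δ = Geometry Δ
  open Geometry Γ
  open Epimorphism γ

  module _
    (lift-line  : ∀ {x N} → onPoints x Δ.I N → ∃[ M ] x I M × onLines M ≡ N)
    (lift-point : ∀ {M y} → y Δ.I onLines M → ∃[ x ] x I M × onPoints x ≡ y)
    (two-lines  : ∀ {y N₁ N₂ N₃} → y Δ.I N₁ → y Δ.I N₂ → N₁ ≢ N₂ → y Δ.I N₃ → N₃ ≡ N₁ ⊎ N₃ ≡ N₂)
    (two-points : ∀ {N y₁ y₂ y₃} → y₁ Δ.I N → y₂ Δ.I N → y₁ ≢ y₂ → y₃ Δ.I N → y₃ ≡ y₁ ⊎ y₃ ≡ y₂)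
    {L : Line} (single : ∀ {M} → onLines M ≡ onLines L → L ≡ M)
    where

    module Gon {m} (G : OrdinaryGon Δ m) where
      open OrdinaryGon G

      line-over : ∀ {x y N} → onPoints x ≡ y → y Δ.I N → ∃[ M ] x I M × onLines M ≡ N
      line-over refl = lift-line

      point-over : ∀ {M N y} → onLines M ≡ N → y Δ.I N → ∃[ x ] x I M × onPoints x ≡ y
      point-over refl = lift-point

      on-line : ∀ i → i ≢ next i → ∀ {x M} → onLines M ≡ line i → x I M →
                onPoints x ≡ point i ⊎ onPoints x ≡ point (next i)
      on-line i i≢ eq inc = two-points (point-I-line i) (next-I-line i) (i≢ ∘ point-injective)
        (subst (_ Δ.I_) eq (preserves-I inc))

      on-point : ∀ i → i ≢ next i → ∀ {x M} → onPoints x ≡ point (next i) → x I M →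
                 onLines M ≡ line i ⊎ onLines M ≡ line (next i)
      on-point i i≢ eq inc = two-lines (next-I-line i) (point-I-line (next i)) (i≢ ∘ line-injective)
        (subst (Δ._I _) eq (preserves-I inc))

      differ : ∀ {x i j} → i ≢ j → onPoints x ≡ point i → onPoints x ≡ point j → ⊥
      differ i≢j e e′ = i≢j (point-injective (trans (sym e) e′))

      differ-line : ∀ {M i j} → i ≢ j → onLines M ≡ line i → onLines M ≡ line j → ⊥
      differ-line i≢j e e′ = i≢j (line-injective (trans (sym e) e′))

      collinear : ∀ {x y y′ N} → onPoints x ≡ y → y Δ.I N → y′ Δ.I N →
                  CollinearWith γ (pointFibre γ y′) x
      collinear e inc inc′ =
        let M , x∈M , M↦N = line-over e inc
            z , z∈M , z↦y′ = point-over M↦N inc′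
        in z , z↦y′ , M , x∈M , z∈M

      incident : ∀ {M N y} → onLines M ≡ N → y Δ.I N → IncidentWith γ (pointFibre γ y) M
      incident e inc = let z , z∈M , z↦y = point-over e inc in z , z↦y , z∈M

      Over : Fin m → Pred Point ℓ
      Over i = pointFibre γ (point i)

      lines-after : ∀ i → i ≢ next i →
        lineFibre γ (line (next i)) ≐ ∁ (lineFibre γ (line i)) ∩ IncidentWith γ (Over (next i))
      lines-after i i≢ = (λ e → (λ e′ → differ-line i≢ e′ e) , incident e (point-I-line (next i)))
        , λ (e , z , z↦ , z∈M) → [ (λ M↦ → ⊥-elim (e M↦)) , id ]′ (on-point i i≢ z↦ z∈M)

      lines-before : ∀ i → i ≢ next i →
        lineFibre γ (line i) ≐ ∁ (lineFibre γ (line (next i))) ∩ IncidentWith γ (Over (next i))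
      lines-before i i≢ = (λ e → differ-line i≢ e , incident e (next-I-line i))
        , λ (e , z , z↦ , z∈M) → [ id , (λ M↦ → ⊥-elim (e M↦)) ]′ (on-point i i≢ z↦ z∈M)

      points-after : ∀ i → i ≢ next i → next i ≢ next (next i) → i ≢ next (next i) →
        Over (next (next i)) ≐ ∁ (Over i ∪ Over (next i)) ∩ CollinearWith γ (Over (next i))
      points-after i i≢₁ 1≢2 i≢₂ =
        (λ e → [ (λ e′ → differ i≢₂ e′ e) , (λ e′ → differ 1≢2 e′ e) ]′
             , collinear e (next-I-line (next i)) (point-I-line (next i)))
        , λ (x∉ , z , z↦ , M , x∈M , z∈M) →
            [ (λ M↦ → ⊥-elim (x∉ (on-line i i≢₁ M↦ x∈M)))
            , (λ M↦ → [ (λ x↦ → ⊥-elim (x∉ (inj₂ x↦))) , id ]′ (on-line (next i) 1≢2 M↦ x∈M))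
            ]′ (on-point i i≢₁ z↦ z∈M)

      points-before : ∀ i → i ≢ next i → next i ≢ next (next i) → i ≢ next (next i) →
        Over i ≐ ∁ (Over (next i) ∪ Over (next (next i))) ∩ CollinearWith γ (Over (next i))
      points-before i i≢₁ 1≢2 i≢₂ =
        (λ e → [ differ i≢₁ e , differ i≢₂ e ]′ , collinear e (point-I-line i) (next-I-line i))
        , λ (x∉ , z , z↦ , M , x∈M , z∈M) →
            [ (λ M↦ → [ id , (λ x↦ → ⊥-elim (x∉ (inj₁ x↦))) ]′ (on-line i i≢₁ M↦ x∈M))
            , (λ M↦ → ⊥-elim (x∉ (on-line (next i) 1≢2 M↦ x∈M)))
            ]′ (on-point i i≢₁ z↦ z∈M)

      module _ (t : Fin m) (t≢ : t ≢ next t) (L↦t : onLines L ≡ line t) where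

        L-fibre : lineFibre γ (line t) ≐ ｛ L ｝
        L-fibre = (λ e → single (trans e (sym L↦t))) , λ { refl → L↦t }

        -- A point over an end of line `t` lies, by lifting, on some line over `t`, and `L` is the
        -- only one.
        L-points : Over t ∪ Over (next t) ≐ PointsOn γ L
        L-points = [ (λ e → over e (point-I-line t)) , (λ e → over e (next-I-line t)) ]′
                 , on-line t t≢ L↦t
          where
          over : ∀ {x y} → onPoints x ≡ y → y Δ.I line t → x I L
          over e inc = let M , x∈M , M↦ = line-over e inc
                       in subst (_ I_) (sym (single (trans M↦ (sym L↦t)))) x∈M

    ∁-cong : ∀ {a p q r s} {X : Set a} {P : Pred X p} {Q : Pred X q} {R : Pred X r} {S : Pred X s} →
             P ≐ ∁ Q ∩ R → Q ≐ S → P ≐ ∁ S ∩ R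
    ∁-cong (⊆ , ⊇) (Q⊆S , S⊆Q) =
      (λ p → let ¬q , r = ⊆ p in ¬q ∘ S⊆Q , r) , λ (¬s , r) → ⊇ (¬s ∘ Q⊆S , r)

    ∪-swap : ∀ {a p q s} {X : Set a} {P : Pred X p} {Q : Pred X q} {S : Pred X s} → P ∪ Q ≐ S → Q ∪ P ≐ S
    ∪-swap (⊆ , ⊇) = ⊆ ∘ swap , swap ∘ ⊇

    quadrangle-type : (G : OrdinaryGon Δ 4) → onLines L ≡ OrdinaryGon.line G 0F →
                      (∀ y → ∃[ i ] OrdinaryGon.point G i ≡ y) → TypeA₄ γ
    quadrangle-type G L↦ all = record
      { a = point 0F ; b = point 1F ; c = point 2F ; d = point 3F
      ; distinct = tabulate⁺ {f = point} point-injective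
      ; all-points = λ y → subst (_∈ tabulate point) (proj₂ (all y)) (∈-tabulate⁺ {f = point} (proj₁ (all y)))
      ; ab = line 0F ; bc = line 1F ; cd = line 2F ; ad = line 3F
      ; ab-joins = point-I-line 0F , next-I-line 0F
      ; bc-joins = point-I-line 1F , next-I-line 1F
      ; cd-joins = point-I-line 2F , next-I-line 2F
      ; ad-joins = next-I-line 3F , point-I-line 3F
      ; L = L
      ; A,B-on-L = record
        { covers    = L-points 0F (λ ()) L↦
        ; disjoint  = λ (e , e′) → differ {i = 0F} {1F} (λ ()) e e′
        ; nonempty₁ = points-surjective _
        ; nonempty₂ = points-surjective _
        }
      ; C-points = ∁-cong (points-after 0F (λ ()) (λ ()) (λ ())) (L-points 0F (λ ()) L↦)
      ; D-points = ∁-cong (points-before 3F (λ ()) (λ ()) (λ ())) (L-points 0F (λ ()) L↦)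
      ; ab-lines = L-fibre 0F (λ ()) L↦
      ; bc-lines = ∁-cong (lines-after 0F (λ ())) (L-fibre 0F (λ ()) L↦)
      ; ad-lines = ∁-cong (lines-before 3F (λ ())) (L-fibre 0F (λ ()) L↦)
      ; cd-lines = (λ e → incident e (point-I-line 2F) , incident e (next-I-line 2F))
                 , λ ((z , z↦c , z∈M) , (w , w↦d , w∈M)) →
                     cd (on-point 1F (λ ()) z↦c z∈M) (on-point 2F (λ ()) w↦d w∈M)
      }
      where
      open OrdinaryGon G
      open Gon G
      cd : ∀ {M} → onLines M ≡ line 1F ⊎ onLines M ≡ line 2F → onLines M ≡ line 2F ⊎ onLines M ≡ line 3F →
           onLines M ≡ line 2F
      cd (inj₂ M↦cd) _           = M↦cd
      cd (inj₁ _)    (inj₁ M↦cd) = M↦cd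
      cd (inj₁ M↦bc) (inj₂ M↦ad) = ⊥-elim (differ-line {i = 1F} {3F} (λ ()) M↦bc M↦ad)

    hexagon-type : (G : OrdinaryGon Δ 6) → onLines L ≡ OrdinaryGon.line G 1F →
                   (∀ y → ∃[ i ] OrdinaryGon.point G i ≡ y) → TypeA₆ γ
    hexagon-type G L↦ all = record
      { a = point 0F ; b = point 1F ; c = point 2F ; d = point 3F ; e = point 4F ; f = point 5F
      ; distinct = tabulate⁺ {f = point} point-injective
      ; all-points = λ y → subst (_∈ tabulate point) (proj₂ (all y)) (∈-tabulate⁺ {f = point} (proj₁ (all y)))
      ; ab = line 0F ; bc = line 1F ; cd = line 2F ; de = line 3F ; fe = line 4F ; fa = line 5F
      ; ab-joins = point-I-line 0F , next-I-line 0F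
      ; bc-joins = point-I-line 1F , next-I-line 1F
      ; cd-joins = point-I-line 2F , next-I-line 2F
      ; de-joins = point-I-line 3F , next-I-line 3F
      ; fe-joins = next-I-line 4F , point-I-line 4F
      ; fa-joins = point-I-line 5F , next-I-line 5F
      ; L = L
      ; C,B-on-L = record
        { covers    = ∪-swap (L-points 1F (λ ()) L↦)
        ; disjoint  = λ (e , e′) → differ {i = 2F} {1F} (λ ()) e e′
        ; nonempty₁ = points-surjective _
        ; nonempty₂ = points-surjective _
        }
      ; D-points  = ∁-cong (points-after 1F (λ ()) (λ ()) (λ ())) (L-points 1F (λ ()) L↦)
      ; A-points  = ∁-cong (points-before 0F (λ ()) (λ ()) (λ ())) (L-points 1F (λ ()) L↦)
      ; E-points  = points-after 2F (λ ()) (λ ()) (λ ())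
      ; F-points  = points-before 5F (λ ()) (λ ()) (λ ())
      ; bc-lines  = L-fibre 1F (λ ()) L↦
      ; cd-lines  = ∁-cong (lines-after 1F (λ ())) (L-fibre 1F (λ ()) L↦)
      ; ab-lines  = ∁-cong (lines-before 0F (λ ())) (L-fibre 1F (λ ()) L↦)
      ; de-lines  = lines-after 2F (λ ())
      ; fa-lines  = lines-before 5F (λ ())
      ; fe-lines  = lines-before 4F (λ ())
      ; fe-lines′ = lines-after 3F (λ ())
      }
      where
      open OrdinaryGon G
      open Gon G

-- Epimorphisms onto thin polygons of order (s, 1)

avoid-two : ∀ {a} {A : Set a} → ((x y : A) → Dec (x ≡ y)) → ∀ {x₁ x₂ x₃ : A} →
            x₁ ≢ x₂ → x₁ ≢ x₃ → x₂ ≢ x₃ → ∀ p q →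
            (x₁ ≢ p × x₁ ≢ q) ⊎ (x₂ ≢ p × x₂ ≢ q) ⊎ (x₃ ≢ p × x₃ ≢ q)
avoid-two _≟_ {x₁} {x₂} x₁≢x₂ x₁≢x₃ x₂≢x₃ p q with x₁ ≟ p | x₁ ≟ q | x₂ ≟ p | x₂ ≟ q
... | no ≢p    | no ≢q    | _        | _        = inj₁ (≢p , ≢q)
... | yes refl | _        | yes eq   | _        = ⊥-elim (x₁≢x₂ (sym eq))
... | yes refl | _        | no ≢p    | no ≢q    = inj₂ (inj₁ (≢p , ≢q))
... | yes refl | _        | no _     | yes refl = inj₂ (inj₂ (x₁≢x₃ ∘ sym , x₂≢x₃ ∘ sym))
... | no _     | yes refl | _        | yes eq   = ⊥-elim (x₁≢x₂ (sym eq))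
... | no _     | yes refl | no ≢p    | no ≢q    = inj₂ (inj₁ (≢p , ≢q))
... | no _     | yes refl | yes refl | no _     = inj₂ (inj₂ (x₂≢x₃ ∘ sym , x₁≢x₃ ∘ sym))

next-distinct : ∀ {r} (i : Fin (2 + r)) → i ≢ next i
next-distinct i eq with toℕ-next i
... | inj₁ e       = 1+n≢n (trans (sym e) (cong toℕ (sym eq)))
... | inj₂ (e , z) = case trans (cong suc (trans (sym z) (cong toℕ (sym eq)))) e of λ ()

next-surjective : ∀ {r} (i : Fin (suc r)) → ∃[ j ] next j ≡ i
next-surjective {r} i = (r + toℕ i) mod suc r , trans (next-mod (r + toℕ i)) (Fin.toℕ-injective (begin
  toℕ ((suc r + toℕ i) mod suc r)   ≡⟨ Fin.toℕ-fromℕ< _ ⟩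
  (suc r + toℕ i) % suc r           ≡⟨ cong (_% suc r) (+-comm (suc r) (toℕ i)) ⟩
  (toℕ i + suc r) % suc r           ≡⟨ [m+n]%n≡m%n (toℕ i) (suc r) ⟩
  toℕ i % suc r                     ≡⟨ m<n⇒m%n≡m (Fin.toℕ<n i) ⟩
  toℕ i                             ∎))
  where
  open ≡-Reasoning

module Classification (Em : ExcludedMiddle (lsuc ℓ)) {q : ℕ}
  {Γ : Geometry ℓ} (thick-Γ : IsThickPolygon Γ (3 + q)) (chained : LocallyFinitelyChained Γ (3 + q))
  {Δ : Geometry ℓ} (thin-Δ : IsThinPolygon Δ (3 + q)) {s : Set ℓ} (order : HasOrder Δ s (Fin 1))
  (γ : Epimorphism Γ Δ) where

  module Γ = Geometry Γ
  module Δ = Geometry Δ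
  module IΓ = Incidence Γ
  module IΔ = Incidence Δ
  open Epimorphism γ

  n : ℕ
  n = 3 + q

  em : ExcludedMiddle ℓ
  em = lower-em Em

  𝒫 : Polygon IΓ.Adjacent n
  𝒫 = incidence-polygon em (proj₁ thick-Γ)

  𝒬 : Polygon IΔ.Adjacent n
  𝒬 = incidence-polygon em (proj₁ thin-Δ)

  module 𝒫 = PolygonProperties 𝒫
  module 𝒬 = PolygonProperties 𝒬
  open IΔ using (pl; lp)

  g : Γ.Element → Δ.Element
  g = map onPoints onLines

  g-adjacent : ∀ {x y} → IΓ.Adjacent x y → IΔ.Adjacent (g x) (g y)
  g-adjacent (IΓ.pl i) = pl (preserves-I i)
  g-adjacent (IΓ.lp i) = lp (preserves-I i)

  g-surjective : ∀ u → ∃[ x ] g x ≡ u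
  g-surjective (inj₁ y) = let x , eq = points-surjective y in inj₁ x , cong inj₁ eq
  g-surjective (inj₂ N) = let M , eq = lines-surjective N in inj₂ M , cong inj₂ eq

  pointAt : ∀ N → Maybe s → Δ.Point
  pointAt N = proj₁ (proj₁ order N)

  pointAt-injective : ∀ N {k k′} → pointAt N k ≡ pointAt N k′ → k ≡ k′
  pointAt-injective N = proj₁ (proj₂ (proj₁ order N))

  pointAt-I : ∀ N k → pointAt N k Δ.I N
  pointAt-I N k = Equivalence.from (proj₂ (proj₂ (proj₁ order N)) _) (k , refl)

  lineAt : ∀ y → Maybe (Fin 1) → Δ.Line
  lineAt y = proj₁ (proj₂ order y)

  lineAt-injective : ∀ y {k k′} → lineAt y k ≡ lineAt y k′ → k ≡ k′
  lineAt-injective y = proj₁ (proj₂ (proj₂ order y))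

  lineAt-I : ∀ y k → y Δ.I lineAt y k
  lineAt-I y k = Equivalence.from (proj₂ (proj₂ (proj₂ order y)) _) (k , refl)

  lineAt-≢ : ∀ y → lineAt y nothing ≢ lineAt y (just 0F)
  lineAt-≢ y eq = case lineAt-injective y eq of λ ()

  lineAt-only : ∀ {y N} → y Δ.I N → N ≡ lineAt y nothing ⊎ N ≡ lineAt y (just 0F)
  lineAt-only {y} {N} inc with Equivalence.to (proj₂ (proj₂ (proj₂ order y)) N) inc
  ... | nothing , eq = inj₁ (sym eq)
  ... | just 0F , eq = inj₂ (sym eq)

  two-lines : ∀ {y N₁ N₂ N₃} → y Δ.I N₁ → y Δ.I N₂ → N₁ ≢ N₂ → y Δ.I N₃ → N₃ ≡ N₁ ⊎ N₃ ≡ N₂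
  two-lines i₁ i₂ N₁≢N₂ i₃ with lineAt-only i₁ | lineAt-only i₂ | lineAt-only i₃
  ... | inj₁ refl | inj₁ e₂   | _       = ⊥-elim (N₁≢N₂ (sym e₂))
  ... | inj₂ refl | inj₂ e₂   | _       = ⊥-elim (N₁≢N₂ (sym e₂))
  ... | inj₁ refl | inj₂ refl | e       = e
  ... | inj₂ refl | inj₁ refl | e       = swap e

  gon-at : ∀ u → ∃[ G ] _LiesIn_ Δ u G
  gon-at u = let G , _ , u∈G , _ = IsWeakSubpolygon.common-gon (proj₁ thin-Δ) u u (in-full u) (in-full u)
             in G , u∈G
    where
    in-full : ∀ x → HasElement Δ (full Δ) x
    in-full (inj₁ _) = _
    in-full (inj₂ _) = _

  two-points-on : ∀ N → ∃[ y ] ∃[ z ] y Δ.I N × z Δ.I N × y ≢ z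
  two-points-on N with gon-at (inj₂ N)
  ... | G , i , refl = point i , point (next i) , point-I-line i , next-I-line i ,
                       next-distinct i ∘ point-injective
    where open OrdinaryGon {Γ = Δ} {m = n} G

  no-dead-end : ∀ (x p : Δ.Element) → ∃[ y ] IΔ.Adjacent x y × y ≢ p
  no-dead-end (inj₁ y) p with p 𝒬.≟ inj₂ (lineAt y nothing)
  ... | no  p≢   = _ , pl (lineAt-I y nothing) , p≢ ∘ sym
  ... | yes refl = _ , pl (lineAt-I y (just 0F)) , lineAt-≢ y ∘ sym ∘ inj₂-injective
  no-dead-end (inj₂ N) p with two-points-on N
  ... | y , z , y∈ , z∈ , y≢z with p 𝒬.≟ inj₁ y
  ...   | no  p≢   = _ , lp y∈ , p≢ ∘ sym
  ...   | yes refl = _ , lp z∈ , y≢z ∘ sym ∘ inj₁-injective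

  open Covering 𝒫 𝒬 no-dead-end g g-adjacent g-surjective

  Single : Γ.Element → Set ℓ
  Single z = ∀ x → g x ≡ g z → x ≡ z

  C : Cycle (Fin (n + n)) n
  C = cycle (2 + q)

  only-lines : ∀ {y m} → IΔ.Adjacent (inj₁ y) m →
               m ≡ inj₂ (lineAt y nothing) ⊎ m ≡ inj₂ (lineAt y (just 0F))
  only-lines (pl i) = map (cong inj₂) (cong inj₂) (lineAt-only i)

  module Folding (y : Δ.Point) = Fold 𝒬 no-dead-end C (0 mod (n + n)) (cycle-reach (2 + q))
    (pl (lineAt-I y nothing)) (pl (lineAt-I y (just 0F))) (lineAt-≢ y ∘ inj₂-injective)
    only-lines (s≤s z≤n)

  -- A class of the colouring `fold ∘ g` is a union of fibres of `g`. If it has one element `z`,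
  -- both the fibre through `z` and the fold class of `g z` are singletons.
  single-near : ∀ y → ∃[ z ] Single z × (∀ u → Folding.fold y u ≡ Folding.fold y (g z) → u ≡ g z)
  single-near y =
    let z , single = single-class Em (proj₁ thick-Γ) (proj₂ thick-Γ) chained C (fold ∘ g)
                       (λ a → fold-edge (g-adjacent a)) onto (0 mod (n + n))
    in z , (λ x eq → single x (cong fold eq)) , λ u eq →
         let x , gx≡u = g-surjective u
         in trans (sym gx≡u) (cong g (single x (trans (cong fold gx≡u) eq)))
    where
    open Folding y
    onto : ∀ i → ∃[ x ] fold (g x) ≡ i
    onto i = let u , fu≡i = fold-onto i
                 x , gx≡u = g-surjective u
             in x , trans (cong fold gx≡u) fu≡i

  two-nbrs-but : ∀ x z → ∃[ k ] ∃[ l ] IΓ.Adjacent x k × IΓ.Adjacent x l × k ≢ z × l ≢ z × k ≢ l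
  two-nbrs-but x z with three-nbrs (proj₂ thick-Γ) x
  ... | h , h-injective , adj = choose (h 0F 𝒫.≟ z) (h 1F 𝒫.≟ z)
    where
    distinct : ∀ {i j} → i ≢ j → h i ≢ h j
    distinct i≢j = i≢j ∘ h-injective
    choose : Dec (h 0F ≡ z) → Dec (h 1F ≡ z) →
             ∃[ k ] ∃[ l ] IΓ.Adjacent x k × IΓ.Adjacent x l × k ≢ z × l ≢ z × k ≢ l
    choose (yes refl) _          =
      h 1F , h 2F , adj 1F , adj 2F , distinct (λ ()) , distinct (λ ()) , distinct (λ ())
    choose (no 0≢z)   (yes refl) = h 0F , h 2F , adj 0F , adj 2F , 0≢z , distinct (λ ()) , distinct (λ ())
    choose (no 0≢z)   (no 1≢z)   = h 0F , h 1F , adj 0F , adj 1F , 0≢z , 1≢z , distinct (λ ())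

  -- A point over the first point of the path from onLines L to g z′ is on two lines
  -- other than L, and each of them leads to z′.
  single-line-isolated : ∀ {L z′} → Single (inj₂ L) → Single z′ → g z′ ≢ inj₂ (onLines L) →
                         (IΔ.Adjacent (inj₂ (onLines L)) (g z′) → ⊥) → ⊥
  single-line-isolated {L} {z′} single single′ ≢L not-adj with 𝒬.connect (inj₂ (onLines L)) (g z′)
  ... | k , k≤n , p = by-path p refl k≤n
    where
    through : ∀ {y u₂ k} → y Δ.I onLines L → IΔ.Adjacent (inj₁ y) u₂ → u₂ ≢ inj₂ (onLines L) →
              𝒬.NB (inj₁ y) u₂ k (g z′) → suc (suc k) ≤ n → ⊥
    through {y} {_} {k} y∈ b@(pl y∈N) u₂≢L w k< with lift {inj₂ L} (lp y∈)
    ... | inj₁ x , a , refl with two-nbrs-but (inj₁ x) (inj₂ L)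
    ...   | m , m′ , c , c′ , m≢L , m′≢L , m≢m′ =
      let t , v , gt≡  = continue c m≢L
          t′ , v′ , gt′≡ = continue c′ m′≢L
      in 𝒫.separate c c′ m≢m′ (subst (𝒫.NB _ m k) (single′ t gt≡) v)
           (subst (𝒫.NB _ m′ k) (single′ t′ gt′≡) v′)
           (+-mono-<-≤ k< (<⇒≤ k<))
      where
      over : ∀ {m} → IΓ.Adjacent (inj₁ x) m → m ≢ inj₂ L → g m ≡ inj₂ _
      over (IΓ.pl {M = M} i) m≢L = case two-lines y∈ y∈N (u₂≢L ∘ sym ∘ cong inj₂) (preserves-I i) of λ where
        (inj₁ e) → ⊥-elim (m≢L (single (inj₂ M) (cong inj₂ e)))
        (inj₂ e) → cong inj₂ e
      continue : ∀ {m} → IΓ.Adjacent (inj₁ x) m → m ≢ inj₂ L → ∃[ t ] 𝒫.NB (inj₁ x) m k t × g t ≡ g z′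
      continue {m} c m≢L = lift-NB c (subst (λ u → 𝒬.NB (inj₁ y) u k (g z′)) (sym (over c m≢L)) w)
    by-path : ∀ {k u} → 𝒬.Path (inj₂ (onLines L)) k u → u ≡ g z′ → k ≤ n → ⊥
    by-path Walks.here eq k≤n = ≢L (sym eq)
    by-path (Walks.go a Walks.stop) eq k≤n = not-adj (subst (IΔ.Adjacent _) eq a)
    by-path (Walks.go (lp {x = y} y∈) (Walks.step {d = u₂} {k} b u₂≢L w)) eq k≤n =
      through y∈ b u₂≢L (subst (𝒬.NB (inj₁ y) u₂ k) eq w) k≤n

  line-over : ∀ {N x M} → onPoints x Δ.I N → Single (inj₁ x) → onLines M ≡ N →
              IΓ.Adjacent (inj₂ M) (inj₁ x)
  line-over {x = x} {M} x∈N single refl with lift {inj₂ M} (lp x∈N)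
  ... | z , a , z↦x = subst (IΓ.Adjacent (inj₂ M)) (single z z↦x) a

  -- Every line over `N` passes through the only points over two points of `N`; two such lines would
  -- form a digon.
  joining-line-single : ∀ {N x₀ x₁} → onPoints x₀ Δ.I N → onPoints x₁ Δ.I N →
    Single (inj₁ x₀) → Single (inj₁ x₁) → x₁ ≢ x₀ → ∀ {M} → onLines M ≡ N → Single (inj₂ M)
  joining-line-single {N} {x₀} {x₁} x₀∈N x₁∈N single₀ single₁ x₁≢x₀ {M} M↦N (inj₂ M′) M′↦M =
    decidable-stable em λ M′≢M → 𝒫.separate
      (𝒫.symmetric (line-over x₀∈N single₀ M′↦N)) (𝒫.symmetric (line-over x₀∈N single₀ M↦N)) M′≢M
      (𝒫.step (line-over x₁∈N single₁ M′↦N) (x₁≢x₀ ∘ inj₁-injective) 𝒫.stop)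
      (𝒫.step (line-over x₁∈N single₁ M↦N) (x₁≢x₀ ∘ inj₁-injective) 𝒫.stop)
      (s≤s (s≤s (s≤s (≤-trans (s≤s (s≤s z≤n)) (m≤n+m n q)))))
    where
    M′↦N : onLines M′ ≡ N
    M′↦N = trans (inj₂-injective M′↦M) M↦N

  -- Lines with at least three points: the case s > 1

  module TwoLabels {k k′ : s} (k≢k′ : k ≢ k′) where

    third-point : ∀ {y m} q → IΔ.Adjacent (inj₁ y) m → ∃[ q′ ] IΔ.Adjacent m q′ × q′ ≢ inj₁ y × q′ ≢ q
    third-point {y} q (pl {M = N} _)
      with avoid-two 𝒬._≟_ {at nothing} {at (just k)} {at (just k′)}
             (distinct (λ ())) (distinct (λ ())) (distinct (k≢k′ ∘ just-injective)) (inj₁ y) q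
      where
      at : Maybe s → Δ.Element
      at = inj₁ ∘ pointAt N
      distinct : ∀ {i j} → i ≢ j → at i ≢ at j
      distinct i≢j = i≢j ∘ pointAt-injective N ∘ inj₁-injective
    ... | inj₁ (≢y , ≢q)        = _ , lp (pointAt-I N _) , ≢y , ≢q
    ... | inj₂ (inj₁ (≢y , ≢q)) = _ , lp (pointAt-I N _) , ≢y , ≢q
    ... | inj₂ (inj₂ (≢y , ≢q)) = _ , lp (pointAt-I N _) , ≢y , ≢q

    Close : Δ.Point → Γ.Element → Set ℓ
    Close y z = g z ≡ inj₁ y ⊎ IΔ.Adjacent (inj₁ y) (g z)

    single-close : ∀ y → ∃[ z ] Single z × Close y z
    single-close y = let z , single , own = single-near y
                     in z , single , Folding.own-label y third-point (g z) own

    point-off : ∀ N → ∃[ y ] ¬ (y Δ.I N)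
    point-off N with two-points-on N
    -- Leave `N` at `y` along another line and take a further point on it; a return to `N` would
    -- close a digon.
    ... | y , _ , y∈N , _ with 𝒬.extend no-dead-end 2 (inj₂ N) (inj₁ y)
    ...   | _ , w@(Walks.step (pl _) _ (Walks.step (lp {x = z} _) _ Walks.stop)) = z , off
      where
      off : ¬ (z Δ.I N)
      off z∈N with 𝒬.NB-snoc w (pl z∈N)
      ... | inj₁ w′                     = 𝒬.girth (lp y∈N) w′ (s≤s (s≤s (s≤s (≤-trans (s≤s (s≤s z≤n)) (m≤n+m n q)))))
      ... | inj₂ (inj₂ (_ , refl , w′)) = 𝒬.girth (lp y∈N) w′ (s≤s (s≤s (s≤s z≤n)))

    not-close : ∀ {L} → Single (inj₂ L) → ∀ {y} → ¬ (y Δ.I onLines L) →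
                ∀ z → Single z → ¬ Close y z
    not-close {L} single {y} y∉L z single′ (inj₁ gz≡y) = single-line-isolated single single′
      (λ gz≡L → case trans (sym gz≡y) gz≡L of λ ()) (λ a → y∉L (on (subst (IΔ.Adjacent _) gz≡y a)))
      where
      on : ∀ {N} → IΔ.Adjacent (inj₂ N) (inj₁ y) → y Δ.I N
      on (lp i) = i
    not-close {L} single {y} y∉L (inj₂ M) single′ (inj₂ (pl y∈M)) = single-line-isolated single single′
      (λ gM≡L → y∉L (subst (y Δ.I_) (inj₂-injective gM≡L) y∈M)) λ ()

    -- For a point off `onLines L`, the single element near it is neither over that line nor over a
    -- point of it, which `single-line-isolated` excludes.
    no-single-line : ∀ L → ¬ Single (inj₂ L)
    no-single-line L single =
      let y , y∉L             = point-off (onLines L)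
          z , single′ , close = single-close y
      in not-close single y∉L z single′ close

    close-point : ∀ {y} z → Single z → Close y z → ∃[ x ] onPoints x ≡ y × Single (inj₁ x)
    close-point (inj₁ x) single (inj₁ eq) = x , inj₁-injective eq , single
    close-point (inj₂ M) single _         = ⊥-elim (no-single-line M single)

    single-point : ∀ y → ∃[ x ] onPoints x ≡ y × Single (inj₁ x)
    single-point y = let z , single , close = single-close y in close-point z single close

    -- With single lines excluded, every point of Δ has a one-element fibre. Two such points on a
    -- line would make the line over it single after all.
    no-line : ¬ Δ.Line
    no-line N =
      let y₀ , y₁ , y₀∈N , y₁∈N , y₀≢y₁ = two-points-on N
          M , M↦N = lines-surjective N
      in join (single-point y₀) (single-point y₁) y₀∈N y₁∈N y₀≢y₁ M↦N
      where
      join : ∀ {y₀ y₁ M} → ∃[ x ] onPoints x ≡ y₀ × Single (inj₁ x) →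
             ∃[ x ] onPoints x ≡ y₁ × Single (inj₁ x) →
             y₀ Δ.I N → y₁ Δ.I N → y₀ ≢ y₁ → onLines M ≡ N → ⊥
      join (x₀ , refl , single₀) (x₁ , refl , single₁) y₀∈N y₁∈N y₀≢y₁ M↦N =
        no-single-line _ (joining-line-single y₀∈N y₁∈N single₀ single₁
          (λ x₁≡x₀ → y₀≢y₁ (cong onPoints (sym x₁≡x₀))) M↦N)

  -- The case s = 1

  -- Without lines Δ would have no points either and would be thick vacuously.
  some-line : Δ.Line
  some-line = decidable-stable em λ no-line → proj₂ thin-Δ
    ( (λ y → ⊥-elim (no-line (lineAt y nothing)))
    , (λ N → ⊥-elim (no-line N)))

  s-inhabited : s
  s-inhabited = decidable-stable em λ empty →
    let y , z , y∈ , z∈ , y≢z = two-points-on some-line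
        k , k↦y = Equivalence.to (proj₂ (proj₂ (proj₁ order some-line)) y) y∈
        l , l↦z = Equivalence.to (proj₂ (proj₂ (proj₁ order some-line)) z) z∈
    in y≢z (trans (sym k↦y) (trans (cong (pointAt some-line) (only empty k l)) l↦z))
    where
    only : ¬ s → ∀ (k l : Maybe s) → k ≡ l
    only empty nothing  nothing  = refl
    only empty (just k) _        = ⊥-elim (empty k)
    only empty nothing  (just l) = ⊥-elim (empty l)

  s-unique : ∀ (k l : s) → k ≡ l
  s-unique k l = decidable-stable em λ k≢l → TwoLabels.no-line k≢l some-line

  order-one : s ↔ Fin 1
  order-one = mk↔ₛ′ (λ _ → 0F) (λ _ → s-inhabited) (λ { 0F → refl ; (fsuc ()) }) (s-unique s-inhabited)

  two-points : ∀ {N y₁ y₂ y₃} → y₁ Δ.I N → y₂ Δ.I N → y₁ ≢ y₂ → y₃ Δ.I N → y₃ ≡ y₁ ⊎ y₃ ≡ y₂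
  two-points {N} i₁ i₂ y₁≢y₂ i₃ with index i₁ | index i₂ | index i₃
    where
    index : ∀ {y} → y Δ.I N → ∃[ k ] pointAt N k ≡ y
    index {y} = Equivalence.to (proj₂ (proj₂ (proj₁ order N)) y)
  ... | nothing , refl | nothing , refl | _              = ⊥-elim (y₁≢y₂ refl)
  ... | just k  , refl | just l  , refl | _              = ⊥-elim (y₁≢y₂ (cong (pointAt N ∘ just) (s-unique k l)))
  ... | nothing , refl | just l  , refl | nothing , refl = inj₁ refl
  ... | nothing , refl | just l  , refl | just m  , refl = inj₂ (cong (pointAt N ∘ just) (s-unique m l))
  ... | just k  , refl | nothing , refl | nothing , refl = inj₂ refl
  ... | just k  , refl | nothing , refl | just m  , refl = inj₁ (cong (pointAt N ∘ just) (s-unique m k))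

  lift-line : ∀ {x N} → onPoints x Δ.I N → ∃[ M ] x Γ.I M × onLines M ≡ N
  lift-line {x} i with lift {inj₁ x} (pl i)
  ... | inj₂ M , IΓ.pl x∈M , eq = M , x∈M , inj₂-injective eq

  lift-point : ∀ {M y} → y Δ.I onLines M → ∃[ x ] x Γ.I M × onPoints x ≡ y
  lift-point {M} i with lift {inj₂ M} (lp i)
  ... | inj₁ x , IΓ.lp x∈M , eq = x , x∈M , inj₁-injective eq

  module Covers (G : OrdinaryGon Δ n) (i₀ : Fin n) where
    open OrdinaryGon G

    -- Each element of Δ now has just two neighbours, and those of an element of `G` belong to `G`.
    -- By connectedness `G` is all of Δ.
    closed : ∀ {u w} → _LiesIn_ Δ u G → IΔ.Adjacent u w → _LiesIn_ Δ w G
    closed (i , refl) (lp y∈) with two-points (point-I-line i) (next-I-line i)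
                                     (next-distinct i ∘ point-injective) y∈
    ... | inj₁ e = i , sym e
    ... | inj₂ e = next i , sym e
    closed (i , refl) (pl ∈N) with next-surjective i
    ... | j , refl with two-lines (next-I-line j) (point-I-line (next j)) (next-distinct j ∘ line-injective) ∈N
    ...   | inj₁ e = j , sym e
    ...   | inj₂ e = next j , sym e

    walk-closed : ∀ {u k w} → 𝒬.Walk u k w → _LiesIn_ Δ u G → _LiesIn_ Δ w G
    walk-closed Walks.nil     u∈ = u∈
    walk-closed (a Walks.∷ w) u∈ = walk-closed w (closed u∈ a)

    everything : ∀ w → _LiesIn_ Δ w G
    everything w = walk-closed (proj₂ (proj₂ (𝒬.diameter (inj₁ (point i₀)) w))) (i₀ , refl)

  Reaches : Fin n → Set
  Reaches t = ∀ i → ∃[ k ] iter next k t ≡ i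

  reaches-next : ∀ {t} → Reaches t → Reaches (next t)
  reaches-next {t} reaches i with next-surjective i
  ... | j , refl with reaches j
  ...   | k , refl = k , iter-comm next k t

  gon-through-line : ∀ {t} → Reaches t → ∀ N → ∃[ G ] N ≡ OrdinaryGon.line {Γ = Δ} G t ×
                     (∀ y → ∃[ i ] OrdinaryGon.point G i ≡ y)
  gon-through-line {t} reaches N with gon-at (inj₂ N)
  ... | G , i , refl with reaches i
  ...   | k , refl = rotate k G , refl , λ y → Covers.everything (rotate k G) t (inj₁ y)

  dual-gon-through-point : ∀ {t} → Reaches t → ∀ y → ∃[ G ] y ≡ OrdinaryGon.line {Γ = dual Δ} G t ×
                           (∀ N → ∃[ i ] OrdinaryGon.point G i ≡ N)
  dual-gon-through-point {t} reaches y with gon-at (inj₁ y)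
  -- Line `t` of the dual gon is point `next t` of the rotated one, so the rotation has to take
  -- `next t` to `i`.
  ... | G , i , refl with reaches-next reaches i
  ...   | k , refl = dualGon {Γ = dual Δ} (rotate k G) , refl ,
                     λ N → Covers.everything (rotate k G) t (inj₂ N)

  single-type : ∀ {α β} {A : Set α} {B : Set β} {t} → Reaches t →
    (∀ {L} → (∀ {M} → onLines M ≡ onLines L → L ≡ M) → (G : OrdinaryGon Δ n) →
       onLines L ≡ OrdinaryGon.line G t → (∀ y → ∃[ i ] OrdinaryGon.point G i ≡ y) → A) →
    (∀ {x} → (∀ {z} → onPoints z ≡ onPoints x → x ≡ z) → (G : OrdinaryGon (dual Δ) n) →
       onPoints x ≡ OrdinaryGon.line G t → (∀ N → ∃[ i ] OrdinaryGon.point G i ≡ N) → B) →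
    A ⊎ B
  single-type {A = A} {B} {t} reaches typeA typeB =
    let z , single , _ = single-near (proj₁ (two-points-on some-line)) in at z single
    where
    at : ∀ z → Single z → A ⊎ B
    at (inj₂ L) single =
      let G , L↦ , all = gon-through-line reaches (onLines L)
      in inj₁ (typeA (λ {M} eq → sym (inj₂-injective (single (inj₂ M) (cong inj₂ eq)))) G L↦ all)
    at (inj₁ x) single =
      let G , x↦ , all = dual-gon-through-point reaches (onPoints x)
      in inj₂ (typeB (λ {z} eq → sym (inj₁-injective (single (inj₁ z) (cong inj₁ eq)))) G x↦ all)

theorem6p3 : ∀ {ℓ : Level} → ExcludedMiddle (lsuc ℓ) →
    (n : ℕ) → n ≡ 4 ⊎ n ≡ 6 →
    (Γ : Geometry ℓ) → IsThickPolygon Γ n → LocallyFinitelyChained Γ n →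
    (Δ : Geometry ℓ) → IsThinPolygon Δ n →
    (s : Set ℓ) → HasOrder Δ s (Fin 1) →
    (γ : Epimorphism Γ Δ) →
    (s ↔ Fin 1) × (TypeA γ n ⊎ TypeB γ n)
theorem6p3 em .4 (inj₁ refl) Γ thick chained Δ thin s order γ =
  -- Here `cycle-reach` serves the `2 + 2` indices of the quadrangle instead of the `2n` colours.
  -- The single line is to be `ab`, line `0F`.
  order-one , single-type (λ i → let k , _ , eq = cycle-reach 1 i in k , sym eq)
    (λ single G L↦ all → quadrangle
      (SingleLine.quadrangle-type γ lift-line lift-point two-lines two-points single G L↦ all))
    (λ single G x↦ all → quadrangle
      (SingleLine.quadrangle-type (dualEpi γ) lift-point lift-line two-points two-lines single G x↦ all))
  where open Classification em thick chained thin order γ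
theorem6p3 em .6 (inj₂ refl) Γ thick chained Δ thin s order γ =
  -- In the hexagon the single line is to be `bc`, so the base index is `1F`, the successor of `0F`.
  order-one , single-type (reaches-next λ i → let k , _ , eq = cycle-reach 2 i in k , sym eq)
    (λ single G L↦ all → hexagon
      (SingleLine.hexagon-type γ lift-line lift-point two-lines two-points single G L↦ all))
    (λ single G x↦ all → hexagon
      (SingleLine.hexagon-type (dualEpi γ) lift-point lift-line two-points two-lines single G x↦ all))
  where open Classification em thick chained thin order γ
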